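{- Let $p\ge5$ be a prime with $p\equiv 2 \pmod 3$. Let $J\in\mathbb{F}_p$ with $J\neq\pm2,-1$, and put $C=3J^2-4$, $D=9J^3-36J-28$. The Vieta graph of the cubic $x^2+y^2+z^2=xyz-C(x+y+z)+D$ over $\mathbb{F}_p$ satisfies the following. (a) If $J^2\neq 4/3$: there are $p^2+1+2\sigma(J^2-4)p$ vertices in total, of which $3(p-4)$ are deficient; there are $3(p-5)$ vertices of degree $2$, $3$ of degree $1$, and $0$ of degree $0$. (b) If $J^2=4/3$: there are $p^2+1-2\sigma(2)p$ vertices in total, of which $3(p-3)$ are deficient; there are $3(p-3)$ vertices of degree $2$, $0$ of degree $1$, and $0$ of degree $0$.
   Context: $\sigma:\mathbb{F}_p\to\{ -1,0,1\}\subset\mathbb{Z}$ denotes the quadratic character: $\sigma(a)=1$ if $a$ is a nonzero square, $\sigma(a)=-1$ if $a$ is a non-square, $\sigma(0)=0$. The Vieta graph of the equation $x^2+y^2+z^2=xyz-C(x+y+z)+D$ over $\mathbb{F}_p$ is the finite simple graph whose vertices are the solutions $(x,y,z)\in\mathbb{F}_p^3$, where two distinct vertices are joined by an edge whenever one is a Vieta flip of the other. The Vieta flips of $(x,y,z)$ are $(yz-C-x,y,z)$, $(x,xz-C-y,z)$, $(x,y,xy-C-z)$. Every vertex has degree at most $3$; a vertex is deficient if its degree is less than $3$. -}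

module Defs where

open import Data.Bool.Base using (if_then_else_)
open import Data.Fin.Base using (Fin; toℕ)
open import Data.Fin.Properties using (_≟_; any?)
open import Data.Integer.Base using (ℤ; 0ℤ; 1ℤ; -1ℤ)
open import Data.List.Base using (List; []; _∷_; length; filter; allFin; cartesianProduct)
open import Data.List.Membership.Propositional using (_∈_)
import Data.List.Membership.DecPropositional as DecMembership
open import Data.List.Relation.Unary.Unique.Propositional using (Unique)
import Data.List.Relation.Unary.Unique.Propositional.Properties as Unique
open import Data.Nat.Base as ℕ using (ℕ; NonZero)
open import Data.Nat.DivMod using (_mod_)
import Data.Nat.Properties as ℕ
open import Data.Product.Base using (_×_; _,_; proj₁)
open import Data.Product.Properties using (≡-dec)
open import Data.Sum.Base using (_⊎_; swap)
open import Relation.Binary.Core using (Rel)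
open import Relation.Binary.Definitions using (Decidable; DecidableEquality; Symmetric; Irreflexive)
open import Relation.Binary.PropositionalEquality.Core using (_≡_; _≢_; ≢-sym)
import Relation.Unary as Unary
open import Relation.Nullary.Decidable using (does; ¬?; _×-dec_; _⊎-dec_)
open import Level using (0ℓ)

-- ℤ/p by its representatives 0, …, p-1; it is the field of p elements
-- when p is prime.
𝔽 : ℕ → Set
𝔽 p = Fin p

module _ {p : ℕ} .{{_ : NonZero p}} where

  infix  8 ⊝_
  infixl 7 _⊗_
  infixl 6 _⊕_ _⊖_

  ⟦_⟧ : ℕ → 𝔽 p
  ⟦ n ⟧ = n mod p

  _⊕_ _⊗_ _⊖_ : 𝔽 p → 𝔽 p → 𝔽 p
  ⊝_ : 𝔽 p → 𝔽 p
  a ⊕ b = ⟦ toℕ a ℕ.+ toℕ b ⟧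
  a ⊗ b = ⟦ toℕ a ℕ.* toℕ b ⟧
  ⊝ a   = ⟦ p ℕ.∸ toℕ a ⟧
  a ⊖ b = a ⊕ (⊝ b)

  σ : 𝔽 p → ℤ
  σ a = if does (a ≟ ⟦ 0 ⟧) then 0ℤ
        else if does (any? λ b → b ⊗ b ≟ a) then 1ℤ
        else -1ℤ

-- The vertices are the entries of the duplicate-free list `vertices`; the
-- adjacency relation matters only between members of that list.
record FiniteSimpleGraph : Set₁ where
  infix 4 _~_ _~?_
  field
    Carrier  : Set
    vertices : List Carrier
    unique   : Unique vertices
    _~_      : Rel Carrier 0ℓ
    ~-sym    : Symmetric _~_
    ~-irrefl : Irreflexive _≡_ _~_
    _~?_     : Decidable _~_

  degree : Carrier → ℕ
  degree v = length (filter (v ~?_) vertices)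

  Deficient : Carrier → Set
  Deficient v = degree v ℕ.< 3

  deficient? : Unary.Decidable Deficient
  deficient? v = degree v ℕ.<? 3

  #vertices : ℕ
  #vertices = length vertices

  #deficient : ℕ
  #deficient = length (filter deficient? vertices)

  #ofDegree : ℕ → ℕ
  #ofDegree k = length (filter (λ v → degree v ℕ.≟ k) vertices)

module _ {p : ℕ} .{{_ : NonZero p}} where

  Triple : Set
  Triple = 𝔽 p × 𝔽 p × 𝔽 p

  _≟ₜ_ : DecidableEquality Triple
  _≟ₜ_ = ≡-dec _≟_ (≡-dec _≟_ _≟_)

  open DecMembership _≟ₜ_ using (_∈?_)

  allTriples : List Triple
  allTriples = cartesianProduct (allFin p) (cartesianProduct (allFin p) (allFin p))

  allTriples-unique : Unique allTriples
  allTriples-unique =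
    Unique.cartesianProduct⁺ (Unique.allFin⁺ p)
      (Unique.cartesianProduct⁺ (Unique.allFin⁺ p) (Unique.allFin⁺ p))

  module _ (C D : 𝔽 p) where

    Solution : Triple → Set
    Solution (x , y , z) =
      x ⊗ x ⊕ y ⊗ y ⊕ z ⊗ z ≡ x ⊗ y ⊗ z ⊖ C ⊗ (x ⊕ y ⊕ z) ⊕ D

    solution? : Unary.Decidable Solution
    solution? (x , y , z) = _ ≟ _

    flips : Triple → List Triple
    flips (x , y , z) = (y ⊗ z ⊖ C ⊖ x , y , z)
                      ∷ (x , x ⊗ z ⊖ C ⊖ y , z)
                      ∷ (x , y , x ⊗ y ⊖ C ⊖ z)
                      ∷ []

    Edge : Rel Triple 0ℓ
    Edge v w = v ≢ w × (w ∈ flips v ⊎ v ∈ flips w)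

    edge? : Decidable Edge
    edge? v w = ¬? (v ≟ₜ w) ×-dec ((w ∈? flips v) ⊎-dec (v ∈? flips w))

    vietaGraph : FiniteSimpleGraph
    vietaGraph = record
      { Carrier  = Triple
      ; vertices = filter solution? allTriples
      ; unique   = Unique.filter⁺ solution? allTriples-unique
      ; _~_      = Edge
      ; ~-sym    = λ (v≢w , f) → ≢-sym v≢w , swap f
      ; ~-irrefl = λ v≡w e → proj₁ e v≡w
      ; _~?_     = edge?
      }

{-# OPTIONS --safe #-}
-- Vertices.  For fixed x and y the equation is quadratic in z, so the number of
-- solutions is the sum over x and y of 1 + σ(q), q the discriminant in z.  As a
-- polynomial in y, q has leading coefficient x² - 4 and discriminant 16 (x + 2) P(x)
-- with a cubic P, so only x = ±2 and the roots of P contribute to the sum more than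
-- the generic - σ(x² - 4).  Let e³ = (J - 2) / (J + 1), which is solvable because cubing
-- is bijective when p ≡ 2 (mod 3).  Cardano's formula gives a root of P in terms of e,
-- and it is the only root because -3 is not a square.
--
-- Degrees.  The degree of a vertex is 3 minus the number of flips that fix it.  The
-- vertices fixed by one flip form a curve which is birational to a curve
-- 3 s² = (J + 1) + (J - 2) (t - 1)³.  Since cubing is bijective, every s determines t,
-- and exactly three values of s give no vertex.  A vertex fixed by the first two flips
-- has x = y and P(z) = 0; no vertex is fixed by all three.
module Submission where

open import Defs
open import Data.Nat.Base as ℕ using (ℕ; NonZero; _≤_; _∸_; zero; suc)
open import Data.Nat.DivMod using (_%_; _/_; m≡m%n+[m/n]*n; %-distribˡ-+; %-distribˡ-*; m<n⇒m%n≡m; n%n≡0)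
open import Data.Nat.Primality using (Prime; euclidsLemma)
open import Data.Integer.Base as ℤ using (ℤ; +_; -[1+_]; 0ℤ; 1ℤ; -1ℤ)
open import Data.Product.Base using (_×_; _,_; ∃; proj₁; proj₂)
open import Relation.Binary.PropositionalEquality hiding ([_])

open import Algebra.Bundles using (AbelianGroup; CommutativeRing; CommutativeSemiring)
import Algebra.Properties.AbelianGroup
import Algebra.Properties.CommutativeMonoid.Sum as MonoidSum
import Algebra.Properties.CommutativeSemiring.Exp as Exp
import Algebra.Properties.Group as GroupProperties
import Algebra.Properties.Ring
import Algebra.Properties.Semiring.Sum as SemiringSum
import Algebra.Solver.Ring as RingSolver
open import Algebra.Solver.Ring.AlmostCommutativeRing using (fromCommutativeRing; _-Raw-AlmostCommutative⟶_)
open import Data.Bool.Base using (Bool; true; false; T; if_then_else_)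
open import Data.Fin.Base using (Fin; toℕ; zero; suc)
open import Data.Fin.Permutation using (Permutation; permutation)
open import Data.Fin.Properties using (toℕ-injective; toℕ-fromℕ<; toℕ<n; toℕ≤n; _≟_; any?)
import Data.Integer.Properties as ℤ
import Data.Integer.Tactic.RingSolver as ℤ-Solver
open import Data.List.Base as List
  using (List; []; _∷_; length; filter; map; tabulate; _++_; allFin; cartesianProduct)
open import Data.List.Membership.Propositional using (_∈_)
open import Data.List.Membership.Propositional.Properties
  using (∈-map⁺; ∈-map⁻; ∈-filter⁺; ∈-filter⁻; ∈-allFin; ∈-cartesianProduct⁺)
open import Data.List.Membership.Propositional.Properties.WithK using (unique∧set⇒bag)
open import Data.List.Properties using (filter-++; length-++; length-map; length-tabulate)
open import Data.List.Relation.Binary.BagAndSetEquality using (∼bag⇒↭)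
open import Data.List.Relation.Binary.Permutation.Propositional.Properties using (↭-length)
open import Data.List.Relation.Unary.All as All using ([]; _∷_)
import Data.List.Relation.Unary.All.Properties as All
open import Data.List.Relation.Unary.AllPairs using (AllPairs; []; _∷_)
open import Data.List.Relation.Unary.Any using (here; there)
open import Data.List.Relation.Unary.Unique.Propositional using (Unique)
import Data.List.Relation.Unary.Unique.Propositional.Properties as Unique
import Data.Maybe.Base as Maybe
open import Data.Maybe.Base using (just; is-just)
open import Data.Nat.Coprimality as Coprime using (prime⇒coprime; coprime-Bézout)
open import Data.Nat.Divisibility using (_∣_; ∣⇒≤; m%n≡0⇒n∣m)
open import Data.Nat.GCD using (module Bézout)
import Data.Nat.Properties as ℕ
import Data.Nat.Tactic.RingSolver as ℕ-Solver
open import Data.Sum.Base as Sum using (_⊎_; inj₁; [_,_]′)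
open import Data.Vec.Base as Vec using (Vec; []; _∷_)
open import Function.Base using (_∘_; case_of_)
open import Function.Bundles using (mk⇔)
open import Relation.Nullary.Decidable
  using (Dec; yes; no; does; does-⇔; dec-true; dec-false; dec⇒maybe; ¬?; _×-dec_)
open import Relation.Nullary.Negation using (¬_; contradiction)
import Relation.Unary as Unary
open import Relation.Unary.Properties using (_∩?_)

-- The conditions on J keep the formulas nondegenerate: J ≠ ±2 gives P(-2) ≠ 0 and keeps the
-- coordinates y and z of a vertex fixed by the first flip away from -2, while J ≠ -1 makes e exist
-- and excludes a vertex fixed by all three flips. The term 2 σ(J² - 4) p arises because the two
-- exceptional slices, x = -2 and x = the root of P, contribute equally: J and the root are rational
-- functions of e, and root² - 4 differs from J² - 4 by a square factor. If J² = 4/3, then C = 0 and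
-- P = (x - 2)(x² - D) with D not a square. The root is then x = 2, where x² - 4 vanishes as well;
-- this slice still contributes p σ(-2) = p σ(J² - 4), and σ(-2) = -σ(2) because 3 = (2/J)² is a
-- square while -3 is not. A vertex fixed by two flips would now need z² = D, so the vertices of
-- degree 1 disappear.

-- Syntax of polynomial equations

Curried : Set → Set → ℕ → Set
Curried X A zero    = A
Curried X A (suc n) = X → Curried X A n

uncurry : ∀ {X A n} → Curried X A n → Vec X n → A
uncurry f []       = f
uncurry f (x ∷ xs) = uncurry (f x) xs

infix  10 #_
infix  9 :-_
infixl 8 _:*_
infixl 7 _:+_ _:-_
infix  5 _:=_

-- Unlike the polynomials of Algebra.Solver.Ring these do not have the ring as a parameter,
-- so that p is not inferred by unifying rings, which is very slow.
data Expr (n : ℕ) : Set where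
  var       : Fin n → Expr n
  #_        : ℕ → Expr n
  _:+_ _:*_ : Expr n → Expr n → Expr n
  :-_       : Expr n → Expr n

_:-_ : ∀ {n} → Expr n → Expr n → Expr n
a :- b = a :+ :- b

record Equation (n : ℕ) : Set where
  constructor _:=_
  field lhs rhs : Expr n

open Equation

-- Functions of n expressions stand for expressions in n variables.
Exprs : ℕ → Set → Set
Exprs n A = Curried (Expr n) A n

close : ∀ n {A : Set} → Exprs n A → A
close n f = uncurry f (Vec.map var (Vec.allFin n))

-- The commutative ring 𝔽 p and polynomial identities in it

module _ {p : ℕ} .{{_ : NonZero p}} where

  private F = 𝔽 p

  ⟦⟧-cong : ∀ {m n} → m % p ≡ n % p → ⟦_⟧ {p} m ≡ ⟦ n ⟧
  ⟦⟧-cong eq = toℕ-injective (trans (toℕ-fromℕ< _) (trans eq (sym (toℕ-fromℕ< _))))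

  ⟦toℕ⟧ : (a : F) → ⟦ toℕ a ⟧ ≡ a
  ⟦toℕ⟧ a = toℕ-injective (trans (toℕ-fromℕ< _) (m<n⇒m%n≡m (toℕ<n a)))

  toℕ-⟦⟧ : ∀ m → toℕ (⟦_⟧ {p} m) ≡ m % p
  toℕ-⟦⟧ m = toℕ-fromℕ< _

  toℕ-0 : toℕ (⟦_⟧ {p} 0) ≡ 0
  toℕ-0 = trans (toℕ-⟦⟧ 0) (m<n⇒m%n≡m (ℕ.>-nonZero⁻¹ p))

  ⟦+⟧ : ∀ m n → ⟦ m ⟧ ⊕ ⟦ n ⟧ ≡ ⟦_⟧ {p} (m ℕ.+ n)
  ⟦+⟧ m n = ⟦⟧-cong (trans (cong₂ (λ a b → (a ℕ.+ b) % p) (toℕ-⟦⟧ m) (toℕ-⟦⟧ n)) (sym (%-distribˡ-+ m n p)))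

  ⟦*⟧ : ∀ m n → ⟦ m ⟧ ⊗ ⟦ n ⟧ ≡ ⟦_⟧ {p} (m ℕ.* n)
  ⟦*⟧ m n = ⟦⟧-cong (trans (cong₂ (λ a b → (a ℕ.* b) % p) (toℕ-⟦⟧ m) (toℕ-⟦⟧ n)) (sym (%-distribˡ-* m n p)))

  ⟦p⟧ : ⟦ p ⟧ ≡ ⟦_⟧ {p} 0
  ⟦p⟧ = ⟦⟧-cong (trans (n%n≡0 p) (sym (m<n⇒m%n≡m (ℕ.>-nonZero⁻¹ p))))

  ⊕-assoc : (a b c : F) → (a ⊕ b) ⊕ c ≡ a ⊕ (b ⊕ c)
  ⊕-assoc a b c = begin
    ⟦ toℕ a ℕ.+ toℕ b ⟧ ⊕ c                     ≡⟨ cong ((a ⊕ b) ⊕_) (⟦toℕ⟧ c) ⟨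
    ⟦ toℕ a ℕ.+ toℕ b ⟧ ⊕ ⟦ toℕ c ⟧             ≡⟨ ⟦+⟧ _ _ ⟩
    ⟦ toℕ a ℕ.+ toℕ b ℕ.+ toℕ c ⟧               ≡⟨ cong ⟦_⟧ (ℕ.+-assoc (toℕ a) _ _) ⟩
    ⟦ toℕ a ℕ.+ (toℕ b ℕ.+ toℕ c) ⟧             ≡⟨ ⟦+⟧ _ _ ⟨
    ⟦ toℕ a ⟧ ⊕ ⟦ toℕ b ℕ.+ toℕ c ⟧             ≡⟨ cong (_⊕ (b ⊕ c)) (⟦toℕ⟧ a) ⟩
    a ⊕ (b ⊕ c)                                 ∎
    where open ≡-Reasoning

  ⊗-assoc : (a b c : F) → (a ⊗ b) ⊗ c ≡ a ⊗ (b ⊗ c)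
  ⊗-assoc a b c = begin
    ⟦ toℕ a ℕ.* toℕ b ⟧ ⊗ c                     ≡⟨ cong ((a ⊗ b) ⊗_) (⟦toℕ⟧ c) ⟨
    ⟦ toℕ a ℕ.* toℕ b ⟧ ⊗ ⟦ toℕ c ⟧             ≡⟨ ⟦*⟧ _ _ ⟩
    ⟦ toℕ a ℕ.* toℕ b ℕ.* toℕ c ⟧               ≡⟨ cong ⟦_⟧ (ℕ.*-assoc (toℕ a) _ _) ⟩
    ⟦ toℕ a ℕ.* (toℕ b ℕ.* toℕ c) ⟧             ≡⟨ ⟦*⟧ _ _ ⟨
    ⟦ toℕ a ⟧ ⊗ ⟦ toℕ b ℕ.* toℕ c ⟧             ≡⟨ cong (_⊗ (b ⊗ c)) (⟦toℕ⟧ a) ⟩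
    a ⊗ (b ⊗ c)                                 ∎
    where open ≡-Reasoning

  ⊕-comm : (a b : F) → a ⊕ b ≡ b ⊕ a
  ⊕-comm a b = cong ⟦_⟧ (ℕ.+-comm (toℕ a) (toℕ b))

  ⊗-comm : (a b : F) → a ⊗ b ≡ b ⊗ a
  ⊗-comm a b = cong ⟦_⟧ (ℕ.*-comm (toℕ a) (toℕ b))

  ⊕-identityˡ : (a : F) → ⟦ 0 ⟧ ⊕ a ≡ a
  ⊕-identityˡ a = trans (cong (⟦ 0 ⟧ ⊕_) (sym (⟦toℕ⟧ a))) (trans (⟦+⟧ 0 (toℕ a)) (⟦toℕ⟧ a))

  ⊗-identityˡ : (a : F) → ⟦ 1 ⟧ ⊗ a ≡ a
  ⊗-identityˡ a = begin
    ⟦ 1 ⟧ ⊗ a           ≡⟨ cong (⟦ 1 ⟧ ⊗_) (⟦toℕ⟧ a) ⟨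
    ⟦ 1 ⟧ ⊗ ⟦ toℕ a ⟧   ≡⟨ ⟦*⟧ 1 (toℕ a) ⟩
    ⟦ 1 ℕ.* toℕ a ⟧     ≡⟨ cong ⟦_⟧ (ℕ.*-identityˡ (toℕ a)) ⟩
    ⟦ toℕ a ⟧           ≡⟨ ⟦toℕ⟧ a ⟩
    a                   ∎
    where open ≡-Reasoning

  ⊕-inverseʳ : (a : F) → a ⊕ ⊝ a ≡ ⟦ 0 ⟧
  ⊕-inverseʳ a = begin
    a ⊕ ⊝ a                             ≡⟨ cong (_⊕ ⊝ a) (⟦toℕ⟧ a) ⟨
    ⟦ toℕ a ⟧ ⊕ ⟦ p ℕ.∸ toℕ a ⟧         ≡⟨ ⟦+⟧ _ _ ⟩
    ⟦ toℕ a ℕ.+ (p ℕ.∸ toℕ a) ⟧         ≡⟨ cong ⟦_⟧ (ℕ.m+[n∸m]≡n (toℕ≤n a)) ⟩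
    ⟦ p ⟧                               ≡⟨ ⟦p⟧ ⟩
    ⟦ 0 ⟧                               ∎
    where open ≡-Reasoning

  ⊗-distribˡ-⊕ : (a b c : F) → a ⊗ (b ⊕ c) ≡ a ⊗ b ⊕ a ⊗ c
  ⊗-distribˡ-⊕ a b c = begin
    a ⊗ (b ⊕ c)                                      ≡⟨ cong (_⊗ (b ⊕ c)) (⟦toℕ⟧ a) ⟨
    ⟦ toℕ a ⟧ ⊗ ⟦ toℕ b ℕ.+ toℕ c ⟧                  ≡⟨ ⟦*⟧ _ _ ⟩
    ⟦ toℕ a ℕ.* (toℕ b ℕ.+ toℕ c) ⟧                  ≡⟨ cong ⟦_⟧ (ℕ.*-distribˡ-+ (toℕ a) _ _) ⟩
    ⟦ toℕ a ℕ.* toℕ b ℕ.+ toℕ a ℕ.* toℕ c ⟧          ≡⟨ ⟦+⟧ _ _ ⟨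
    a ⊗ b ⊕ a ⊗ c                                    ∎
    where open ≡-Reasoning

  𝔽-commutativeRing : CommutativeRing _ _
  𝔽-commutativeRing = record
    { Carrier = F ; _≈_ = _≡_ ; _+_ = _⊕_ ; _*_ = _⊗_ ; -_ = ⊝_ ; 0# = ⟦ 0 ⟧ ; 1# = ⟦ 1 ⟧
    ; isCommutativeRing = record
      { isRing = record
        { +-isAbelianGroup = record
          { isGroup = record
            { isMonoid = record
              { isSemigroup = record
                { isMagma = record { isEquivalence = isEquivalence ; ∙-cong = cong₂ _⊕_ }
                ; assoc = ⊕-assoc }
              ; identity = ⊕-identityˡ , λ a → trans (⊕-comm a _) (⊕-identityˡ a) }
            ; inverse = (λ a → trans (⊕-comm _ a) (⊕-inverseʳ a)) , ⊕-inverseʳ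
            ; ⁻¹-cong = cong ⊝_ }
          ; comm = ⊕-comm }
        ; *-cong = cong₂ _⊗_
        ; *-assoc = ⊗-assoc
        ; *-identity = ⊗-identityˡ , λ a → trans (⊗-comm a _) (⊗-identityˡ a)
        ; distrib = ⊗-distribˡ-⊕ , λ a b c →
            trans (⊗-comm _ a) (trans (⊗-distribˡ-⊕ a b c) (cong₂ _⊕_ (⊗-comm a b) (⊗-comm a c)))
        }
      ; *-comm = ⊗-comm } }

  module 𝔽 = CommutativeRing 𝔽-commutativeRing
  import Algebra.Properties.Ring 𝔽.ring as 𝔽-Prop
  import Algebra.Properties.AbelianGroup 𝔽.+-abelianGroup as 𝔽-AbelianGroup
  open ≡-Reasoning

  fromℤ : ℤ → F
  fromℤ (+ n)    = ⟦ n ⟧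
  fromℤ -[1+ n ] = ⊝ ⟦ suc n ⟧

  fromℤ-⊖ : ∀ m n → fromℤ (m ℤ.⊖ n) ≡ ⟦ m ⟧ ⊖ ⟦ n ⟧
  fromℤ-⊖ m       zero    = sym (trans (cong (⟦ m ⟧ ⊕_) 𝔽-Prop.-0#≈0#) (𝔽.+-identityʳ _))
  fromℤ-⊖ zero    (suc n) = sym (𝔽.+-identityˡ _)
  fromℤ-⊖ (suc m) (suc n) = begin
    fromℤ (suc m ℤ.⊖ suc n)                   ≡⟨ cong fromℤ (ℤ.[1+m]⊖[1+n]≡m⊖n m n) ⟩
    fromℤ (m ℤ.⊖ n)                           ≡⟨ fromℤ-⊖ m n ⟩
    ⟦ m ⟧ ⊖ ⟦ n ⟧                             ≡⟨ cong (_⊖ ⟦ n ⟧) (𝔽.+-identityˡ ⟦ m ⟧) ⟨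
    ⟦ 0 ⟧ ⊕ ⟦ m ⟧ ⊖ ⟦ n ⟧                     ≡⟨ cong (λ a → a ⊕ ⟦ m ⟧ ⊖ ⟦ n ⟧) (⊕-inverseʳ ⟦ 1 ⟧) ⟨
    ⟦ 1 ⟧ ⊖ ⟦ 1 ⟧ ⊕ ⟦ m ⟧ ⊖ ⟦ n ⟧             ≡⟨ cong (_⊖ ⟦ n ⟧)
        (trans (⊕-assoc ⟦ 1 ⟧ (⊝ ⟦ 1 ⟧) ⟦ m ⟧)
        (trans (cong (⟦ 1 ⟧ ⊕_) (⊕-comm (⊝ ⟦ 1 ⟧) ⟦ m ⟧)) (sym (⊕-assoc ⟦ 1 ⟧ ⟦ m ⟧ (⊝ ⟦ 1 ⟧))))) ⟩
    ⟦ 1 ⟧ ⊕ ⟦ m ⟧ ⊖ ⟦ 1 ⟧ ⊖ ⟦ n ⟧             ≡⟨ ⊕-assoc (⟦ 1 ⟧ ⊕ ⟦ m ⟧) (⊝ ⟦ 1 ⟧) (⊝ ⟦ n ⟧) ⟩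
    ⟦ 1 ⟧ ⊕ ⟦ m ⟧ ⊕ (⊝ ⟦ 1 ⟧ ⊖ ⟦ n ⟧)         ≡⟨ cong₂ _⊕_ (⟦+⟧ 1 m)
        (trans (𝔽-AbelianGroup.⁻¹-∙-comm ⟦ 1 ⟧ ⟦ n ⟧) (cong ⊝_ (⟦+⟧ 1 n))) ⟩
    ⟦ suc m ⟧ ⊖ ⟦ suc n ⟧                     ∎

  fromℤ-+ : ∀ i j → fromℤ (i ℤ.+ j) ≡ fromℤ i ⊕ fromℤ j
  fromℤ-+ (+ m)    (+ n)    = sym (⟦+⟧ m n)
  fromℤ-+ (+ m)    -[1+ n ] = fromℤ-⊖ m (suc n)
  fromℤ-+ -[1+ m ] (+ n)    = trans (fromℤ-⊖ n (suc m)) (⊕-comm ⟦ n ⟧ (⊝ ⟦ suc m ⟧))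
  fromℤ-+ -[1+ m ] -[1+ n ] = trans
    (cong ⊝_ (trans (cong (⟦_⟧ ∘ suc) (sym (ℕ.+-suc m n))) (sym (⟦+⟧ (suc m) (suc n)))))
    (sym (𝔽-AbelianGroup.⁻¹-∙-comm ⟦ suc m ⟧ ⟦ suc n ⟧))

  fromℤ-neg : ∀ i → fromℤ (ℤ.- i) ≡ ⊝ fromℤ i
  fromℤ-neg (+ zero)  = sym 𝔽-Prop.-0#≈0#
  fromℤ-neg (+ suc n) = refl
  fromℤ-neg -[1+ n ]  = sym (𝔽-Prop.-‿involutive _)

  fromℤ-*⁺ : ∀ m j → fromℤ (+ m ℤ.* j) ≡ ⟦ m ⟧ ⊗ fromℤ j
  fromℤ-*⁺ m (+ n)    = trans (cong fromℤ (sym (ℤ.pos-* m n))) (sym (⟦*⟧ m n))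
  fromℤ-*⁺ m -[1+ n ] = begin
    fromℤ (+ m ℤ.* ℤ.- (+ suc n))   ≡⟨ cong fromℤ (ℤ.neg-distribʳ-* (+ m) (+ suc n)) ⟨
    fromℤ (ℤ.- (+ m ℤ.* + suc n))   ≡⟨ fromℤ-neg (+ m ℤ.* + suc n) ⟩
    ⊝ fromℤ (+ m ℤ.* + suc n)       ≡⟨ cong ⊝_ (fromℤ-*⁺ m (+ suc n)) ⟩
    ⊝ (⟦ m ⟧ ⊗ ⟦ suc n ⟧)           ≡⟨ 𝔽-Prop.-‿distribʳ-* ⟦ m ⟧ ⟦ suc n ⟧ ⟩
    ⟦ m ⟧ ⊗ ⊝ ⟦ suc n ⟧             ∎

  fromℤ-* : ∀ i j → fromℤ (i ℤ.* j) ≡ fromℤ i ⊗ fromℤ j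
  fromℤ-* (+ m)    j = fromℤ-*⁺ m j
  fromℤ-* -[1+ m ] j = begin
    fromℤ (ℤ.- (+ suc m) ℤ.* j)     ≡⟨ cong fromℤ (ℤ.neg-distribˡ-* (+ suc m) j) ⟨
    fromℤ (ℤ.- (+ suc m ℤ.* j))     ≡⟨ fromℤ-neg (+ suc m ℤ.* j) ⟩
    ⊝ fromℤ (+ suc m ℤ.* j)         ≡⟨ cong ⊝_ (fromℤ-*⁺ (suc m) j) ⟩
    ⊝ (⟦ suc m ⟧ ⊗ fromℤ j)         ≡⟨ 𝔽-Prop.-‿distribˡ-* ⟦ suc m ⟧ (fromℤ j) ⟩
    ⊝ ⟦ suc m ⟧ ⊗ fromℤ j           ∎

  fromℤ-morphism : ℤ.+-*-rawRing -Raw-AlmostCommutative⟶ fromCommutativeRing 𝔽-commutativeRing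
  fromℤ-morphism = record
    { ⟦_⟧ = fromℤ ; +-homo = fromℤ-+ ; *-homo = fromℤ-* ; -‿homo = fromℤ-neg
    ; 0-homo = refl ; 1-homo = refl }

  -- The coefficients are integers, whose equality is decided by evaluation, so that an identity is
  -- checked uniformly in the unknown p.
  module Solver = RingSolver ℤ.+-*-rawRing (fromCommutativeRing 𝔽-commutativeRing) fromℤ-morphism
    (λ i j → Maybe.map (cong fromℤ) (dec⇒maybe (i ℤ.≟ j)))
  private
    polynomial : ∀ {n} → Expr n → Solver.Polynomial n
    polynomial (var i)  = Solver.var i
    polynomial (# k)    = Solver.con (+ k)
    polynomial (a :+ b) = polynomial a Solver.:+ polynomial b
    polynomial (a :* b) = polynomial a Solver.:* polynomial b
    polynomial (:- a)   = Solver.:- polynomial a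

  eval : ∀ {n} → Vec F n → Expr n → F
  eval ρ (var i)  = Vec.lookup ρ i
  eval ρ (# k)    = ⟦ k ⟧
  eval ρ (a :+ b) = eval ρ a ⊕ eval ρ b
  eval ρ (a :* b) = eval ρ a ⊗ eval ρ b
  eval ρ (:- a)   = ⊝ eval ρ a

  Valid : ∀ {n} → Equation n → Set
  Valid (l := r) = T (is-just (Solver.normalise (polynomial l) Solver.≟N Solver.normalise (polynomial r)))

  Holds : ∀ {n} → Vec F n → Equation n → Set
  Holds ρ (l := r) = eval ρ l ≡ eval ρ r

  abstract
    private
      eval-polynomial : ∀ {n} (ρ : Vec F n) e → Solver.⟦ polynomial e ⟧ ρ ≡ eval ρ e
      eval-polynomial ρ (var i)  = refl
      eval-polynomial ρ (# k)    = refl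
      eval-polynomial ρ (a :+ b) = cong₂ _⊕_ (eval-polynomial ρ a) (eval-polynomial ρ b)
      eval-polynomial ρ (a :* b) = cong₂ _⊗_ (eval-polynomial ρ a) (eval-polynomial ρ b)
      eval-polynomial ρ (:- a)   = cong ⊝_ (eval-polynomial ρ a)

      eval-normalise : ∀ {n} (ρ : Vec F n) e → Solver.⟦ Solver.normalise (polynomial e) ⟧N ρ ≡ eval ρ e
      eval-normalise ρ e = trans (Solver.correct (polynomial e) ρ) (eval-polynomial ρ e)

    valid⇒holds : ∀ {n} (ρ : Vec F n) (eq : Equation n) → Valid eq → Holds ρ eq
    valid⇒holds ρ (l := r) ok with Solver.normalise (polynomial l) Solver.≟N Solver.normalise (polynomial r)
    ... | just l≈r = trans (sym (eval-normalise ρ l)) (trans (Solver.⟦ l≈r ⟧N-cong ρ) (eval-normalise ρ r))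

  -- For a concrete identity that holds over ℤ, `Valid eq` evaluates to the unit type, so the
  -- implicit argument is filled in by eta. The vector `ρ` only supplies the field elements.
  identity : ∀ {n} (ρ : Vec F n) (f : Exprs n (Equation n)) →
    let eq = close n {Equation n} f in {Valid eq} → Holds ρ eq
  identity {n} ρ f {ok} = valid⇒holds ρ (close n {Equation n} f) ok

  ⊕-cancelled : ∀ {a b l r : F} q → a ≡ b ⊕ q ⊗ (l ⊖ r) → l ≡ r → a ≡ b
  ⊕-cancelled {b = b} {l} q a≡ refl = trans a≡
      (trans (cong (b ⊕_) (trans (cong (q ⊗_) (⊕-inverseʳ l)) (𝔽.zeroʳ q))) (𝔽.+-identityʳ b))

  -- The last equation a = b follows from l = r since a - b = q (l - r) as polynomials over ℤ.
  Combination Combination₂ : ℕ → Set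
  Combination n  = Expr n × Equation n × Equation n
  Combination₂ n = Expr n × Equation n × Combination n

  linear-combination : ∀ {n} (ρ : Vec F n) (f : Exprs n (Combination n)) →
    let q , eq , goal = close n {Combination n} f in
    {Valid (lhs goal := rhs goal :+ q :* (lhs eq :- rhs eq))} → Holds ρ eq → Holds ρ goal
  linear-combination {n} ρ f {ok} = let q , eq , goal = close n {Combination n} f in
    ⊕-cancelled (eval ρ q) (valid⇒holds ρ (lhs goal := rhs goal :+ q :* (lhs eq :- rhs eq)) ok)

  linear-combination₂ : ∀ {n} (ρ : Vec F n) (f : Exprs n (Combination₂ n)) →
    let q₁ , eq₁ , q₂ , eq₂ , goal = close n {Combination₂ n} f in
    {Valid (lhs goal := rhs goal :+ q₂ :* (lhs eq₂ :- rhs eq₂) :+ q₁ :* (lhs eq₁ :- rhs eq₁))} →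
    Holds ρ eq₁ → Holds ρ eq₂ → Holds ρ goal
  linear-combination₂ {n} ρ f {ok} h₁ h₂ = let q₁ , eq₁ , q₂ , eq₂ , goal = close n {Combination₂ n} f in
    ⊕-cancelled (eval ρ q₂) (⊕-cancelled (eval ρ q₁)
      (valid⇒holds ρ (lhs goal := rhs goal :+ q₂ :* (lhs eq₂ :- rhs eq₂) :+ q₁ :* (lhs eq₁ :- rhs eq₁)) ok) h₁) h₂

  ⊖≡0⇒≡ : ∀ {a b : F} → a ⊖ b ≡ ⟦ 0 ⟧ → a ≡ b
  ⊖≡0⇒≡ {a} {b} h = trans (identity (a ∷ b ∷ []) λ a b → a := b :+ (a :- b)) (trans (cong (b ⊕_) h) (𝔽.+-identityʳ b))

-- 𝔽 p as a field

module _ {p : ℕ} .{{nz : NonZero p}} where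

  ⟦⟧≡0⇒∣ : ∀ n → ⟦_⟧ {p} n ≡ ⟦ 0 ⟧ → p ∣ n
  ⟦⟧≡0⇒∣ n eq = m%n≡0⇒n∣m n p (trans (sym (toℕ-⟦⟧ n)) (trans (cong toℕ eq) toℕ-0))

  ⟦⟧≢0 : ∀ n .{{_ : NonZero n}} → n ℕ.< p → ⟦_⟧ {p} n ≢ ⟦ 0 ⟧
  ⟦⟧≢0 n n<p eq = ℕ.<⇒≱ n<p (∣⇒≤ (⟦⟧≡0⇒∣ n eq))

module _ {p : ℕ} .{{nz : NonZero p}} (pr : Prime p) where
  private F = 𝔽 p

  ⊗≡0 : (a b : F) → a ⊗ b ≡ ⟦ 0 ⟧ → a ≡ ⟦ 0 ⟧ ⊎ b ≡ ⟦ 0 ⟧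
  ⊗≡0 a b eq = Sum.map (zero-of a) (zero-of b) (euclidsLemma (toℕ a) (toℕ b) pr (⟦⟧≡0⇒∣ _ eq))
    where
    zero-of : (c : F) → p ∣ toℕ c → c ≡ ⟦ 0 ⟧
    zero-of c p∣c with toℕ c in eq
    ... | zero  = toℕ-injective (trans eq (sym toℕ-0))
    ... | suc n = contradiction (∣⇒≤ p∣c) (ℕ.<⇒≱ (subst (ℕ._< p) eq (toℕ<n c)))

  ⊗≢0 : {a b : F} → a ≢ ⟦ 0 ⟧ → b ≢ ⟦ 0 ⟧ → a ⊗ b ≢ ⟦ 0 ⟧
  ⊗≢0 {a} {b} a≢0 b≢0 eq = [ a≢0 , b≢0 ]′ (⊗≡0 a b eq)

  ⊗-cancelˡ : {a b c : F} → a ≢ ⟦ 0 ⟧ → a ⊗ b ≡ a ⊗ c → b ≡ c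
  ⊗-cancelˡ {a} {b} {c} a≢0 eq =
    [ (λ a≡0 → contradiction a≡0 a≢0) , (λ b≡c → ⊖≡0⇒≡ b≡c) ]′
      (⊗≡0 a (b ⊖ c) (linear-combination (a ∷ b ∷ c ∷ [])
        (λ a b c → # 1 , a :* b := a :* c , a :* (b :- c) := # 0) eq))

  private
    ⟦*p⟧ : ∀ y → ⟦ y ℕ.* p ⟧ ≡ ⟦_⟧ {p} 0
    ⟦*p⟧ y = trans (sym (⟦*⟧ y p)) (trans (cong (⟦ y ⟧ ⊗_) ⟦p⟧) (lem ⟦ y ⟧))
      where
      lem : (y : F) → y ⊗ ⟦ 0 ⟧ ≡ ⟦ 0 ⟧
      lem y = identity (y ∷ []) (λ y → y :* # 0 := # 0)

    bézout-inverse : ∀ {n} → Bézout.Identity 1 n p → ∃ λ b → ⟦ n ⟧ ⊗ b ≡ ⟦ 1 ⟧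
    bézout-inverse {n} (Bézout.+- x y 1+yp≡xn) = ⟦ x ⟧ , (begin
      ⟦ n ⟧ ⊗ ⟦ x ⟧               ≡⟨ ⟦*⟧ n x ⟩
      ⟦ n ℕ.* x ⟧                 ≡⟨ cong ⟦_⟧ (trans (ℕ.*-comm n x) (sym 1+yp≡xn)) ⟩
      ⟦ 1 ℕ.+ y ℕ.* p ⟧           ≡⟨ ⟦+⟧ 1 (y ℕ.* p) ⟨
      ⟦ 1 ⟧ ⊕ ⟦ y ℕ.* p ⟧         ≡⟨ cong (⟦ 1 ⟧ ⊕_) (⟦*p⟧ y) ⟩
      ⟦ 1 ⟧ ⊕ ⟦ 0 ⟧               ≡⟨ ⟦+⟧ 1 0 ⟩
      ⟦ 1 ⟧                       ∎)
      where open ≡-Reasoning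
    bézout-inverse {n} (Bézout.-+ x y 1+xn≡yp) = ⊝ ⟦ x ⟧ , lem ⟦ n ⟧ ⟦ x ⟧ (begin
      ⟦ 1 ⟧ ⊕ ⟦ x ⟧ ⊗ ⟦ n ⟧       ≡⟨ cong (⟦ 1 ⟧ ⊕_) (⟦*⟧ x n) ⟩
      ⟦ 1 ⟧ ⊕ ⟦ x ℕ.* n ⟧         ≡⟨ ⟦+⟧ 1 (x ℕ.* n) ⟩
      ⟦ 1 ℕ.+ x ℕ.* n ⟧           ≡⟨ cong ⟦_⟧ 1+xn≡yp ⟩
      ⟦ y ℕ.* p ⟧                 ≡⟨ ⟦*p⟧ y ⟩
      ⟦ 0 ⟧                       ∎)
      where
      open ≡-Reasoning
      lem : (a x : F) → ⟦ 1 ⟧ ⊕ x ⊗ a ≡ ⟦ 0 ⟧ → a ⊗ ⊝ x ≡ ⟦ 1 ⟧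
      lem a x h = linear-combination (a ∷ x ∷ [])
        (λ a x → :- # 1 , # 1 :+ x :* a := # 0 , a :* :- x := # 1) h

  toℕ≢0 : {a : F} → a ≢ ⟦ 0 ⟧ → NonZero (toℕ a)
  toℕ≢0 a≢0 = ℕ.≢-nonZero λ eq → a≢0 (toℕ-injective (trans eq (sym toℕ-0)))

  inverse : (a : F) → a ≢ ⟦ 0 ⟧ → ∃ λ b → a ⊗ b ≡ ⟦ 1 ⟧
  inverse a a≢0 = subst (λ a → ∃ λ b → a ⊗ b ≡ ⟦ 1 ⟧) (⟦toℕ⟧ a)
    (bézout-inverse (coprime-Bézout (Coprime.sym (prime⇒coprime pr {{toℕ≢0 a≢0}} (toℕ<n a)))))

  abstract
    -- The value 0 at 0 makes the function total, so that formulas with quotients can be written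
    -- before their denominators are known to be nonzero.
    inv : F → F
    inv a with a ≟ ⟦ 0 ⟧
    ... | yes _   = ⟦ 0 ⟧
    ... | no  a≢0 = proj₁ (inverse a a≢0)

    inv-inverse : {a : F} → a ≢ ⟦ 0 ⟧ → a ⊗ inv a ≡ ⟦ 1 ⟧
    inv-inverse {a} a≢0 with a ≟ ⟦ 0 ⟧
    ... | yes a≡0  = contradiction a≡0 a≢0
    ... | no  a≢0′ = proj₂ (inverse a a≢0′)

-- Fermat's theorem and cube roots

module 𝔽-Sum {p : ℕ} .{{_ : NonZero p}} = MonoidSum (CommutativeRing.*-commutativeMonoid (𝔽-commutativeRing {p}))
module 𝔽-Exp {p : ℕ} .{{_ : NonZero p}} = Exp (CommutativeRing.commutativeSemiring (𝔽-commutativeRing {p}))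
open 𝔽-Exp using () renaming (_^_ to _^F_)

scale-permutation : ∀ {p} .{{_ : NonZero p}} (a b : 𝔽 p) → a ⊗ b ≡ ⟦ 1 ⟧ → Permutation p p
scale-permutation {p} a b ab≡1 = permutation (a ⊗_) (b ⊗_)
  cancel cancel′
  where
  cancel : (x : 𝔽 p) → a ⊗ (b ⊗ x) ≡ x
  cancel x = linear-combination (a ∷ b ∷ x ∷ [])
    (λ a b x → x , a :* b := # 1 , a :* (b :* x) := x) ab≡1
  cancel′ : (x : 𝔽 p) → b ⊗ (a ⊗ x) ≡ x
  cancel′ x = linear-combination (b ∷ a ∷ x ∷ [])
    (λ b a x → x , a :* b := # 1 , b :* (a :* x) := x) ab≡1

-- Multiplication by a permutes the nonzero elements and multiplies each of them by a, so their
-- product, which is nonzero, cancels. Here `sum` belongs to the multiplicative monoid and is a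
-- product.
fermat : ∀ {p} .{{_ : NonZero p}} → Prime p → (a : 𝔽 p) → a ≢ ⟦ 0 ⟧ → a ^F (p ℕ.∸ 1) ≡ ⟦ 1 ⟧
fermat {p@(suc m)} pr a a≢0 with inverse pr a a≢0
... | b , ab≡1 = trans (sym K≡a^m)
    (⊗-cancelˡ pr (H≢0 (λ i → h i) h≢0)
    (trans (⊗-comm H K) (trans (sym H≡KH) (sym (trans (⊗-comm H ⟦ 1 ⟧) (⊗-identityˡ H))))))
  where
  open 𝔽-Sum {p}
  h k : 𝔽 p → 𝔽 p
  -- The factor 0 is replaced by 1, so that the product can run over all of `Fin p`; accordingly `k`
  -- is 1 at 0, which leaves p - 1 factors a.
  h zero    = ⟦ 1 ⟧
  h (suc i) = suc i
  k zero    = ⟦ 1 ⟧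
  k (suc i) = a
  H = sum h
  K = sum k
  K≡a^m : K ≡ a ^F m
  K≡a^m = trans (⊗-identityˡ (sum {m} (λ _ → a))) (sum-replicate m)
  h≢0 : ∀ i → h i ≢ ⟦ 0 ⟧
  h≢0 zero    eq = a≢0 (trans (sym (⊗-identityˡ a)) (trans (cong (_⊗ a) eq) (lem a)))
    where
    lem : (a : 𝔽 p) → ⟦ 0 ⟧ ⊗ a ≡ ⟦ 0 ⟧
    lem a = identity (a ∷ []) (λ a → # 0 :* a := # 0)
  h≢0 (suc i) ()
  H≢0 : ∀ {n} (f : Fin n → 𝔽 p) → (∀ i → f i ≢ ⟦ 0 ⟧) → sum f ≢ ⟦ 0 ⟧
  H≢0 {zero}  f f≢0 = h≢0 zero
  H≢0 {suc n} f f≢0 = ⊗≢0 pr (f≢0 zero) (H≢0 (f ∘ suc) (f≢0 ∘ suc))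
  hk : ∀ i → h (a ⊗ i) ≡ k i ⊗ h i
  hk zero    = trans (cong h (lem a)) (sym (⊗-identityˡ ⟦ 1 ⟧))
    where
    lem : (a : 𝔽 p) → a ⊗ ⟦ 0 ⟧ ≡ ⟦ 0 ⟧
    lem a = identity (a ∷ []) (λ a → a :* # 0 := # 0)
  hk (suc i) with a ⊗ suc i in eq
  ... | zero  = contradiction eq (⊗≢0 pr a≢0 (λ ()))
  ... | suc j = refl
  H≡KH : H ≡ K ⊗ H
  H≡KH = trans (sum-permute h (scale-permutation a b ab≡1)) (trans (sum-cong-≗ hk) (∑-distrib-+ k h))

module _ {p : ℕ} .{{nz : NonZero p}} (pr : Prime p) (p%3≡2 : p % 3 ≡ 2) where
  private
    F = 𝔽 p
    k = p / 3
    p≡ : p ≡ suc (suc (k ℕ.* 3))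
    p≡ = trans (m≡m%n+[m/n]*n p 3) (cong (ℕ._+ k ℕ.* 3) p%3≡2)

    0⊗ : (a : F) → ⟦ 0 ⟧ ⊗ a ≡ ⟦ 0 ⟧
    0⊗ a = identity (a ∷ []) (λ a → # 0 :* a := # 0)

    unit-power : (a : F) → a ≢ ⟦ 0 ⟧ → a ^F (suc (k ℕ.* 3)) ≡ ⟦ 1 ⟧
    unit-power a a≢0 = trans (cong (a ^F_) (sym (cong (ℕ._∸ 1) p≡))) (fermat pr a a≢0)

    1⊗1⊗ : (a : F) → ⟦ 1 ⟧ ⊗ (⟦ 1 ⟧ ⊗ (a ⊗ ⟦ 1 ⟧)) ≡ a
    1⊗1⊗ a = identity (a ∷ []) (λ a → # 1 :* (# 1 :* (a :* # 1)) := a)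

    -- With p = 3 k + 2 the exponent 3 (2 k + 1) equals 2 (p - 1) + 1. Hence raising to the power 2
    -- k + 1 inverts cubing.
    power-cycle : ∀ a → a ^F ((k ℕ.+ k ℕ.+ 1) ℕ.* 3) ≡ a
    power-cycle a with a ≟ ⟦ 0 ⟧
    -- Fermat's theorem does not cover 0; writing the exponent as a successor exposes a factor 0.
    ... | yes refl = trans (cong (λ n → ⟦ 0 ⟧ ^F (n ℕ.* 3)) (ℕ.+-comm (k ℕ.+ k) 1)) (0⊗ _)
    ... | no a≢0   = begin
      a ^F ((k ℕ.+ k ℕ.+ 1) ℕ.* 3)                                       ≡⟨ cong (a ^F_) (exponent k) ⟩
      a ^F (suc (k ℕ.* 3) ℕ.+ (suc (k ℕ.* 3) ℕ.+ 1))                     ≡⟨ 𝔽-Exp.^-homo-* a (suc (k ℕ.* 3)) _ ⟩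
      a ^F suc (k ℕ.* 3) ⊗ a ^F (suc (k ℕ.* 3) ℕ.+ 1)                    ≡⟨ cong (a ^F suc (k ℕ.* 3) ⊗_)
          (𝔽-Exp.^-homo-* a (suc (k ℕ.* 3)) 1) ⟩
      a ^F suc (k ℕ.* 3) ⊗ (a ^F suc (k ℕ.* 3) ⊗ (a ⊗ ⟦ 1 ⟧))            ≡⟨ cong (λ u → u ⊗ (u ⊗ (a ⊗ ⟦ 1 ⟧)))
          (unit-power a a≢0) ⟩
      ⟦ 1 ⟧ ⊗ (⟦ 1 ⟧ ⊗ (a ⊗ ⟦ 1 ⟧))                                      ≡⟨ 1⊗1⊗ a ⟩
      a                                                                  ∎
      where
      open ≡-Reasoning
      exponent : ∀ k → (k ℕ.+ k ℕ.+ 1) ℕ.* 3 ≡ suc (k ℕ.* 3) ℕ.+ (suc (k ℕ.* 3) ℕ.+ 1)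
      exponent = ℕ-Solver.solve-∀

    ^F-3 : (a : F) → a ^F 3 ≡ a ⊗ a ⊗ a
    ^F-3 a = lem
      where
      lem : a ⊗ (a ⊗ (a ⊗ ⟦ 1 ⟧)) ≡ a ⊗ a ⊗ a
      lem = identity (a ∷ []) (λ a → a :* (a :* (a :* # 1)) := a :* a :* a)

  abstract
    cbrt : F → F
    cbrt a = a ^F (k ℕ.+ k ℕ.+ 1)

    cbrt-cubed : ∀ a → cbrt a ⊗ cbrt a ⊗ cbrt a ≡ a
    cbrt-cubed a = trans (sym (^F-3 (cbrt a))) (trans (𝔽-Exp.^-assocʳ a (k ℕ.+ k ℕ.+ 1) 3) (power-cycle a))

    cbrt-cube : ∀ a → cbrt (a ⊗ a ⊗ a) ≡ a
    cbrt-cube a = trans (cong (_^F (k ℕ.+ k ℕ.+ 1)) (sym (^F-3 a)))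
      (trans (𝔽-Exp.^-assocʳ a 3 (k ℕ.+ k ℕ.+ 1)) (trans (cong (a ^F_) (ℕ.*-comm 3 (k ℕ.+ k ℕ.+ 1))) (power-cycle a)))

  cube-injective : {a b : F} → a ⊗ a ⊗ a ≡ b ⊗ b ⊗ b → a ≡ b
  cube-injective {a} {b} eq = trans (sym (cbrt-cube a)) (trans (cong cbrt eq) (cbrt-cube b))

-- Sums over 𝔽 p and the quadratic character

module ℤ-Group = GroupProperties (AbelianGroup.group ℤ.+-0-abelianGroup)
module ℤ-Sum = MonoidSum ℤ.+-0-commutativeMonoid
open ℤ-Sum using (sum; sum-cong-≗; ∑-distrib-+; ∑-comm; sum-permute)
module ℤ-SumProduct = SemiringSum (CommutativeSemiring.semiring ℤ.+-*-commutativeSemiring)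
open ℤ-SumProduct using (*-distribˡ-sum)

ι : ∀ {a} {A : Set a} → Dec A → ℤ
ι A? = if does A? then 1ℤ else 0ℤ

module _ {a b} {A : Set a} {B : Set b} where
  ι-⇔ : (A? : Dec A) (B? : Dec B) → (A → B) → (B → A) → ι A? ≡ ι B?
  ι-⇔ A? B? f g = cong (λ t → if t then 1ℤ else 0ℤ) (does-⇔ (mk⇔ f g) A? B?)

module _ {a} {A : Set a} where
  ι-true : (A? : Dec A) → A → ι A? ≡ 1ℤ
  ι-true A? x = cong (λ t → if t then 1ℤ else 0ℤ) (dec-true A? x)

  ι-false : (A? : Dec A) → ¬ A → ι A? ≡ 0ℤ
  ι-false A? ¬x = cong (λ t → if t then 1ℤ else 0ℤ) (dec-false A? ¬x)

module _ {a ℓ} {A : Set a} {P : Unary.Pred A ℓ} (P? : Unary.Decidable P) where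

  length-filter-tabulate : ∀ {n} (f : Fin n → A) → + length (filter P? (tabulate f)) ≡ sum (λ i → ι (P? (f i)))
  length-filter-tabulate {zero}  f = refl
  length-filter-tabulate {suc n} f with does (P? (f zero))
  ... | true  = trans (ℤ.pos-+ 1 _) (cong (λ s → 1ℤ ℤ.+ s) (length-filter-tabulate (f ∘ suc)))
  ... | false = trans (length-filter-tabulate (f ∘ suc)) (sym (ℤ.+-identityˡ _))

  length-filter-map : ∀ {b} {B : Set b} (f : B → A) ys → length (filter P? (map f ys)) ≡ length (filter (P? ∘ f) ys)
  length-filter-map f List.[] = refl
  length-filter-map f (y List.∷ ys) with does (P? (f y))
  ... | true  = cong suc (length-filter-map f ys)
  ... | false = length-filter-map f ys

module _ {a b ℓ} {A : Set a} {B : Set b} {P : Unary.Pred (A × B) ℓ} (P? : Unary.Decidable P) where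

  length-filter-product : ∀ {n} (f : Fin n → A) (ys : List B) →
    + length (filter P? (cartesianProduct (tabulate f) ys)) ≡ sum (λ i → + length (filter (λ y → P? (f i , y)) ys))
  length-filter-product {zero}  f ys = refl
  length-filter-product {suc n} f ys = begin
    + length (filter P? (map (f zero ,_) ys ++ zs))                                ≡⟨ cong (λ l → + length l)
        (filter-++ P? (map (f zero ,_) ys) zs) ⟩
    + length (filter P? (map (f zero ,_) ys) ++ filter P? zs)                      ≡⟨ cong (λ n → + n)
        (length-++ (filter P? (map (f zero ,_) ys))) ⟩
    + (length (filter P? (map (f zero ,_) ys)) ℕ.+ length (filter P? zs))          ≡⟨ ℤ.pos-+
        (length (filter P? (map (f zero ,_) ys))) _ ⟩
    + length (filter P? (map (f zero ,_) ys)) ℤ.+ + length (filter P? zs)          ≡⟨ cong₂ ℤ._+_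
        (cong (λ n → + n) (length-filter-map P? (f zero ,_) ys)) (length-filter-product (f ∘ suc) ys) ⟩
    sum (λ i → + length (filter (λ y → P? (f i , y)) ys))                          ∎
    where
    open ≡-Reasoning
    zs = cartesianProduct (tabulate (f ∘ suc)) ys

sum-const : ∀ n c → sum {n} (λ _ → c) ≡ + n ℤ.* c
sum-const zero    c = refl
sum-const (suc n) c = trans (cong (λ s → c ℤ.+ s) (sum-const n c)) (sym (ℤ.suc-* (+ n) c))

sum-δ : ∀ {n} (b : Fin n) → sum (λ i → ι (i ≟ b)) ≡ 1ℤ
sum-δ {suc n} zero    = cong (λ s → 1ℤ ℤ.+ s) (trans (sum-const n 0ℤ) (ℤ.*-zeroʳ (+ n)))
sum-δ {suc n} (suc b) = trans (ℤ.+-identityˡ _) (sum-δ b)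

sum-≥0 : ∀ {n} (f : Fin n → ℤ) → (∀ i → 0ℤ ℤ.≤ f i) → 0ℤ ℤ.≤ sum f
sum-≥0 {zero}  f f≥0 = ℤ.≤-refl
sum-≥0 {suc n} f f≥0 = ℤ.+-mono-≤ (f≥0 zero) (sum-≥0 (f ∘ suc) (f≥0 ∘ suc))

sum≡0⇒≡0 : ∀ {n} (f : Fin n → ℤ) → (∀ i → 0ℤ ℤ.≤ f i) → sum f ≡ 0ℤ → ∀ i → f i ≡ 0ℤ
sum≡0⇒≡0 {suc n} f f≥0 s≡0 = λ where
    zero    → f₀≡0
    (suc i) → sum≡0⇒≡0 (f ∘ suc) (f≥0 ∘ suc)
        (trans (sym (ℤ.+-identityˡ _)) (trans (cong (λ t → t ℤ.+ sum (f ∘ suc)) (sym f₀≡0)) s≡0)) i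
  where
  f₀≡0 : f zero ≡ 0ℤ
  f₀≡0 = ℤ.≤-antisym
    (subst (f zero ℤ.≤_) s≡0 (subst (ℤ._≤ f zero ℤ.+ sum (f ∘ suc)) (ℤ.+-identityʳ (f zero))
      (ℤ.+-monoʳ-≤ (f zero) (sum-≥0 (f ∘ suc) (f≥0 ∘ suc)))))
    (f≥0 zero)

if-true : ∀ {a} {A : Set a} {t : Bool} {x y : A} → t ≡ true → (if t then x else y) ≡ x
if-true refl = refl

if-false : ∀ {a} {A : Set a} {t : Bool} {x y : A} → t ≡ false → (if t then x else y) ≡ y
if-false refl = refl

module _ {p : ℕ} .{{nz : NonZero p}} where

  NonSquare : 𝔽 p → Set
  NonSquare a = ∀ b → b ⊗ b ≢ a

  data Quadratic (a : 𝔽 p) : Set where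
    zero      : a ≡ ⟦ 0 ⟧ → Quadratic a
    square    : ∀ b → b ≢ ⟦ 0 ⟧ → b ⊗ b ≡ a → Quadratic a
    nonSquare : NonSquare a → Quadratic a

  0⊗0≡0 : ⟦ 0 ⟧ ⊗ ⟦ 0 ⟧ ≡ ⟦_⟧ {p} 0
  0⊗0≡0 = 𝔽.zeroˡ ⟦ 0 ⟧

  quadratic : ∀ a → Quadratic a
  quadratic a = case any? (λ b → b ⊗ b ≟ a) of λ where
    (no a≢□) → nonSquare λ b b²≡a → a≢□ (b , b²≡a)
    (yes (b , b²≡a)) → case b ≟ ⟦ 0 ⟧ of λ where
      (yes b≡0) → zero (trans (sym b²≡a) (trans (cong₂ _⊗_ b≡0 b≡0) 0⊗0≡0))
      (no b≢0)  → square b b≢0 b²≡a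

  σ-zero : ∀ {a : 𝔽 p} → a ≡ ⟦ 0 ⟧ → σ a ≡ 0ℤ
  σ-zero {a} a≡0 = if-true (dec-true (a ≟ ⟦ 0 ⟧) a≡0)

  σ-nonSquare : ∀ {a} → NonSquare a → σ a ≡ -1ℤ
  σ-nonSquare {a} a≢□ = trans
    (if-false (dec-false (a ≟ ⟦ 0 ⟧) (λ a≡0 → a≢□ ⟦ 0 ⟧ (trans 0⊗0≡0 (sym a≡0)))))
    (if-false (dec-false (any? λ b → b ⊗ b ≟ a) λ (b , b²≡a) → a≢□ b b²≡a))

module QuadraticCharacter {p : ℕ} .{{nz : NonZero p}} (pr : Prime p) (2<p : 2 ℕ.< p) where
  private F = 𝔽 p

  2≢0 : ⟦ 2 ⟧ ≢ ⟦_⟧ {p} 0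
  2≢0 = ⟦⟧≢0 2 2<p

  1≢0 : ⟦ 1 ⟧ ≢ ⟦_⟧ {p} 0
  1≢0 = ⟦⟧≢0 1 (ℕ.<-trans (ℕ.s≤s (ℕ.s≤s ℕ.z≤n)) 2<p)

  σ-square : {b : F} → b ≢ ⟦ 0 ⟧ → σ (b ⊗ b) ≡ 1ℤ
  σ-square {b} b≢0 = trans
    (if-false (dec-false (b ⊗ b ≟ ⟦ 0 ⟧) (⊗≢0 pr b≢0 b≢0)))
    (if-true (dec-true (any? λ c → c ⊗ c ≟ b ⊗ b) (b , refl)))

  square≡square : (a b : F) → a ⊗ a ≡ b ⊗ b → a ≡ b ⊎ a ≡ ⊝ b
  square≡square a b eq = Sum.map
    (λ h → ⊖≡0⇒≡ h) (λ h → linear-combination (a ∷ b ∷ []) (λ a b → # 1 , a :+ b := # 0 , a := :- b) h)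
    (⊗≡0 pr (a ⊖ b) (a ⊕ b) (linear-combination (a ∷ b ∷ [])
      (λ a b → # 1 , a :* a := b :* b , (a :- b) :* (a :+ b) := # 0) eq))

  sum-unique : {P : F → Set} (P? : Unary.Decidable P) (b : F) → P b → (∀ {v} → P v → v ≡ b) → sum (λ v → ι (P? v)) ≡ 1ℤ
  sum-unique P? b Pb uniq = trans (sum-cong-≗ λ v → ι-⇔ (P? v) (v ≟ b) uniq λ { refl → Pb }) (sum-δ b)

  private
    roots : ∀ {b} → b ≢ ⟦ 0 ⟧ → ∀ v → ι (v ⊗ v ≟ b ⊗ b) ≡ ι (v ≟ b) ℤ.+ ι (v ≟ ⊝ b)
    roots {b} b≢0 v = case v ≟ b of λ where
      (yes refl) → trans (ι-true (b ⊗ b ≟ b ⊗ b) refl)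
        (sym (cong₂ ℤ._+_ (ι-true (b ≟ b) refl) (ι-false (b ≟ ⊝ b)
          λ b≡-b → ⊗≢0 pr 2≢0 b≢0 (linear-combination (b ∷ []) (λ b → # 1 , b := :- b , # 2 :* b := # 0) b≡-b))))
      (no v≢b) → trans
        (ι-⇔ (v ⊗ v ≟ b ⊗ b) (v ≟ ⊝ b)
          (λ eq → [ (λ v≡b → contradiction v≡b v≢b) , (λ h → h) ]′ (square≡square v b eq))
          (λ h → linear-combination (v ∷ b ∷ []) (λ v b → v :- b , v := :- b , v :* v := b :* b) h))
        (sym (trans (cong (λ s → s ℤ.+ ι (v ≟ ⊝ b)) (ι-false (v ≟ b) v≢b)) (ℤ.+-identityˡ _)))

    #roots′ : ∀ {a} → Quadratic a → sum (λ v → ι (v ⊗ v ≟ a)) ≡ 1ℤ ℤ.+ σ a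
    #roots′ {a} (zero a≡0) = trans
      (sum-unique (λ v → v ⊗ v ≟ a) ⟦ 0 ⟧ (trans 0⊗0≡0 (sym a≡0))
        (λ {v} v²≡a → [ (λ h → h) , (λ h → h) ]′ (⊗≡0 pr v v (trans v²≡a a≡0))))
      (sym (cong (λ s → 1ℤ ℤ.+ s) (σ-zero a≡0)))
    #roots′ {a} (nonSquare a≢□) = begin
      sum (λ v → ι (v ⊗ v ≟ a))         ≡⟨ sum-cong-≗ (λ v → ι-false (v ⊗ v ≟ a) (a≢□ v)) ⟩
      sum {p} (λ _ → 0ℤ)                ≡⟨ sum-const p 0ℤ ⟩
      + p ℤ.* 0ℤ                        ≡⟨ ℤ.*-zeroʳ (+ p) ⟩
      0ℤ                                ≡⟨ cong (λ s → 1ℤ ℤ.+ s) (σ-nonSquare a≢□) ⟨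
      1ℤ ℤ.+ σ a                        ∎
      where open ≡-Reasoning
    #roots′ (square b b≢0 refl) = begin
      sum (λ v → ι (v ⊗ v ≟ b ⊗ b))                           ≡⟨ sum-cong-≗ (roots b≢0) ⟩
      sum (λ v → ι (v ≟ b) ℤ.+ ι (v ≟ ⊝ b))                   ≡⟨ ∑-distrib-+ (λ v → ι (v ≟ b)) (λ v → ι (v ≟ ⊝ b)) ⟩
      sum (λ v → ι (v ≟ b)) ℤ.+ sum (λ v → ι (v ≟ ⊝ b))       ≡⟨ cong₂ ℤ._+_ (sum-δ b) (sum-δ (⊝ b)) ⟩
      1ℤ ℤ.+ 1ℤ                                               ≡⟨ cong (λ s → 1ℤ ℤ.+ s) (σ-square b≢0) ⟨
      1ℤ ℤ.+ σ (b ⊗ b)                                        ∎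
      where open ≡-Reasoning

  #roots : ∀ a → sum (λ v → ι (v ⊗ v ≟ a)) ≡ 1ℤ ℤ.+ σ a
  #roots a = #roots′ (quadratic a)

  sum-#roots : (f : F → F) → sum (λ u → sum (λ v → ι (v ⊗ v ≟ f u))) ≡ + p ℤ.+ sum (λ u → σ (f u))
  sum-#roots f = begin
    sum (λ u → sum (λ v → ι (v ⊗ v ≟ f u)))       ≡⟨ sum-cong-≗ (λ u → #roots (f u)) ⟩
    sum (λ u → 1ℤ ℤ.+ σ (f u))                    ≡⟨ ∑-distrib-+ (λ _ → 1ℤ) (λ u → σ (f u)) ⟩
    sum {p} (λ _ → 1ℤ) ℤ.+ sum (λ u → σ (f u))    ≡⟨ cong (λ s → s ℤ.+ sum (λ u → σ (f u)))
        (trans (sum-const p 1ℤ) (ℤ.*-identityʳ (+ p))) ⟩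
    + p ℤ.+ sum (λ u → σ (f u))                   ∎
    where open ≡-Reasoning

  -- The pairs (a, v) with v² = a are counted in two ways: each v belongs to one a, and each a has 1
  -- + σ a square roots.
  sum-σ : sum (λ (a : F) → σ a) ≡ 0ℤ
  sum-σ = ℤ-Group.∙-cancelˡ (+ p) _ _ (begin
    + p ℤ.+ sum (λ a → σ a)                       ≡⟨ sum-#roots (λ a → a) ⟨
    sum (λ a → sum (λ v → ι (v ⊗ v ≟ a)))         ≡⟨ ∑-comm (λ a v → ι (v ⊗ v ≟ a)) ⟩
    sum (λ v → sum (λ a → ι (v ⊗ v ≟ a)))         ≡⟨ sum-cong-≗ (λ v → sum-unique (λ a → v ⊗ v ≟ a) (v ⊗ v) refl sym) ⟩
    sum {p} (λ _ → 1ℤ)                            ≡⟨ sum-const p 1ℤ ⟩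
    + p ℤ.* 1ℤ                                    ≡⟨ ℤ.*-identityʳ (+ p) ⟩
    + p                                           ≡⟨ ℤ.+-identityʳ (+ p) ⟨
    + p ℤ.+ 0ℤ                                    ∎)
    where open ≡-Reasoning

  -- The product is a separate variable c so that any polynomial identity exhibiting a square factor
  -- can be supplied directly.
  σ-square-⊗ : ∀ {b a c} → b ≢ ⟦ 0 ⟧ → b ⊗ b ⊗ a ≡ c → σ c ≡ σ a
  σ-square-⊗ {b} {a} {c} b≢0 b²a≡c = case quadratic a of λ where
      (zero a≡0) → trans (σ-zero (trans (sym b²a≡c) (trans (cong (b ⊗ b ⊗_) a≡0) (𝔽.zeroʳ (b ⊗ b))))) (sym (σ-zero a≡0))
      (square d d≢0 d²≡a) → trans
        (trans (cong σ (trans (sym b²a≡c) (bd d a d²≡a))) (σ-square (⊗≢0 pr b≢0 d≢0)))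
        (sym (trans (cong σ (sym d²≡a)) (σ-square d≢0)))
      (nonSquare a≢□) → let b⁻¹ , bb⁻¹≡1 = inverse pr b b≢0 in
        trans (σ-nonSquare (λ d d²≡c → a≢□ (b⁻¹ ⊗ d) (bd⁻¹ b⁻¹ d bb⁻¹≡1 (trans d²≡c (sym b²a≡c))))) (sym (σ-nonSquare a≢□))
    where
    bd : ∀ d a → d ⊗ d ≡ a → b ⊗ b ⊗ a ≡ (b ⊗ d) ⊗ (b ⊗ d)
    bd d a h = linear-combination (b ∷ a ∷ d ∷ [])
      (λ b a d → :- (b :* b) , d :* d := a , b :* b :* a := b :* d :* (b :* d)) h
    bd⁻¹ : ∀ b⁻¹ d → b ⊗ b⁻¹ ≡ ⟦ 1 ⟧ → d ⊗ d ≡ b ⊗ b ⊗ a → (b⁻¹ ⊗ d) ⊗ (b⁻¹ ⊗ d) ≡ a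
    bd⁻¹ b⁻¹ d h₁ h₂ = trans {j = b ⊗ b⁻¹ ⊗ (b ⊗ b⁻¹) ⊗ a} (linear-combination (b⁻¹ ∷ d ∷ b ∷ a ∷ [])
      (λ b⁻¹ d b a →
        b⁻¹ :* b⁻¹ ,
        d :* d := b :* b :* a ,
        b⁻¹ :* d :* (b⁻¹ :* d) := b :* b⁻¹ :* (b :* b⁻¹) :* a) h₂)
      (linear-combination (b ∷ b⁻¹ ∷ a ∷ [])
        (λ b b⁻¹ a → (b :* b⁻¹ :+ # 1) :* a , b :* b⁻¹ := # 1 , b :* b⁻¹ :* (b :* b⁻¹) :* a := a) h₁)

  affine-permutation : ∀ (a a⁻¹ b : F) → a ⊗ a⁻¹ ≡ ⟦ 1 ⟧ → Permutation p p
  affine-permutation a a⁻¹ b aa⁻¹≡1 = permutation (λ y → a ⊗ y ⊕ b) (λ u → a⁻¹ ⊗ (u ⊖ b)) invˡ invʳ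
    where
    invˡ : ∀ u → a ⊗ (a⁻¹ ⊗ (u ⊖ b)) ⊕ b ≡ u
    invˡ u = linear-combination (a ∷ a⁻¹ ∷ u ∷ b ∷ [])
      (λ a a⁻¹ u b → u :- b , a :* a⁻¹ := # 1 , a :* (a⁻¹ :* (u :- b)) :+ b := u) aa⁻¹≡1
    invʳ : ∀ y → a⁻¹ ⊗ (a ⊗ y ⊕ b ⊖ b) ≡ y
    invʳ y = linear-combination (a⁻¹ ∷ a ∷ y ∷ b ∷ [])
      (λ a⁻¹ a y b → y , a :* a⁻¹ := # 1 , a⁻¹ :* (a :* y :+ b :- b) := y) aa⁻¹≡1

  sum-affine : (f : F → ℤ) {a : F} → a ≢ ⟦ 0 ⟧ → ∀ b → sum (λ y → f (a ⊗ y ⊕ b)) ≡ sum f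
  sum-affine f {a} a≢0 b = let a⁻¹ , aa⁻¹≡1 = inverse pr a a≢0 in
    sym (sum-permute f (affine-permutation a a⁻¹ b aa⁻¹≡1))

  sum-σ-affine : {a : F} → a ≢ ⟦ 0 ⟧ → ∀ b → sum (λ y → σ (a ⊗ y ⊕ b)) ≡ 0ℤ
  sum-σ-affine a≢0 b = trans (sum-affine σ a≢0 b) sum-σ

  -- The terms - (σ (b ⊗ a) + σ a) are nonnegative and sum to 0.
  nonSquare⊗nonSquare : ∀ {b a} → NonSquare b → NonSquare a → σ (b ⊗ a) ≡ 1ℤ
  nonSquare⊗nonSquare {b} {a} b≢□ a≢□ = begin
    σ (b ⊗ a)                                   ≡⟨ ℤ-Group.∙-cancelʳ (σ a) _ _
        (trans (ℤ-neg-injective (defect≡0 a)) (cong (λ s → 1ℤ ℤ.+ s) (sym (σ-nonSquare a≢□)))) ⟩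
    1ℤ                                          ∎
    where
    open ≡-Reasoning
    ℤ-neg-injective : ∀ {i} → ℤ.- i ≡ 0ℤ → i ≡ 0ℤ
    ℤ-neg-injective {i} eq = trans (sym (ℤ.neg-involutive i)) (cong (λ i → ℤ.- i) eq)
    defect : F → ℤ
    defect c = ℤ.- (σ (b ⊗ c) ℤ.+ σ c)
    σ≤1 : ∀ c → σ c ℤ.≤ 1ℤ
    σ≤1 c = case quadratic c of λ where
      (zero c≡0) → ℤ.≤-trans (ℤ.≤-reflexive (σ-zero c≡0)) (ℤ.+≤+ ℕ.z≤n)
      (square d d≢0 d²≡c) → ℤ.≤-reflexive (trans (cong σ (sym d²≡c)) (σ-square d≢0))
      (nonSquare c≢□) → ℤ.≤-trans (ℤ.≤-reflexive (σ-nonSquare c≢□)) ℤ.-≤+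
    σ-sum≤0 : ∀ c → σ (b ⊗ c) ℤ.+ σ c ℤ.≤ 0ℤ
    σ-sum≤0 c = case quadratic c of λ where
      (zero c≡0) → ℤ.≤-reflexive (cong₂ ℤ._+_
        (σ-zero (trans (cong (b ⊗_) c≡0) (𝔽.zeroʳ b))) (σ-zero c≡0))
      (square d d≢0 d²≡c) → ℤ.≤-reflexive (cong₂ ℤ._+_
        (trans (σ-square-⊗ d≢0 (trans (cong (_⊗ b) d²≡c) (⊗-comm c b))) (σ-nonSquare b≢□))
        (trans (cong σ (sym d²≡c)) (σ-square d≢0)))
      (nonSquare c≢□) → ℤ.+-mono-≤ (σ≤1 (b ⊗ c)) (ℤ.≤-reflexive (σ-nonSquare c≢□))
    b≢0 : b ≢ ⟦ 0 ⟧
    b≢0 b≡0 = b≢□ ⟦ 0 ⟧ (trans 0⊗0≡0 (sym b≡0))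
    sum-defect : sum defect ≡ 0ℤ
    sum-defect = begin
      sum (λ c → ℤ.- (σ (b ⊗ c) ℤ.+ σ c))                   ≡⟨ sum-cong-≗ (λ c → sym (ℤ.-1*i≡-i (σ (b ⊗ c) ℤ.+ σ c))) ⟩
      sum (λ c → -1ℤ ℤ.* (σ (b ⊗ c) ℤ.+ σ c))               ≡⟨ *-distribˡ-sum -1ℤ (λ c → σ (b ⊗ c) ℤ.+ σ c) ⟨
      -1ℤ ℤ.* sum (λ c → σ (b ⊗ c) ℤ.+ σ c)                 ≡⟨ cong (λ s → -1ℤ ℤ.* s) (∑-distrib-+ (λ c → σ (b ⊗ c)) σ) ⟩
      -1ℤ ℤ.* (sum (λ c → σ (b ⊗ c)) ℤ.+ sum {p} σ)         ≡⟨ cong (λ s → -1ℤ ℤ.* s) (cong₂ ℤ._+_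
                                                                 (trans (sum-cong-≗ (λ c → cong σ
                                                                     (sym (𝔽.+-identityʳ (b ⊗ c)))))
                                                                     (sum-σ-affine b≢0 ⟦ 0 ⟧)) sum-σ) ⟩
      0ℤ                                                    ∎
    defect≡0 : ∀ c → defect c ≡ 0ℤ
    defect≡0 = sum≡0⇒≡0 defect (λ c → ℤ.neg-mono-≤ (σ-sum≤0 c)) sum-defect

  σ-⊗ : ∀ a b → σ (a ⊗ b) ≡ σ a ℤ.* σ b
  σ-⊗ a b = case quadratic a of λ where
    (zero a≡0) → trans (σ-zero (trans (cong (_⊗ b) a≡0) (𝔽.zeroˡ b))) (cong (λ s → s ℤ.* σ b) (sym (σ-zero a≡0)))
    (square d d≢0 d²≡a) → trans (σ-square-⊗ d≢0 (cong (_⊗ b) d²≡a))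
      (trans (sym (ℤ.*-identityˡ (σ b))) (cong (λ s → s ℤ.* σ b) (trans (sym (σ-square d≢0)) (cong σ d²≡a))))
    (nonSquare a≢□) → case quadratic b of λ where
      (zero b≡0) → trans (σ-zero (trans (cong (a ⊗_) b≡0) (𝔽.zeroʳ a)))
        (trans (sym (ℤ.*-zeroʳ (σ a))) (cong (λ s → σ a ℤ.* s) (sym (σ-zero b≡0))))
      (square d d≢0 d²≡b) → trans (σ-square-⊗ d≢0 (trans (cong (_⊗ a) d²≡b) (⊗-comm b a)))
        (trans (sym (ℤ.*-identityʳ (σ a))) (cong (λ s → σ a ℤ.* s) (trans (sym (σ-square d≢0)) (cong σ d²≡b))))
      (nonSquare b≢□) → trans (nonSquare⊗nonSquare a≢□ b≢□) (sym (cong₂ ℤ._*_ (σ-nonSquare a≢□) (σ-nonSquare b≢□)))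

  σ-cancel : ∀ {a} → a ≢ ⟦ 0 ⟧ → ∀ b → σ a ℤ.* σ (a ⊗ b) ≡ σ b
  σ-cancel {a} a≢0 b = trans (sym (σ-⊗ a (a ⊗ b))) (σ-square-⊗ a≢0 (⊗-assoc a a b))

  -- v = u + t turns v² = u² - Δ into 2 u t + t² = - Δ, which is linear in u.
  sum-σ-u²-Δ : ∀ {Δ} → Δ ≢ ⟦ 0 ⟧ → sum (λ u → σ (u ⊗ u ⊖ Δ)) ≡ -1ℤ
  sum-σ-u²-Δ {Δ} Δ≢0 = ℤ-Group.∙-cancelˡ (+ p) _ _ (begin
    + p ℤ.+ sum (λ u → σ (u ⊗ u ⊖ Δ))                                      ≡⟨ sum-#roots (λ u → u ⊗ u ⊖ Δ) ⟨
    sum (λ u → sum (λ v → ι (v ⊗ v ≟ u ⊗ u ⊖ Δ)))                          ≡⟨ sum-cong-≗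
        (λ u → sum-affine (λ v → ι (v ⊗ v ≟ u ⊗ u ⊖ Δ)) 1≢0 u) ⟨
    sum (λ u → sum (λ t → ι (solves? u t)))                                ≡⟨ ∑-comm (λ u t → ι (solves? u t)) ⟩
    sum (λ t → sum (λ u → ι (solves? u t)))                                ≡⟨ sum-cong-≗ count ⟩
    sum (λ t → 1ℤ ℤ.+ -1ℤ ℤ.* ι (t ≟ ⟦ 0 ⟧))                               ≡⟨ ∑-distrib-+ {p} (λ _ → 1ℤ)
        (λ t → -1ℤ ℤ.* ι (t ≟ ⟦ 0 ⟧)) ⟩
    sum {p} (λ _ → 1ℤ) ℤ.+ sum (λ t → -1ℤ ℤ.* ι (t ≟ ⟦ 0 ⟧))               ≡⟨ cong₂ ℤ._+_
        (trans (sum-const p 1ℤ) (ℤ.*-identityʳ (+ p)))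
                                                                                (trans (sym (*-distribˡ-sum -1ℤ
                                                                                    (λ t → ι (t ≟ ⟦ 0 ⟧)))) (cong (λ s → -1ℤ ℤ.* s) (sum-δ {p} ⟦ 0 ⟧))) ⟩
    + p ℤ.+ -1ℤ                                                            ∎)
    where
    open ≡-Reasoning
    solves? : ∀ u t → Dec ((⟦ 1 ⟧ ⊗ t ⊕ u) ⊗ (⟦ 1 ⟧ ⊗ t ⊕ u) ≡ u ⊗ u ⊖ Δ)
    solves? u t = (⟦ 1 ⟧ ⊗ t ⊕ u) ⊗ (⟦ 1 ⟧ ⊗ t ⊕ u) ≟ u ⊗ u ⊖ Δ
    count : ∀ t → sum (λ u → ι (solves? u t)) ≡ 1ℤ ℤ.+ -1ℤ ℤ.* ι (t ≟ ⟦ 0 ⟧)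
    count t = case t ≟ ⟦ 0 ⟧ of λ where
        (yes t≡0) → trans (sum-cong-≗ λ u → ι-false (solves? u t) (absurd t u t≡0))
          (trans (trans (sum-const p 0ℤ) (ℤ.*-zeroʳ (+ p))) (sym (cong (λ s → 1ℤ ℤ.+ -1ℤ ℤ.* s) (ι-true (t ≟ ⟦ 0 ⟧) t≡0))))
        (no t≢0) → let w , 2tw≡1 = inverse pr (⟦ 2 ⟧ ⊗ t) (⊗≢0 pr 2≢0 t≢0) in
          trans (sum-unique (λ u → solves? u t) (⊝ ((Δ ⊕ t ⊗ t) ⊗ w)) (exists t w 2tw≡1) (λ {u} → unique t w u 2tw≡1))
            (sym (cong (λ s → 1ℤ ℤ.+ -1ℤ ℤ.* s) (ι-false (t ≟ ⟦ 0 ⟧) t≢0)))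
      where
      absurd : ∀ t u → t ≡ ⟦ 0 ⟧ → (⟦ 1 ⟧ ⊗ t ⊕ u) ⊗ (⟦ 1 ⟧ ⊗ t ⊕ u) ≢ u ⊗ u ⊖ Δ
      absurd t u t≡0 eq = Δ≢0 (trans {j = ⊝ (t ⊗ (t ⊕ ⟦ 2 ⟧ ⊗ u))}
        (linear-combination (Δ ∷ t ∷ u ∷ [])
          (λ Δ t u →
            # 1 ,
            (# 1 :* t :+ u) :* (# 1 :* t :+ u) := u :* u :- Δ ,
            Δ := :- (t :* (t :+ # 2 :* u))) eq) (linear-combination (t ∷ u ∷ [])
          (λ t u → :- (t :+ # 2 :* u) , t := # 0 , :- (t :* (t :+ # 2 :* u)) := # 0) t≡0))
      exists : ∀ t w → ⟦ 2 ⟧ ⊗ t ⊗ w ≡ ⟦ 1 ⟧ →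
        let u = ⊝ ((Δ ⊕ t ⊗ t) ⊗ w) in (⟦ 1 ⟧ ⊗ t ⊕ u) ⊗ (⟦ 1 ⟧ ⊗ t ⊕ u) ≡ u ⊗ u ⊖ Δ
      exists t w h = linear-combination (t ∷ Δ ∷ w ∷ [])
        (λ t Δ w →
          :- (Δ :+ t :* t) ,
          # 2 :* t :* w := # 1 ,
          (# 1 :* t :+ :- ((Δ :+ t :* t) :* w)) :* (# 1 :* t :+ :- ((Δ :+ t :* t) :* w)) :=
            :- ((Δ :+ t :* t) :* w) :* :- ((Δ :+ t :* t) :* w) :- Δ) h
      unique : ∀ t w u → ⟦ 2 ⟧ ⊗ t ⊗ w ≡ ⟦ 1 ⟧ →
        (⟦ 1 ⟧ ⊗ t ⊕ u) ⊗ (⟦ 1 ⟧ ⊗ t ⊕ u) ≡ u ⊗ u ⊖ Δ → u ≡ ⊝ ((Δ ⊕ t ⊗ t) ⊗ w)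
      unique t w u h eq = trans {j = ⟦ 2 ⟧ ⊗ t ⊗ w ⊗ u}
        (linear-combination (u ∷ t ∷ w ∷ [])
          (λ u t w → :- u , # 2 :* t :* w := # 1 , u := # 2 :* t :* w :* u) h) (linear-combination (t ∷ w ∷ u ∷ Δ ∷ [])
          (λ t w u Δ →
            w ,
            (# 1 :* t :+ u) :* (# 1 :* t :+ u) := u :* u :- Δ ,
            # 2 :* t :* w :* u := :- ((Δ :+ t :* t) :* w)) eq)

  module _ {a : F} (a≢0 : a ≢ ⟦ 0 ⟧) (b c : F) where
    private
      Δ = b ⊗ b ⊖ ⟦ 4 ⟧ ⊗ a ⊗ c

    -- Since 4 a (a y² + b y + c) = (2 a y + b)² - Δ and σ(a) σ(a q) = σ(q), the permutation y ↦ 2 a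
    -- y + b brings the sum to the standard form.
    sum-σ-quadratic : sum (λ y → σ (a ⊗ (y ⊗ y) ⊕ b ⊗ y ⊕ c)) ≡ σ a ℤ.* sum (λ u → σ (u ⊗ u ⊖ Δ))
    sum-σ-quadratic = begin
      sum (λ y → σ (a ⊗ (y ⊗ y) ⊕ b ⊗ y ⊕ c))                                        ≡⟨ sum-cong-≗
          (λ y → σ-cancel a≢0 (a ⊗ (y ⊗ y) ⊕ b ⊗ y ⊕ c)) ⟨
      sum (λ y → σ a ℤ.* σ (a ⊗ (a ⊗ (y ⊗ y) ⊕ b ⊗ y ⊕ c)))                          ≡⟨ sum-cong-≗
          (λ y → cong (λ s → σ a ℤ.* s)
                                                                                          (sym (σ-square-⊗ 2≢0 (complete-square a b c y)))) ⟩
      sum (λ y → σ a ℤ.* σ ((⟦ 2 ⟧ ⊗ a ⊗ y ⊕ b) ⊗ (⟦ 2 ⟧ ⊗ a ⊗ y ⊕ b) ⊖ Δ))          ≡⟨ *-distribˡ-sum (σ a)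
          (λ y → σ ((⟦ 2 ⟧ ⊗ a ⊗ y ⊕ b) ⊗ (⟦ 2 ⟧ ⊗ a ⊗ y ⊕ b) ⊖ Δ)) ⟨
      σ a ℤ.* sum (λ y → σ ((⟦ 2 ⟧ ⊗ a ⊗ y ⊕ b) ⊗ (⟦ 2 ⟧ ⊗ a ⊗ y ⊕ b) ⊖ Δ))          ≡⟨ cong (λ s → σ a ℤ.* s)
                                                                                          (sum-affine (λ u → σ (u ⊗ u ⊖ Δ)) (⊗≢0 pr 2≢0 a≢0) b) ⟩
      σ a ℤ.* sum (λ u → σ (u ⊗ u ⊖ Δ))                                              ∎
      where
      open ≡-Reasoning
      complete-square : ∀ a b c y → ⟦ 2 ⟧ ⊗ ⟦ 2 ⟧ ⊗ (a ⊗ (a ⊗ (y ⊗ y) ⊕ b ⊗ y ⊕ c)) ≡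
        (⟦ 2 ⟧ ⊗ a ⊗ y ⊕ b) ⊗ (⟦ 2 ⟧ ⊗ a ⊗ y ⊕ b) ⊖ (b ⊗ b ⊖ ⟦ 4 ⟧ ⊗ a ⊗ c)
      complete-square a b c y = identity (a ∷ y ∷ b ∷ c ∷ [])
        (λ a y b c →
          # 2 :* # 2 :* (a :* (a :* (y :* y) :+ b :* y :+ c)) :=
            (# 2 :* a :* y :+ b) :* (# 2 :* a :* y :+ b) :- (b :* b :- # 4 :* a :* c))

    sum-σ-nondegenerate : Δ ≢ ⟦ 0 ⟧ → sum (λ y → σ (a ⊗ (y ⊗ y) ⊕ b ⊗ y ⊕ c)) ≡ ℤ.- σ a
    sum-σ-nondegenerate Δ≢0 = trans sum-σ-quadratic (trans (cong (λ s → σ a ℤ.* s) (sum-σ-u²-Δ Δ≢0))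
      (trans (ℤ.*-comm (σ a) -1ℤ) (ℤ.-1*i≡-i (σ a))))

    -- Now the sum is that of σ(u²), which is 1 except at u = 0, so it equals p - 1.
    sum-σ-degenerate : Δ ≡ ⟦ 0 ⟧ → sum (λ y → σ (a ⊗ (y ⊗ y) ⊕ b ⊗ y ⊕ c)) ≡ ℤ.- σ a ℤ.+ + p ℤ.* σ a
    sum-σ-degenerate Δ≡0 = trans sum-σ-quadratic (begin
      σ a ℤ.* sum (λ u → σ (u ⊗ u ⊖ Δ))                        ≡⟨ cong (λ s → σ a ℤ.* s) (sum-cong-≗ σ-u²) ⟩
      σ a ℤ.* sum (λ u → 1ℤ ℤ.+ -1ℤ ℤ.* ι (u ≟ ⟦ 0 ⟧))         ≡⟨ cong (λ s → σ a ℤ.* s)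
          (∑-distrib-+ {p} (λ _ → 1ℤ) (λ t → -1ℤ ℤ.* ι (t ≟ ⟦ 0 ⟧))) ⟩
      σ a ℤ.* (sum {p} (λ _ → 1ℤ) ℤ.+ sum (λ u → -1ℤ ℤ.* ι (u ≟ ⟦ 0 ⟧)))  ≡⟨ cong (λ s → σ a ℤ.* s)
          (cong₂ ℤ._+_ (trans (sum-const p 1ℤ) (ℤ.*-identityʳ (+ p)))
                                                                                (trans (sym (*-distribˡ-sum -1ℤ
                                                                                    (λ t → ι (t ≟ ⟦ 0 ⟧)))) (cong (λ s → -1ℤ ℤ.* s) (sum-δ {p} ⟦ 0 ⟧)))) ⟩
      σ a ℤ.* (+ p ℤ.+ -1ℤ)                                    ≡⟨ expand (σ a) (+ p) ⟩
      ℤ.- σ a ℤ.+ + p ℤ.* σ a                                  ∎)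
      where
      open ≡-Reasoning
      expand : ∀ s q → s ℤ.* (q ℤ.+ -1ℤ) ≡ ℤ.- s ℤ.+ q ℤ.* s
      expand = ℤ-Solver.solve-∀
      Δ-drop : ∀ u d → d ≡ ⟦ 0 ⟧ → u ⊗ u ⊖ d ≡ u ⊗ u
      Δ-drop u d d≡0 = linear-combination (u ∷ d ∷ []) (λ u d → :- # 1 , d := # 0 , u :* u :- d := u :* u) d≡0
      σ-u² : ∀ u → σ (u ⊗ u ⊖ Δ) ≡ 1ℤ ℤ.+ -1ℤ ℤ.* ι (u ≟ ⟦ 0 ⟧)
      σ-u² u = trans (cong σ (Δ-drop u Δ Δ≡0)) (case u ≟ ⟦ 0 ⟧ of λ where
        (yes u≡0) → trans (σ-zero (trans (cong₂ _⊗_ u≡0 u≡0) 0⊗0≡0))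
            (sym (cong (λ s → 1ℤ ℤ.+ -1ℤ ℤ.* s) (ι-true (u ≟ ⟦ 0 ⟧) u≡0)))
        (no u≢0) → trans (σ-square u≢0) (sym (cong (λ s → 1ℤ ℤ.+ -1ℤ ℤ.* s) (ι-false (u ≟ ⟦ 0 ⟧) u≢0))))

  #quadratic-roots : ∀ b c → sum (λ z → ι (z ⊗ z ⊕ b ⊗ z ⊕ c ≟ ⟦ 0 ⟧)) ≡ 1ℤ ℤ.+ σ (b ⊗ b ⊖ ⟦ 4 ⟧ ⊗ c)
  #quadratic-roots b c = begin
    sum (λ z → ι (z ⊗ z ⊕ b ⊗ z ⊕ c ≟ ⟦ 0 ⟧))                   ≡⟨ sum-cong-≗
        (λ z → ι-⇔ (z ⊗ z ⊕ b ⊗ z ⊕ c ≟ ⟦ 0 ⟧) (root? (⟦ 2 ⟧ ⊗ z ⊕ b)) (to z) (from z)) ⟩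
    sum (λ z → ι (root? (⟦ 2 ⟧ ⊗ z ⊕ b)))                       ≡⟨ sum-affine (λ v → ι (root? v)) 2≢0 b ⟩
    sum (λ v → ι (root? v))                                     ≡⟨ #roots (b ⊗ b ⊖ ⟦ 4 ⟧ ⊗ c) ⟩
    1ℤ ℤ.+ σ (b ⊗ b ⊖ ⟦ 4 ⟧ ⊗ c)                                ∎
    where
    open ≡-Reasoning
    root? : ∀ v → Dec (v ⊗ v ≡ b ⊗ b ⊖ ⟦ 4 ⟧ ⊗ c)
    root? v = v ⊗ v ≟ b ⊗ b ⊖ ⟦ 4 ⟧ ⊗ c
    to : ∀ z → z ⊗ z ⊕ b ⊗ z ⊕ c ≡ ⟦ 0 ⟧ → (⟦ 2 ⟧ ⊗ z ⊕ b) ⊗ (⟦ 2 ⟧ ⊗ z ⊕ b) ≡ b ⊗ b ⊖ ⟦ 4 ⟧ ⊗ c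
    to z h = linear-combination (z ∷ b ∷ c ∷ [])
      (λ z b c →
        # 4 ,
        z :* z :+ b :* z :+ c := # 0 ,
        (# 2 :* z :+ b) :* (# 2 :* z :+ b) := b :* b :- # 4 :* c) h
    from : ∀ z → (⟦ 2 ⟧ ⊗ z ⊕ b) ⊗ (⟦ 2 ⟧ ⊗ z ⊕ b) ≡ b ⊗ b ⊖ ⟦ 4 ⟧ ⊗ c → z ⊗ z ⊕ b ⊗ z ⊕ c ≡ ⟦ 0 ⟧
    from z h = ⊗-cancelˡ pr {⟦ 2 ⟧ ⊗ ⟦ 2 ⟧} (⊗≢0 pr 2≢0 2≢0) (linear-combination (z ∷ b ∷ c ∷ [])
      (λ z b c →
        # 1 ,
        (# 2 :* z :+ b) :* (# 2 :* z :+ b) := b :* b :- # 4 :* c ,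
        # 2 :* # 2 :* (z :* z :+ b :* z :+ c) := # 2 :* # 2 :* # 0) h)

-- Counting in duplicate-free lists

module _ {a} {A : Set a} where

  length-≡ : {xs ys : List A} → Unique xs → Unique ys → (∀ {v} → v ∈ xs → v ∈ ys) → (∀ {v} → v ∈ ys → v ∈ xs) → length xs ≡ length ys
  length-≡ xs! ys! xs⊆ys ys⊆xs = ↭-length (∼bag⇒↭ (unique∧set⇒bag xs! ys! (mk⇔ xs⊆ys ys⊆xs)))

module _ {a b} {A : Set a} {B : Set b} (f : A → B) where

  map-unique : {xs : List A} → (∀ {x y} → x ∈ xs → y ∈ xs → f x ≡ f y → x ≡ y) → Unique xs → Unique (map f xs)
  map-unique inj []           = []
  map-unique inj (x∉xs ∷ xs!) =
    All.map⁺ (All.tabulate λ y∈xs fx≡fy → All.lookup x∉xs y∈xs (inj (here refl) (there y∈xs) fx≡fy))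
    ∷ map-unique (λ x∈ y∈ → inj (there x∈) (there y∈)) xs!

  -- Injectivity is asked only on the members of `xs`, because `fixedPoint` is proved injective only
  -- at regular parameters.
  length-bijection : {xs : List A} {ys : List B} → Unique xs → Unique ys →
    (∀ {x y} → x ∈ xs → y ∈ xs → f x ≡ f y → x ≡ y) →
    (∀ {x} → x ∈ xs → f x ∈ ys) → (∀ {y} → y ∈ ys → ∃ λ x → x ∈ xs × f x ≡ y) → length xs ≡ length ys
  length-bijection {xs} {ys} xs! ys! inj to from = trans (sym (length-map f xs))
    (length-≡ (map-unique inj xs!) ys!
      (λ v∈ → let x , x∈xs , v≡fx = ∈-map⁻ f v∈ in subst (_∈ ys) (sym v≡fx) (to x∈xs))
      (λ v∈ → let x , x∈xs , fx≡v = from v∈ in subst (_∈ map f xs) fx≡v (∈-map⁺ f x∈xs)))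

module _ {a ℓ} {A : Set a} {P : Unary.Pred A ℓ} (P? : Unary.Decidable P) where

  -- Distinctness is asked only where P holds: two flips of a vertex can coincide, but only when
  -- both equal the vertex and are filtered out.
  filter-unique : {xs : List A} → AllPairs (λ x y → P x → P y → x ≢ y) xs → Unique (filter P? xs)
  filter-unique []         = []
  filter-unique {x ∷ xs} (px ∷ pxs) with P? x
  ... | no  _  = filter-unique pxs
  ... | yes Px = All.tabulate (λ y∈ → let y∈xs , Py = ∈-filter⁻ P? y∈ in All.lookup px y∈xs Px Py) ∷ filter-unique pxs

𝟙 : ∀ {a} {A : Set a} → Dec A → ℕ
𝟙 A? = if does A? then 1 else 0

module _ {a} {A : Set a} where

  Σ[_] : List A → (A → ℕ) → ℕ
  Σ[ []     ] f = 0
  Σ[ x ∷ xs ] f = f x ℕ.+ Σ[ xs ] f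

  Σ-cong : ∀ {xs} {f g : A → ℕ} → (∀ {x} → x ∈ xs → f x ≡ g x) → Σ[ xs ] f ≡ Σ[ xs ] g
  Σ-cong {[]}     h = refl
  Σ-cong {x ∷ xs} h = cong₂ ℕ._+_ (h (here refl)) (Σ-cong (h ∘ there))

  Σ-+ : ∀ xs (f g : A → ℕ) → Σ[ xs ] (λ x → f x ℕ.+ g x) ≡ Σ[ xs ] f ℕ.+ Σ[ xs ] g
  Σ-+ []       f g = refl
  Σ-+ (x ∷ xs) f g = trans (cong (f x ℕ.+ g x ℕ.+_) (Σ-+ xs f g)) (interchange (f x) (g x) (Σ[ xs ] f) (Σ[ xs ] g))
    where
    interchange : ∀ a b c d → a ℕ.+ b ℕ.+ (c ℕ.+ d) ≡ a ℕ.+ c ℕ.+ (b ℕ.+ d)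
    interchange = ℕ-Solver.solve-∀

  Σ-0 : ∀ xs → Σ[ xs ] (λ _ → 0) ≡ 0
  Σ-0 []       = refl
  Σ-0 (x ∷ xs) = Σ-0 xs

  length-filter : ∀ {ℓ} {P : Unary.Pred A ℓ} (P? : Unary.Decidable P) xs → length (filter P? xs) ≡ Σ[ xs ] (λ x → 𝟙 (P? x))
  length-filter P? []       = refl
  length-filter P? (x ∷ xs) with does (P? x)
  ... | true  = cong suc (length-filter P? xs)
  ... | false = length-filter P? xs

-- Degree counts by inclusion and exclusion

module _ {A : Set} {P₁ P₂ P₃ : A → Set} (P₁? : Unary.Decidable P₁) (P₂? : Unary.Decidable P₂) (P₃? : Unary.Decidable P₃)
  (deg : A → ℕ) (xs : List A)
  (deg≡ : ∀ {v} → v ∈ xs → 𝟙 (P₁? v) ℕ.+ 𝟙 (P₂? v) ℕ.+ 𝟙 (P₃? v) ℕ.+ deg v ≡ 3)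
  (¬P₁₂₃ : ∀ {v} → v ∈ xs → P₁ v → P₂ v → ¬ P₃ v)
  {q r : ℕ}
  (#₁ : length (filter P₁? xs) ≡ q) (#₂ : length (filter P₂? xs) ≡ q) (#₃ : length (filter P₃? xs) ≡ q)
  (#₁₂ : length (filter (P₁? ∩? P₂?) xs) ≡ r) (#₁₃ : length (filter (P₁? ∩? P₃?) xs) ≡ r) (#₂₃ : length (filter (P₂? ∩? P₃?) xs) ≡ r) where

  private
    pairs singles : A → ℕ
    pairs v   = 𝟙 ((P₁? ∩? P₂?) v) ℕ.+ 𝟙 ((P₁? ∩? P₃?) v) ℕ.+ 𝟙 ((P₂? ∩? P₃?) v)
    singles v = 𝟙 (P₁? v) ℕ.+ 𝟙 (P₂? v) ℕ.+ 𝟙 (P₃? v)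

    Σ-three : ∀ (f g h : A → ℕ) {s} → Σ[ xs ] f ≡ s → Σ[ xs ] g ≡ s → Σ[ xs ] h ≡ s →
      Σ[ xs ] (λ v → f v ℕ.+ g v ℕ.+ h v) ≡ 3 ℕ.* s
    Σ-three f g h {s} refl eq₂ eq₃ = trans (Σ-+ xs (λ v → f v ℕ.+ g v) h)
      (trans (cong₂ ℕ._+_ (trans (Σ-+ xs f g) (cong (s ℕ.+_) eq₂)) eq₃) (arith s))
      where
      arith : ∀ s → s ℕ.+ s ℕ.+ s ≡ 3 ℕ.* s
      arith = ℕ-Solver.solve-∀

    count : ∀ {P : A → Set} (P? : Unary.Decidable P) {s} → length (filter P? xs) ≡ s → Σ[ xs ] (λ v → 𝟙 (P? v)) ≡ s
    count P? eq = trans (sym (length-filter P? xs)) eq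

    Σ-pairs : Σ[ xs ] pairs ≡ 3 ℕ.* r
    Σ-pairs = Σ-three _ _ _ (count (P₁? ∩? P₂?) #₁₂) (count (P₁? ∩? P₃?) #₁₃) (count (P₂? ∩? P₃?) #₂₃)

    Σ-singles : Σ[ xs ] singles ≡ 3 ℕ.* q
    Σ-singles = Σ-three _ _ _ (count P₁? #₁) (count P₂? #₂) (count P₃? #₃)

    -- Here d is the degree of a vertex and k the number of pairs of flips fixing it. As three flips
    -- never fix it, k is 0 or 1 and marks degree 1; the number of flips fixing it is 2 at degree 1,
    -- 1 at degree 2 and 0 at degree 3.
    Pointwise : ∀ {A B C : Set} → Dec A → Dec B → Dec C → ℕ → Set
    Pointwise A? B? C? d =
      let k = 𝟙 (A? ×-dec B?) ℕ.+ 𝟙 (A? ×-dec C?) ℕ.+ 𝟙 (B? ×-dec C?) in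
      𝟙 (d ℕ.≟ 0) ≡ 0 × 𝟙 (d ℕ.≟ 1) ≡ k ×
      𝟙 (d ℕ.≟ 2) ℕ.+ (k ℕ.+ k) ≡ 𝟙 A? ℕ.+ 𝟙 B? ℕ.+ 𝟙 C? × 𝟙 (d ℕ.<? 3) ≡ 𝟙 (d ℕ.≟ 1) ℕ.+ 𝟙 (d ℕ.≟ 2)

    cases : ∀ {A B C : Set} (A? : Dec A) (B? : Dec B) (C? : Dec C) {d} → 𝟙 A? ℕ.+ 𝟙 B? ℕ.+ 𝟙 C? ℕ.+ d ≡ 3 →
      (A → B → ¬ C) → Pointwise A? B? C? d
    cases (yes a) (yes b) (yes c) _    ¬abc = contradiction c (¬abc a b)
    cases (yes _) (yes _) (no  _) refl _    = refl , refl , refl , refl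
    cases (yes _) (no  _) (yes _) refl _    = refl , refl , refl , refl
    cases (yes _) (no  _) (no  _) refl _    = refl , refl , refl , refl
    cases (no  _) (yes _) (yes _) refl _    = refl , refl , refl , refl
    cases (no  _) (yes _) (no  _) refl _    = refl , refl , refl , refl
    cases (no  _) (no  _) (yes _) refl _    = refl , refl , refl , refl
    cases (no  _) (no  _) (no  _) refl _    = refl , refl , refl , refl

    pointwise : ∀ {v} → v ∈ xs → Pointwise (P₁? v) (P₂? v) (P₃? v) (deg v)
    pointwise {v} v∈xs = cases (P₁? v) (P₂? v) (P₃? v) (deg≡ v∈xs) (¬P₁₂₃ v∈xs)

  #degree-0 : length (filter (λ v → deg v ℕ.≟ 0) xs) ≡ 0
  #degree-0 = trans (length-filter (λ v → deg v ℕ.≟ 0) xs) (trans (Σ-cong (proj₁ ∘ pointwise)) (Σ-0 xs))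

  #degree-1 : length (filter (λ v → deg v ℕ.≟ 1) xs) ≡ 3 ℕ.* r
  #degree-1 = trans (length-filter (λ v → deg v ℕ.≟ 1) xs) (trans (Σ-cong (proj₁ ∘ proj₂ ∘ pointwise)) Σ-pairs)

  -- A vertex of degree 1 is fixed by two flips and so occurs twice among the 3 q. The correction
  -- stands on the left to avoid truncated subtraction.
  #degree-2 : length (filter (λ v → deg v ℕ.≟ 2) xs) ℕ.+ (3 ℕ.* r ℕ.+ 3 ℕ.* r) ≡ 3 ℕ.* q
  #degree-2 = begin
    length (filter (λ v → deg v ℕ.≟ 2) xs) ℕ.+ (3 ℕ.* r ℕ.+ 3 ℕ.* r)                    ≡⟨ cong₂ ℕ._+_
        (length-filter (λ v → deg v ℕ.≟ 2) xs) (sym (trans (Σ-+ xs pairs pairs) (cong₂ ℕ._+_ Σ-pairs Σ-pairs))) ⟩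
    Σ[ xs ] (λ v → 𝟙 (deg v ℕ.≟ 2)) ℕ.+ Σ[ xs ] (λ v → pairs v ℕ.+ pairs v)             ≡⟨ Σ-+ xs _ _ ⟨
    Σ[ xs ] (λ v → 𝟙 (deg v ℕ.≟ 2) ℕ.+ (pairs v ℕ.+ pairs v))                           ≡⟨ Σ-cong
        (proj₁ ∘ proj₂ ∘ proj₂ ∘ pointwise) ⟩
    Σ[ xs ] singles                                                                     ≡⟨ Σ-singles ⟩
    3 ℕ.* q                                                                             ∎
    where open ≡-Reasoning

  #degree-<3 : length (filter (λ v → deg v ℕ.<? 3) xs)
    ≡ length (filter (λ v → deg v ℕ.≟ 1) xs) ℕ.+ length (filter (λ v → deg v ℕ.≟ 2) xs)
  #degree-<3 = begin
    length (filter (λ v → deg v ℕ.<? 3) xs)                                             ≡⟨ length-filter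
        (λ v → deg v ℕ.<? 3) xs ⟩
    Σ[ xs ] (λ v → 𝟙 (deg v ℕ.<? 3))                                                    ≡⟨ Σ-cong
        (proj₂ ∘ proj₂ ∘ proj₂ ∘ pointwise) ⟩
    Σ[ xs ] (λ v → 𝟙 (deg v ℕ.≟ 1) ℕ.+ 𝟙 (deg v ℕ.≟ 2))                                 ≡⟨ Σ-+ xs _ _ ⟩
    Σ[ xs ] (λ v → 𝟙 (deg v ℕ.≟ 1)) ℕ.+ Σ[ xs ] (λ v → 𝟙 (deg v ℕ.≟ 2))                 ≡⟨ cong₂ ℕ._+_
        (length-filter (λ v → deg v ℕ.≟ 1) xs) (length-filter (λ v → deg v ℕ.≟ 2) xs) ⟨
    length (filter (λ v → deg v ℕ.≟ 1) xs) ℕ.+ length (filter (λ v → deg v ℕ.≟ 2) xs)   ∎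
    where open ≡-Reasoning

-- Primes p ≡ 2 (mod 3), and the polynomials of the surface as syntax

module _ {p : ℕ} .{{nz : NonZero p}} (pr : Prime p) (5≤p : 5 ℕ.≤ p) (p%3≡2 : p % 3 ≡ 2) where
  private F = 𝔽 p

  2<p : 2 ℕ.< p
  2<p = ℕ.≤-trans (ℕ.s≤s (ℕ.s≤s (ℕ.s≤s ℕ.z≤n))) 5≤p

  open QuadraticCharacter pr 2<p public

  3≢0 : ⟦ 3 ⟧ ≢ ⟦_⟧ {p} 0
  3≢0 = ⟦⟧≢0 3 (ℕ.≤-trans (ℕ.s≤s (ℕ.s≤s (ℕ.s≤s (ℕ.s≤s ℕ.z≤n)))) 5≤p)

  -- If w² = -3, then (w - 1)³ = 2³, so w = 3 because cubing is injective.
  -3-nonSquare : (w : F) → w ⊗ w ≢ ⊝ ⟦ 3 ⟧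
  -3-nonSquare w w²≡-3 = ⊗≢0 pr 2≢0 (⊗≢0 pr 2≢0 3≢0) (12≡0 (linear-combination (w ∷ [])
    (λ w →
      # 1 ,
      w :- # 1 := # 2 ,
      w := # 3) (cube-injective pr p%3≡2 {w ⊖ ⟦ 1 ⟧} {⟦ 2 ⟧} (linear-combination (w ∷ [])
        (λ w →
          w :- # 3 ,
          w :* w := :- # 3 ,
          (w :- # 1) :* (w :- # 1) :* (w :- # 1) := # 2 :* # 2 :* # 2) w²≡-3))))
    where
    12≡0 : w ≡ ⟦ 3 ⟧ → ⟦ 2 ⟧ ⊗ (⟦ 2 ⟧ ⊗ ⟦ 3 ⟧) ≡ ⟦ 0 ⟧
    12≡0 w≡3 = linear-combination₂ (w ∷ [])
      (λ w → # 1 , w :* w := :- # 3 , :- (w :+ # 3) , w := # 3 , # 2 :* (# 2 :* # 3) := # 0) w²≡-3 w≡3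

  -- Otherwise a / b would be a square root of -3. This is the form in which the non-squareness of
  -- -3 is used below.
  a²+3b²≡0⇒b≡0 : (a b : F) → a ⊗ a ⊕ ⟦ 3 ⟧ ⊗ (b ⊗ b) ≡ ⟦ 0 ⟧ → b ≡ ⟦ 0 ⟧
  a²+3b²≡0⇒b≡0 a b h = case b ≟ ⟦ 0 ⟧ of λ where
      (yes b≡0) → b≡0
      (no b≢0)  → contradiction (quotient (inv pr b) (inv-inverse pr b≢0)) (-3-nonSquare (a ⊗ inv pr b))
    where
    quotient : ∀ b⁻¹ → b ⊗ b⁻¹ ≡ ⟦ 1 ⟧ → (a ⊗ b⁻¹) ⊗ (a ⊗ b⁻¹) ≡ ⊝ ⟦ 3 ⟧
    quotient b⁻¹ bb⁻¹≡1 = linear-combination₂ (a ∷ b⁻¹ ∷ b ∷ [])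
      (λ a b⁻¹ b →
        b⁻¹ :* b⁻¹ ,
        a :* a :+ # 3 :* (b :* b) := # 0 ,
        :- (# 3 :* (b :* b⁻¹ :+ # 1)) ,
        b :* b⁻¹ := # 1 ,
        a :* b⁻¹ :* (a :* b⁻¹) := :- # 3) h bb⁻¹≡1

  -- Each Xᴾ evaluates to the X of the module Surface.
  module _ {k : ℕ} where
    private
      E = Expr k

    Cᴾ Dᴾ mᴾ jᴾ nᴾ Kᴾ : E → E
    Cᴾ J = # 3 :* (J :* J) :- # 4
    Dᴾ J = # 9 :* (J :* J :* J) :- # 36 :* J :- # 28
    mᴾ J = J :+ # 2
    jᴾ J = # 2 :- J
    nᴾ J = J :+ # 1
    Kᴾ J = # 9 :* jᴾ J :* (mᴾ J :* mᴾ J :* mᴾ J)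

    Curveᴾ : E → E → E → E
    Curveᴾ y z J = let Y = y :+ # 2 ; Z = z :+ # 2 in
      Y :* Z :* (Y :* Z :- # 4 :* (Y :+ Z) :+ # 6 :* jᴾ J :* mᴾ J) :- Kᴾ J

    Cubicᴾ : E → E → E
    Cubicᴾ x J = (x :- # 2) :* (x :* x :+ Cᴾ J :* x :- Dᴾ J) :+ Cᴾ J :* Cᴾ J

    αᴾ βᴾ rootᴾ : E → E → E
    αᴾ J e = :- (mᴾ J :* nᴾ J :* e)
    βᴾ J e = :- (mᴾ J :* nᴾ J :* (e :* e))
    rootᴾ J e = # 2 :- J :* J :+ αᴾ J e :+ βᴾ J e

    Cofactorᴾ : E → E → E → E
    Cofactorᴾ x J e = let u = x :- # 2 :+ J :* J ; α = αᴾ J e ; β = βᴾ J e in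
      u :* u :+ α :* α :+ β :* β :+ u :* α :+ u :* β :- α :* β

    leadingᴾ : E → E
    leadingᴾ x = x :* x :- # 4

    linearᴾ constantᴾ : E → E → E
    linearᴾ x J   = :- (# 2 :* Cᴾ J :* (x :+ # 2))
    constantᴾ x J = Cᴾ J :* Cᴾ J :- # 4 :* (x :* x :+ Cᴾ J :* x :- Dᴾ J)

    discriminantᴾ denominatorᴾ : E → E → E → E
    discriminantᴾ x y J = leadingᴾ x :* (y :* y) :+ linearᴾ x J :* y :+ constantᴾ x J
    denominatorᴾ s t J  = # 2 :* s :- # 2 :+ jᴾ J :* t

  -- The surface, its cubic P and the root of P

  module Surface (J : F) (J≢2 : J ≢ ⟦ 2 ⟧) (J≢-2 : J ≢ ⊝ ⟦ 2 ⟧) (J≢-1 : J ≢ ⊝ ⟦ 1 ⟧) where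

    C D m j n : F
    C = ⟦ 3 ⟧ ⊗ (J ⊗ J) ⊖ ⟦ 4 ⟧
    D = ⟦ 9 ⟧ ⊗ (J ⊗ J ⊗ J) ⊖ ⟦ 36 ⟧ ⊗ J ⊖ ⟦ 28 ⟧
    m = J ⊕ ⟦ 2 ⟧
    j = ⟦ 2 ⟧ ⊖ J
    n = J ⊕ ⟦ 1 ⟧

    m≢0 : m ≢ ⟦ 0 ⟧
    m≢0 h = J≢-2 (linear-combination (J ∷ []) (λ J → # 1 , mᴾ J := # 0 , J := :- # 2) h)

    j≢0 : j ≢ ⟦ 0 ⟧
    j≢0 h = J≢2 (linear-combination (J ∷ []) (λ J → :- # 1 , jᴾ J := # 0 , J := # 2) h)

    n≢0 : n ≢ ⟦ 0 ⟧
    n≢0 h = J≢-1 (linear-combination (J ∷ []) (λ J → # 1 , nᴾ J := # 0 , J := :- # 1) h)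

    K : F
    K = ⟦ 9 ⟧ ⊗ j ⊗ (m ⊗ m ⊗ m)

    K≢0 : K ≢ ⟦ 0 ⟧
    K≢0 h = ⊗≢0 pr (⊗≢0 pr 3≢0 3≢0) (⊗≢0 pr j≢0 (⊗≢0 pr m≢0 (⊗≢0 pr m≢0 m≢0))) (linear-combination (J ∷ [])
      (λ J → # 1 , Kᴾ J := # 0 , # 3 :* # 3 :* (jᴾ J :* (mᴾ J :* (mᴾ J :* mᴾ J))) := # 0) h)

    -- This is (y z - C)² - 4 (y² + z² + C (y + z) - D), the discriminant of the surface equation in
    -- x. In the shifted coordinates every term but - K is divisible by Y Z, so the curve does not
    -- meet y = -2 or z = -2.
    Curve : F → F → F
    Curve y z = let Y = y ⊕ ⟦ 2 ⟧ ; Z = z ⊕ ⟦ 2 ⟧ in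
      Y ⊗ Z ⊗ (Y ⊗ Z ⊖ ⟦ 4 ⟧ ⊗ (Y ⊕ Z) ⊕ ⟦ 6 ⟧ ⊗ j ⊗ m) ⊖ K

    -- The first flip fixes the vertex exactly when u = 0, and then the surface equation becomes the
    -- equation of the curve.
    surface-completed-square : ∀ x y z → let u = ⟦ 2 ⟧ ⊗ x ⊖ (y ⊗ z ⊖ C) in
      ⟦ 4 ⟧ ⊗ ((x ⊗ x ⊕ y ⊗ y ⊕ z ⊗ z) ⊖ (x ⊗ y ⊗ z ⊖ C ⊗ (x ⊕ y ⊕ z) ⊕ D)) ≡ u ⊗ u ⊖ Curve y z
    surface-completed-square x y z = identity (x ∷ y ∷ z ∷ J ∷ [])
      (λ x y z J →
        # 4 :* (x :* x :+ y :* y :+ z :* z :- (x :* y :* z :- Cᴾ J :* (x :+ y :+ z) :+ Dᴾ J)) :=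
          (# 2 :* x :- (y :* z :- Cᴾ J)) :* (# 2 :* x :- (y :* z :- Cᴾ J)) :- Curveᴾ y z J)

    Cubic : F → F
    Cubic x = (x ⊖ ⟦ 2 ⟧) ⊗ (x ⊗ x ⊕ C ⊗ x ⊖ D) ⊕ C ⊗ C

    -- The value of the cubic at 2 is C².
    Cubic-2 : ∀ {x} → x ≡ ⟦ 2 ⟧ → Cubic x ≡ ⟦ 0 ⟧ → C ≡ ⟦ 0 ⟧
    Cubic-2 {x} x≡2 h = [ (λ c → c) , (λ c → c) ]′ (⊗≡0 pr C C
      (linear-combination₂ (x ∷ J ∷ [])
        (λ x J →
          # 1 ,
          Cubicᴾ x J := # 0 ,
          :- (x :* x :+ Cᴾ J :* x :- Dᴾ J) ,
          x := # 2 ,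
          Cᴾ J :* Cᴾ J := # 0) h x≡2))

    -- The value of the cubic at -2 is - K.
    Cubic--2 : ∀ {x} → x ≡ ⊝ ⟦ 2 ⟧ → Cubic x ≢ ⟦ 0 ⟧
    Cubic--2 {x} x≡-2 h = K≢0 (linear-combination₂ (x ∷ J ∷ [])
      (λ x J →
        :- # 1 ,
        Cubicᴾ x J := # 0 ,
        x :* x :- # 4 :* x :+ # 8 :+ Cᴾ J :* (x :- # 4) :- Dᴾ J ,
        x := :- # 2 ,
        Kᴾ J := # 0) h x≡-2)

    e : F
    e = cbrt pr p%3≡2 ((J ⊖ ⟦ 2 ⟧) ⊗ inv pr n)

    e³n : e ⊗ e ⊗ e ⊗ n ≡ J ⊖ ⟦ 2 ⟧
    e³n = trans (cong (_⊗ n) (cbrt-cubed pr p%3≡2 ((J ⊖ ⟦ 2 ⟧) ⊗ inv pr n))) (cancel (inv pr n) (inv-inverse pr n≢0))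
      where
      cancel : ∀ n⁻¹ → n ⊗ n⁻¹ ≡ ⟦ 1 ⟧ → (J ⊖ ⟦ 2 ⟧) ⊗ n⁻¹ ⊗ n ≡ J ⊖ ⟦ 2 ⟧
      cancel n⁻¹ h = linear-combination (n⁻¹ ∷ J ∷ [])
        (λ n⁻¹ J → J :- # 2 , nᴾ J :* n⁻¹ := # 1 , (J :- # 2) :* n⁻¹ :* nᴾ J := J :- # 2) h

    module _ (e : F) (e³n : e ⊗ e ⊗ e ⊗ n ≡ J ⊖ ⟦ 2 ⟧) where

      e≢0 : e ≢ ⟦ 0 ⟧
      e≢0 h = J≢2 (linear-combination₂ (J ∷ e ∷ [])
        (λ J e → :- # 1 , e :* e :* e :* nᴾ J := J :- # 2 , e :* e :* nᴾ J , e := # 0 , J := # 2) e³n h)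

      -- For e = 1 the equation of e would read J + 1 = J - 2.
      1-e≢0 : ⟦ 1 ⟧ ⊖ e ≢ ⟦ 0 ⟧
      1-e≢0 h = 3≢0 (linear-combination₂ (J ∷ e ∷ [])
        (λ J e →
          # 1 ,
          e :* e :* e :* nᴾ J := J :- # 2 ,
          nᴾ J :* (e :* e :+ e :+ # 1) ,
          # 1 :- e := # 0 ,
          # 3 := # 0) e³n h)

      -- With x = 2 - J² + u the cubic is u³ - 3 α β u - (α³ + β³).
      α β : F
      α = ⊝ (m ⊗ n ⊗ e)
      β = ⊝ (m ⊗ n ⊗ (e ⊗ e))

      root : F
      root = ⟦ 2 ⟧ ⊖ J ⊗ J ⊕ α ⊕ β

      Cofactor : F → F
      Cofactor x = let u = x ⊖ ⟦ 2 ⟧ ⊕ J ⊗ J in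
        u ⊗ u ⊕ α ⊗ α ⊕ β ⊗ β ⊕ u ⊗ α ⊕ u ⊗ β ⊖ α ⊗ β

      -- This is u³ - α³ - β³ - 3 α β u = (u - α - β)(u² + α² + β² + u α + u β - α β). Both α β and
      -- α³ + β³ contain e only through e³, which `e³n` eliminates.
      Cubic-factors : ∀ x → Cubic x ≡ (x ⊖ root) ⊗ Cofactor x
      Cubic-factors x = linear-combination (x ∷ J ∷ e ∷ [])
        (λ x J e →
          # 3 :* nᴾ J :* (mᴾ J :* mᴾ J) :* (x :- # 2 :+ J :* J)
            :- mᴾ J :* mᴾ J :* mᴾ J :* nᴾ J :* (nᴾ J :+ e :* e :* e :* nᴾ J :+ (J :- # 2)) ,
          e :* e :* e :* nᴾ J := J :- # 2 ,
          Cubicᴾ x J := (x :- rootᴾ J e) :* Cofactorᴾ x J e) e³n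

      α-β≢0 : α ⊖ β ≢ ⟦ 0 ⟧
      α-β≢0 h = ⊗≢0 pr (⊗≢0 pr m≢0 n≢0) (⊗≢0 pr e≢0 1-e≢0) (linear-combination (J ∷ e ∷ [])
        (λ J e → :- # 1 , αᴾ J e :- βᴾ J e := # 0 , mᴾ J :* nᴾ J :* (e :* (# 1 :- e)) := # 0) h)

      -- Four times the cofactor is (2 u + α + β)² + 3 (α - β)².
      Cofactor≢0 : ∀ x → Cofactor x ≢ ⟦ 0 ⟧
      Cofactor≢0 x h = α-β≢0 (a²+3b²≡0⇒b≡0 (⟦ 2 ⟧ ⊗ (x ⊖ ⟦ 2 ⟧ ⊕ J ⊗ J) ⊕ α ⊕ β) (α ⊖ β)
        (linear-combination (x ∷ J ∷ e ∷ [])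
          (λ x J e →
            # 4 ,
            Cofactorᴾ x J e := # 0 ,
            (# 2 :* (x :- # 2 :+ J :* J) :+ αᴾ J e :+ βᴾ J e)
              :* (# 2 :* (x :- # 2 :+ J :* J) :+ αᴾ J e :+ βᴾ J e)
              :+ # 3 :* ((αᴾ J e :- βᴾ J e) :* (αᴾ J e :- βᴾ J e)) := # 0) h))

      Cubic-root : Cubic root ≡ ⟦ 0 ⟧
      Cubic-root = trans (Cubic-factors root) (trans (cong (_⊗ Cofactor root) (⊕-inverseʳ root)) (𝔽.zeroˡ (Cofactor root)))

      Cubic-root-unique : ∀ x → Cubic x ≡ ⟦ 0 ⟧ → x ≡ root
      Cubic-root-unique x h = [ ⊖≡0⇒≡ , (λ q → contradiction q (Cofactor≢0 x)) ]′
        (⊗≡0 pr (x ⊖ root) (Cofactor x) (trans (sym (Cubic-factors x)) h))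

      -- Put q = e² - 2 e - 2. Since n (1 - e³) = 3, one has J = (2 + e³) / (1 - e³), which yields
      -- root + 2 = -3 m e / (1 - e) and root - 2 = -q² / ((1 - e)(1 - e³)), while J² - 4 = 3 m e³ /
      -- (1 - e³).
      root²-4 : ((e ⊗ (⟦ 1 ⟧ ⊖ e)) ⊗ (e ⊗ (⟦ 1 ⟧ ⊖ e))) ⊗ (root ⊗ root ⊖ ⟦ 4 ⟧)
                ≡ ((e ⊗ e ⊖ ⟦ 2 ⟧ ⊗ e ⊖ ⟦ 2 ⟧) ⊗ (e ⊗ e ⊖ ⟦ 2 ⟧ ⊗ e ⊖ ⟦ 2 ⟧)) ⊗ (J ⊗ J ⊖ ⟦ 4 ⟧)
      root²-4 = linear-combination (J ∷ e ∷ [])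
        (λ J e → let e² = e :* e ; e³ = e² :* e ; e⁵ = e³ :* e² in
          ((e⁵ :- e²) :* J :+ (# 5 :* e⁵ :- # 6 :* e³ :- # 2 :* e²)) :* (J :* J)
            :+ (# 8 :* e⁵ :- # 20 :* e³ :+ # 8 :* e :+ # 4) :* J
            :+ (# 4 :* e⁵ :- # 16 :* e³ :+ # 16 :* e :+ # 8) ,
          e :* e :* e :* nᴾ J := J :- # 2 ,
          e :* (# 1 :- e) :* (e :* (# 1 :- e)) :* (rootᴾ J e :* rootᴾ J e :- # 4) :=
            (e :* e :- # 2 :* e :- # 2) :* (e :* e :- # 2 :* e :- # 2) :* (J :* J :- # 4)) e³n

      module _ (C≢0 : C ≢ ⟦ 0 ⟧) where

        root≢2 : root ⊖ ⟦ 2 ⟧ ≢ ⟦ 0 ⟧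
        root≢2 h = C≢0 (Cubic-2 (⊖≡0⇒≡ h) Cubic-root)

        root≢-2 : root ⊕ ⟦ 2 ⟧ ≢ ⟦ 0 ⟧
        root≢-2 h = Cubic--2 (lem root h) Cubic-root
          where
          lem : ∀ r → r ⊕ ⟦ 2 ⟧ ≡ ⟦ 0 ⟧ → r ≡ ⊝ ⟦ 2 ⟧
          lem r h = linear-combination (r ∷ []) (λ r → # 1 , r :+ # 2 := # 0 , r := :- # 2) h

        -- This makes the slice at the root of the cubic contribute as much as the slice x = -2,
        -- whence the factor 2 in the number of vertices.
        σ-root : σ (root ⊗ root ⊖ ⟦ 4 ⟧) ≡ σ (J ⊗ J ⊖ ⟦ 4 ⟧)
        σ-root = trans (sym (σ-square-⊗ (⊗≢0 pr e≢0 1-e≢0) refl))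
          -- If q were 0, then `root²-4` would force root = ±2, and both values are excluded.
          (σ-square-⊗ {b = q} (λ q≡0 → ⊗≢0 pr (⊗≢0 pr root≢2 root≢-2) (⊗≢0 pr e-≢0 e-≢0)
              (absurd q q≡0 root²-4)) (sym root²-4))
          where
          q = e ⊗ e ⊖ ⟦ 2 ⟧ ⊗ e ⊖ ⟦ 2 ⟧
          e-≢0 : e ⊗ (⟦ 1 ⟧ ⊖ e) ≢ ⟦ 0 ⟧
          e-≢0 = ⊗≢0 pr e≢0 1-e≢0
          lem : ∀ f r q → q ≡ ⟦ 0 ⟧ → (f ⊗ f) ⊗ (r ⊗ r ⊖ ⟦ 4 ⟧) ≡ (q ⊗ q) ⊗ (J ⊗ J ⊖ ⟦ 4 ⟧) →
                (r ⊖ ⟦ 2 ⟧) ⊗ (r ⊕ ⟦ 2 ⟧) ⊗ (f ⊗ f) ≡ ⟦ 0 ⟧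
          lem f r q q≡0 h = linear-combination₂ (r ∷ f ∷ q ∷ J ∷ [])
            (λ r f q J →
              # 1 ,
              f :* f :* (r :* r :- # 4) := q :* q :* (J :* J :- # 4) ,
              q :* (J :* J :- # 4) ,
              q := # 0 ,
              (r :- # 2) :* (r :+ # 2) :* (f :* f) := # 0) h q≡0
          absurd : ∀ q → q ≡ ⟦ 0 ⟧ → _ → _
          absurd q = lem (e ⊗ (⟦ 1 ⟧ ⊖ e)) root q

    -- The number of vertices

    leading linear constant : F → F
    leading x   = x ⊗ x ⊖ ⟦ 4 ⟧
    linear x    = ⊝ (⟦ 2 ⟧ ⊗ C ⊗ (x ⊕ ⟦ 2 ⟧))
    constant x = C ⊗ C ⊖ ⟦ 4 ⟧ ⊗ (x ⊗ x ⊕ C ⊗ x ⊖ D)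

    discriminant : F → F → F
    discriminant x y = leading x ⊗ (y ⊗ y) ⊕ linear x ⊗ y ⊕ constant x

    sum-discriminants : F → ℤ
    sum-discriminants x = sum (λ y → σ (discriminant x y))

    #z : ∀ x y → sum (λ z → ι (solution? C D (x , y , z))) ≡ 1ℤ ℤ.+ σ (discriminant x y)
    #z x y = begin
      sum (λ z → ι (solution? C D (x , y , z)))                 ≡⟨ sum-cong-≗
          (λ z → ι-⇔ (solution? C D (x , y , z)) (z ⊗ z ⊕ b ⊗ z ⊕ c ≟ ⟦ 0 ⟧) (to z) (from z)) ⟩
      sum (λ z → ι (z ⊗ z ⊕ b ⊗ z ⊕ c ≟ ⟦ 0 ⟧))                 ≡⟨ #quadratic-roots b c ⟩
      1ℤ ℤ.+ σ (b ⊗ b ⊖ ⟦ 4 ⟧ ⊗ c)                              ≡⟨ cong (λ d → 1ℤ ℤ.+ σ d) disc ⟩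
      1ℤ ℤ.+ σ (discriminant x y)                               ∎
      where
      open ≡-Reasoning
      b = C ⊖ x ⊗ y
      c = x ⊗ x ⊕ y ⊗ y ⊕ C ⊗ (x ⊕ y) ⊖ D
      to : ∀ z → Solution C D (x , y , z) → z ⊗ z ⊕ b ⊗ z ⊕ c ≡ ⟦ 0 ⟧
      to z h = linear-combination (z ∷ x ∷ y ∷ J ∷ [])
        (λ z x y J →
          # 1 ,
          x :* x :+ y :* y :+ z :* z := x :* y :* z :- Cᴾ J :* (x :+ y :+ z) :+ Dᴾ J ,
          z :* z :+ (Cᴾ J :- x :* y) :* z :+ (x :* x :+ y :* y :+ Cᴾ J :* (x :+ y) :- Dᴾ J) := # 0) h
      from : ∀ z → z ⊗ z ⊕ b ⊗ z ⊕ c ≡ ⟦ 0 ⟧ → Solution C D (x , y , z)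
      from z h = linear-combination (x ∷ y ∷ z ∷ J ∷ [])
        (λ x y z J →
          # 1 ,
          z :* z :+ (Cᴾ J :- x :* y) :* z :+ (x :* x :+ y :* y :+ Cᴾ J :* (x :+ y) :- Dᴾ J) := # 0 ,
          x :* x :+ y :* y :+ z :* z := x :* y :* z :- Cᴾ J :* (x :+ y :+ z) :+ Dᴾ J) h
      disc : b ⊗ b ⊖ ⟦ 4 ⟧ ⊗ c ≡ discriminant x y
      disc = identity (x ∷ y ∷ J ∷ [])
        (λ x y J →
          (Cᴾ J :- x :* y) :* (Cᴾ J :- x :* y) :- # 4 :* (x :* x :+ y :* y :+ Cᴾ J :* (x :+ y) :- Dᴾ J) :=
            discriminantᴾ x y J)

    leading≢0 : ∀ {x} → x ≢ ⟦ 2 ⟧ → x ≢ ⊝ ⟦ 2 ⟧ → leading x ≢ ⟦ 0 ⟧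
    leading≢0 {x} x≢2 x≢-2 h =
      [ (λ h → x≢2 (⊖≡0⇒≡ h)) , (λ h → x≢-2 (linear-combination (x ∷ []) (λ x → # 1 , x :+ # 2 := # 0 , x := :- # 2) h)) ]′
        (⊗≡0 pr (x ⊖ ⟦ 2 ⟧) (x ⊕ ⟦ 2 ⟧) (linear-combination (x ∷ [])
          (λ x → # 1 , leadingᴾ x := # 0 , (x :- # 2) :* (x :+ # 2) := # 0) h))

    leading-2 : ∀ {x} → x ≡ ⟦ 2 ⟧ → leading x ≡ ⟦ 0 ⟧
    leading-2 {x} h = linear-combination (x ∷ []) (λ x → x :+ # 2 , x := # 2 , leadingᴾ x := # 0) h

    leading--2 : ∀ {x} → x ≡ ⊝ ⟦ 2 ⟧ → leading x ≡ ⟦ 0 ⟧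
    leading--2 {x} h = linear-combination (x ∷ []) (λ x → x :- # 2 , x := :- # 2 , leadingᴾ x := # 0) h

    discriminant-discriminant : ∀ x → linear x ⊗ linear x ⊖ ⟦ 4 ⟧ ⊗ leading x ⊗ constant x
      ≡ ⟦ 16 ⟧ ⊗ (x ⊕ ⟦ 2 ⟧) ⊗ Cubic x
    discriminant-discriminant x = identity (x ∷ J ∷ [])
      (λ x J →
        linearᴾ x J :* linearᴾ x J :- # 4 :* leadingᴾ x :* constantᴾ x J :=
          # 16 :* (x :+ # 2) :* Cubicᴾ x J)

    sum-discriminants-generic : ∀ {x} → x ≢ ⟦ 2 ⟧ → x ≢ ⊝ ⟦ 2 ⟧ → Cubic x ≢ ⟦ 0 ⟧ →
      sum-discriminants x ≡ ℤ.- σ (leading x)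
    sum-discriminants-generic {x} x≢2 x≢-2 Px≢0 = sum-σ-nondegenerate (leading≢0 x≢2 x≢-2) (linear x) (constant x)
      λ h → ⊗≢0 pr (⊗≢0 pr (⊗≢0 pr 2≢0 2≢0) (⊗≢0 pr 2≢0 2≢0))
                   (⊗≢0 pr {x ⊕ ⟦ 2 ⟧} {Cubic x} (λ h → x≢-2
                       (linear-combination (x ∷ []) (λ x → # 1 , x :+ # 2 := # 0 , x := :- # 2) h)) Px≢0)
                   (lem (x ⊕ ⟦ 2 ⟧) (Cubic x) (trans (sym (discriminant-discriminant x)) h))
      where
      lem : ∀ a b → ⟦ 16 ⟧ ⊗ a ⊗ b ≡ ⟦ 0 ⟧ → (⟦ 2 ⟧ ⊗ ⟦ 2 ⟧ ⊗ (⟦ 2 ⟧ ⊗ ⟦ 2 ⟧)) ⊗ (a ⊗ b) ≡ ⟦ 0 ⟧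
      lem a b h = linear-combination (a ∷ b ∷ [])
        (λ a b → # 1 , # 16 :* a :* b := # 0 , # 2 :* # 2 :* (# 2 :* # 2) :* (a :* b) := # 0) h

    sum-discriminants-root : ∀ {x} → x ≢ ⟦ 2 ⟧ → x ≢ ⊝ ⟦ 2 ⟧ → Cubic x ≡ ⟦ 0 ⟧ →
      sum-discriminants x ≡ ℤ.- σ (leading x) ℤ.+ + p ℤ.* σ (leading x)
    sum-discriminants-root {x} x≢2 x≢-2 Px≡0 = sum-σ-degenerate (leading≢0 x≢2 x≢-2) (linear x) (constant x)
      (trans (discriminant-discriminant x) (trans (cong (⟦ 16 ⟧ ⊗ (x ⊕ ⟦ 2 ⟧) ⊗_) Px≡0) (𝔽.zeroʳ (⟦ 16 ⟧ ⊗ (x ⊕ ⟦ 2 ⟧)))))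

    -- At x = -2 the coefficients of y² and y both vanish, and the constant left is - K = (3 m)² (J²
    -- - 4).
    sum-discriminants--2 : ∀ {x} → x ≡ ⊝ ⟦ 2 ⟧ → sum-discriminants x ≡ + p ℤ.* σ (J ⊗ J ⊖ ⟦ 4 ⟧)
    sum-discriminants--2 {x} x≡-2 = trans (sum-cong-≗ λ y → σ-square-⊗ (⊗≢0 pr 3≢0 m≢0) (sym (const y)))
        (sum-const p (σ (J ⊗ J ⊖ ⟦ 4 ⟧)))
      where
      const : ∀ y → discriminant x y ≡ (⟦ 3 ⟧ ⊗ m) ⊗ (⟦ 3 ⟧ ⊗ m) ⊗ (J ⊗ J ⊖ ⟦ 4 ⟧)
      const y = linear-combination (x ∷ y ∷ J ∷ [])
        (λ x y J →
          (x :- # 2) :* (y :* y) :- # 2 :* Cᴾ J :* y :- # 4 :* (x :- # 2 :+ Cᴾ J) ,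
          x := :- # 2 ,
          discriminantᴾ x y J := # 3 :* mᴾ J :* (# 3 :* mᴾ J) :* (J :* J :- # 4)) x≡-2

    -- At x = 2 the discriminant is linear in y with slope -8 C, so its values run through the whole
    -- field.
    sum-discriminants-2 : ∀ {x} → x ≡ ⟦ 2 ⟧ → C ≢ ⟦ 0 ⟧ → sum-discriminants x ≡ 0ℤ
    sum-discriminants-2 {x} x≡2 C≢0 = trans (sum-cong-≗ (λ y → cong σ (affine y))) (sum-σ-affine lin≢0 (constant x))
      where
      affine : ∀ y → discriminant x y ≡ linear x ⊗ y ⊕ constant x
      affine y = linear-combination (x ∷ y ∷ J ∷ [])
        (λ x y J →
          y :* y ,
          leadingᴾ x := # 0 ,
          discriminantᴾ x y J := linearᴾ x J :* y :+ constantᴾ x J) (leading-2 x≡2)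
      lin≢0 : linear x ≢ ⟦ 0 ⟧
      lin≢0 h = ⊗≢0 pr 2≢0 (⊗≢0 pr 2≢0 (⊗≢0 pr 2≢0 C≢0)) (lem C h)
        where
        lem : ∀ c → ⊝ (⟦ 2 ⟧ ⊗ c ⊗ (x ⊕ ⟦ 2 ⟧)) ≡ ⟦ 0 ⟧ → ⟦ 2 ⟧ ⊗ (⟦ 2 ⟧ ⊗ (⟦ 2 ⟧ ⊗ c)) ≡ ⟦ 0 ⟧
        lem c h = linear-combination₂ (c ∷ x ∷ [])
          (λ c x →
            :- # 1 ,
            :- (# 2 :* c :* (x :+ # 2)) := # 0 ,
            :- (# 2 :* c) ,
            x := # 2 ,
            # 2 :* (# 2 :* (# 2 :* c)) := # 0) h x≡2

    4≢0 : ⟦ 4 ⟧ ≢ ⟦_⟧ {p} 0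
    4≢0 = ⟦⟧≢0 4 5≤p

    2≢-2 : ⟦ 2 ⟧ ≢ ⊝ ⟦_⟧ {p} 2
    2≢-2 h = 4≢0 (trans (sym (⟦+⟧ 2 2)) (trans (cong (⟦ 2 ⟧ ⊕_) h) (⊕-inverseʳ ⟦ 2 ⟧)))

    module _ (A : ℤ) (w : F) where
      private
        Rhs : ℤ → ℤ → ℤ → ℤ
        Rhs s i k = ℤ.- s ℤ.+ + p ℤ.* (A ℤ.* (i ℤ.+ k))

        rhs-cong : ∀ {x s i k} → σ (leading x) ≡ s → ι (x ≟ ⊝ ⟦ 2 ⟧) ≡ i → ι (x ≟ w) ≡ k →
          Rhs (σ (leading x)) (ι (x ≟ ⊝ ⟦ 2 ⟧)) (ι (x ≟ w)) ≡ Rhs s i k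
        rhs-cong refl refl refl = refl

      -- A common shape for both cases, so that the sum over x is carried out once. A is the
      -- character value at the exceptional slices x = -2 and x = w, where w is the root of the
      -- cubic, or 2 if J² = 4/3.
      SumDiscriminants : F → Set
      SumDiscriminants x = sum-discriminants x ≡ ℤ.- σ (leading x) ℤ.+ + p ℤ.* (A ℤ.* (ι (x ≟ ⊝ ⟦ 2 ⟧) ℤ.+ ι (x ≟ w)))

      #solutions : (∀ x → SumDiscriminants x) →
        sum (λ x → sum (λ y → sum (λ z → ι (solution? C D (x , y , z))))) ≡ + (p ℕ.^ 2) ℤ.+ 1ℤ ℤ.+ + 2 ℤ.* A ℤ.* + p
      #solutions h = begin
        sum (λ x → sum (λ y → sum (λ z → ι (solution? C D (x , y , z)))))
          ≡⟨ sum-cong-≗ (λ x → trans (sum-cong-≗ (#z x))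
              (trans (∑-distrib-+ {p} (λ _ → 1ℤ) (λ y → σ (discriminant x y)))
              (cong₂ ℤ._+_ (trans (sum-const p 1ℤ) (ℤ.*-identityʳ (+ p))) (h x)))) ⟩
        sum (λ x → + p ℤ.+ (ℤ.- σ (leading x) ℤ.+ + p ℤ.* (A ℤ.* (ι (x ≟ ⊝ ⟦ 2 ⟧) ℤ.+ ι (x ≟ w)))))
          ≡⟨ ∑-distrib-+ {p} (λ _ → + p) (λ x → ℤ.- σ (leading x) ℤ.+ + p ℤ.* (A ℤ.* (ι (x ≟ ⊝ ⟦ 2 ⟧) ℤ.+ ι (x ≟ w)))) ⟩
        sum {p} (λ x → + p) ℤ.+ sum (λ x → ℤ.- σ (leading x) ℤ.+ + p ℤ.* (A ℤ.* (ι (x ≟ ⊝ ⟦ 2 ⟧) ℤ.+ ι (x ≟ w))))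
          ≡⟨ cong₂ ℤ._+_ (sum-const p (+ p))
              (∑-distrib-+ {p} (λ x → ℤ.- σ (leading x)) (λ x → + p ℤ.* (A ℤ.* (ι (x ≟ ⊝ ⟦ 2 ⟧) ℤ.+ ι (x ≟ w))))) ⟩
        + p ℤ.* + p ℤ.+ (sum (λ x → ℤ.- σ (leading x)) ℤ.+ sum (λ x → + p ℤ.* (A ℤ.* (ι (x ≟ ⊝ ⟦ 2 ⟧) ℤ.+ ι (x ≟ w)))))
          ≡⟨ cong (λ s → + p ℤ.* + p ℤ.+ s) (cong₂ ℤ._+_ sum-leading sum-ι) ⟩
        + p ℤ.* + p ℤ.+ (1ℤ ℤ.+ + p ℤ.* (A ℤ.* + 2))
          ≡⟨ cong (λ s → s ℤ.+ (1ℤ ℤ.+ + p ℤ.* (A ℤ.* + 2)))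
              (trans (sym (ℤ.pos-* p p)) (cong (λ k → + (p ℕ.* k)) (sym (ℕ.*-identityʳ p)))) ⟩
        + (p ℕ.^ 2) ℤ.+ (1ℤ ℤ.+ + p ℤ.* (A ℤ.* + 2))
          ≡⟨ rearrange (+ (p ℕ.^ 2)) (+ p) A ⟩
        + (p ℕ.^ 2) ℤ.+ 1ℤ ℤ.+ + 2 ℤ.* A ℤ.* + p
          ∎
        where
        open ≡-Reasoning
        rearrange : ∀ q r A → q ℤ.+ (1ℤ ℤ.+ r ℤ.* (A ℤ.* + 2)) ≡ q ℤ.+ 1ℤ ℤ.+ + 2 ℤ.* A ℤ.* r
        rearrange = ℤ-Solver.solve-∀
        -- The leading coefficient x² - 4 has the form u² - Δ with Δ = 4; this sum is the 1 in p² +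
        -- 1.
        sum-leading : sum (λ x → ℤ.- σ (leading x)) ≡ 1ℤ
        sum-leading = trans (sum-cong-≗ (λ x → sym (ℤ.-1*i≡-i (σ (leading x)))))
          (trans (sym (*-distribˡ-sum -1ℤ (λ x → σ (leading x)))) (cong (λ s → -1ℤ ℤ.* s) (sum-σ-u²-Δ 4≢0)))
        sum-ι : sum (λ x → + p ℤ.* (A ℤ.* (ι (x ≟ ⊝ ⟦ 2 ⟧) ℤ.+ ι (x ≟ w)))) ≡ + p ℤ.* (A ℤ.* + 2)
        sum-ι = trans (sym (*-distribˡ-sum (+ p) (λ x → A ℤ.* (ι (x ≟ ⊝ ⟦ 2 ⟧) ℤ.+ ι (x ≟ w)))))
          (cong (λ s → + p ℤ.* s) (trans (sym (*-distribˡ-sum A (λ x → ι (x ≟ ⊝ ⟦ 2 ⟧) ℤ.+ ι (x ≟ w))))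
            (cong (λ s → A ℤ.* s) (trans (∑-distrib-+ (λ x → ι (x ≟ ⊝ ⟦ 2 ⟧)) (λ x → ι (x ≟ w)))
                (cong₂ ℤ._+_ (sum-δ (⊝ ⟦ 2 ⟧)) (sum-δ w))))))

      module _ (w≢-2 : w ≢ ⊝ ⟦ 2 ⟧) where

        at--2 : A ≡ σ (J ⊗ J ⊖ ⟦ 4 ⟧) → ∀ {x} → x ≡ ⊝ ⟦ 2 ⟧ → SumDiscriminants x
        at--2 refl {x} x≡-2 = trans (sum-discriminants--2 x≡-2) (trans (arith A (+ p))
          (sym (rhs-cong {x} (σ-zero (leading--2 x≡-2)) (ι-true (x ≟ ⊝ ⟦ 2 ⟧) x≡-2)
              (ι-false (x ≟ w) λ x≡w → w≢-2 (trans (sym x≡w) x≡-2)))))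
          where
          arith : ∀ A r → r ℤ.* A ≡ ℤ.- 0ℤ ℤ.+ r ℤ.* (A ℤ.* (1ℤ ℤ.+ 0ℤ))
          arith = ℤ-Solver.solve-∀

        at-w : ∀ {x} → x ≡ w → sum-discriminants x ≡ ℤ.- σ (leading x) ℤ.+ + p ℤ.* A → SumDiscriminants x
        at-w {x} x≡w h = trans h (trans (arith A (+ p) (σ (leading x)))
          (sym (rhs-cong {x} refl (ι-false (x ≟ ⊝ ⟦ 2 ⟧) λ x≡-2 → w≢-2 (trans (sym x≡w) x≡-2)) (ι-true (x ≟ w) x≡w))))
          where
          arith : ∀ A r s → ℤ.- s ℤ.+ r ℤ.* A ≡ ℤ.- s ℤ.+ r ℤ.* (A ℤ.* (0ℤ ℤ.+ 1ℤ))
          arith = ℤ-Solver.solve-∀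

      elsewhere : ∀ {x} → x ≢ ⊝ ⟦ 2 ⟧ → x ≢ w → sum-discriminants x ≡ ℤ.- σ (leading x) → SumDiscriminants x
      elsewhere {x} x≢-2 x≢w h = trans h (trans (arith A (+ p) (σ (leading x)))
        (sym (rhs-cong {x} refl (ι-false (x ≟ ⊝ ⟦ 2 ⟧) x≢-2) (ι-false (x ≟ w) x≢w))))
        where
        arith : ∀ A r s → ℤ.- s ≡ ℤ.- s ℤ.+ r ℤ.* (A ℤ.* (0ℤ ℤ.+ 0ℤ))
        arith = ℤ-Solver.solve-∀

    #solutions-generic : C ≢ ⟦ 0 ⟧ →
      sum (λ x → sum (λ y → sum (λ z → ι (solution? C D (x , y , z)))))
        ≡ + (p ℕ.^ 2) ℤ.+ 1ℤ ℤ.+ + 2 ℤ.* σ (J ⊗ J ⊖ ⟦ 4 ⟧) ℤ.* + p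
    #solutions-generic C≢0 = #solutions A w λ x → case x ≟ ⊝ ⟦ 2 ⟧ of λ where
        (yes x≡-2) → at--2 A w w≢-2 refl x≡-2
        (no x≢-2) → case x ≟ w of λ where
          (yes x≡w) → at-w A w w≢-2 x≡w
            (trans (sum-discriminants-root (λ x≡2 → w≢2 (trans (sym x≡w) x≡2)) x≢-2
                (trans (cong Cubic x≡w) (Cubic-root e e³n)))
              (cong (λ s → ℤ.- σ (leading x) ℤ.+ + p ℤ.* s) (trans (cong (λ x → σ (leading x)) x≡w) (σ-root e e³n C≢0))))
          (no x≢w) → elsewhere A w x≢-2 x≢w (case x ≟ ⟦ 2 ⟧ of λ where
            (yes x≡2) → trans (sum-discriminants-2 x≡2 C≢0) (sym (cong (λ s → ℤ.- s) (σ-zero (leading-2 x≡2))))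
            (no x≢2) → sum-discriminants-generic x≢2 x≢-2 (λ Px≡0 → x≢w (Cubic-root-unique e e³n x Px≡0)))
      where
      A = σ (J ⊗ J ⊖ ⟦ 4 ⟧)
      w = root e e³n
      w≢2 : w ≢ ⟦ 2 ⟧
      w≢2 h = C≢0 (Cubic-2 h (Cubic-root e e³n))
      w≢-2 : w ≢ ⊝ ⟦ 2 ⟧
      w≢-2 h = Cubic--2 h (Cubic-root e e³n)

    module _ (special : ⟦ 3 ⟧ ⊗ (J ⊗ J) ≡ ⟦ 4 ⟧) where

      special⇒C≡0 : C ≡ ⟦ 0 ⟧
      special⇒C≡0 = linear-combination (J ∷ []) (λ J → # 1 , # 3 :* (J :* J) := # 4 , Cᴾ J := # 0) special

      special⇒J≢0 : J ≢ ⟦ 0 ⟧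
      special⇒J≢0 h = 4≢0 (trans (sym special)
          (trans (cong (λ J → ⟦ 3 ⟧ ⊗ (J ⊗ J)) h) (trans (cong (⟦ 3 ⟧ ⊗_) 0⊗0≡0) (𝔽.zeroʳ ⟦ 3 ⟧))))

      special⇒4+3J≢0 : ⟦ 4 ⟧ ⊕ ⟦ 3 ⟧ ⊗ J ≢ ⟦ 0 ⟧
      special⇒4+3J≢0 h = 4≢0 (linear-combination₂ (J ∷ [])
        (λ J → # 3 , # 3 :* (J :* J) := # 4 , # 4 :- # 3 :* J , # 4 :+ # 3 :* J := # 0 , # 4 := # 0) special h)

      special⇒2+3J≢0 : ⟦ 2 ⟧ ⊕ ⟦ 3 ⟧ ⊗ J ≢ ⟦ 0 ⟧
      special⇒2+3J≢0 h = ⊗≢0 pr 2≢0 (⊗≢0 pr 2≢0 2≢0) (linear-combination₂ (J ∷ [])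
        (λ J →
          :- # 3 ,
          # 3 :* (J :* J) := # 4 ,
          # 3 :* J :- # 2 ,
          # 2 :+ # 3 :* J := # 0 ,
          # 2 :* (# 2 :* # 2) := # 0) special h)

      -- If 3 J² = 4, then 4 D = -3 (J (4 + 3 J))².
      special⇒D-nonSquare : NonSquare D
      special⇒D-nonSquare x x²≡D = ⊗≢0 pr special⇒J≢0 special⇒4+3J≢0
        (a²+3b²≡0⇒b≡0 (⟦ 2 ⟧ ⊗ x) (J ⊗ (⟦ 4 ⟧ ⊕ ⟦ 3 ⟧ ⊗ J))
          (linear-combination₂ (x ∷ J ∷ [])
            (λ x J →
              # 4 ,
              x :* x := Dᴾ J ,
              # 12 :* J :+ (# 9 :* (J :* J) :+ # 24 :* J :+ # 28) ,
              # 3 :* (J :* J) := # 4 ,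
              # 2 :* x :* (# 2 :* x) :+ # 3 :* (J :* (# 4 :+ # 3 :* J) :* (J :* (# 4 :+ # 3 :* J))) :=
                # 0) x²≡D special))

      -- For C = 0 the cubic is (x - 2)(x² - D).
      special⇒Cubic≢0 : ∀ {x} → x ≢ ⟦ 2 ⟧ → Cubic x ≢ ⟦ 0 ⟧
      special⇒Cubic≢0 {x} x≢2 h = [ (λ h → x≢2 (⊖≡0⇒≡ h)) , (λ h → special⇒D-nonSquare x (⊖≡0⇒≡ h)) ]′
        (⊗≡0 pr (x ⊖ ⟦ 2 ⟧) (x ⊗ x ⊖ D) (linear-combination₂ (x ∷ J ∷ [])
          (λ x J →
            # 1 ,
            Cubicᴾ x J := # 0 ,
            :- ((x :- # 2) :* x :+ Cᴾ J) ,
            Cᴾ J := # 0 ,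
            (x :- # 2) :* (x :* x :- Dᴾ J) := # 0) h special⇒C≡0))

      -- Here 3 = (2 / J)² is a square and -3 is not.
      special⇒-1-nonSquare : NonSquare (⊝ ⟦ 1 ⟧)
      special⇒-1-nonSquare b b²≡-1 = special⇒J≢0 (a²+3b²≡0⇒b≡0 (⟦ 2 ⟧ ⊗ b) J
        (linear-combination₂ (b ∷ J ∷ [])
          (λ b J →
            # 4 ,
            b :* b := :- # 1 ,
            # 1 ,
            # 3 :* (J :* J) := # 4 ,
            # 2 :* b :* (# 2 :* b) :+ # 3 :* (J :* J) := # 0) b²≡-1 special))

      special⇒σ-2 : σ (⊝ ⟦ 2 ⟧) ≡ ℤ.- σ {p} ⟦ 2 ⟧
      special⇒σ-2 = trans (cong σ (lem ⟦ 2 ⟧)) (trans (σ-⊗ (⊝ ⟦ 1 ⟧) ⟦ 2 ⟧)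
        (trans (cong (λ s → s ℤ.* σ {p} ⟦ 2 ⟧) (σ-nonSquare special⇒-1-nonSquare)) (ℤ.-1*i≡-i (σ {p} ⟦ 2 ⟧))))
        where
        lem : ∀ t → ⊝ t ≡ ⊝ ⟦ 1 ⟧ ⊗ t
        lem t = identity (t ∷ []) (λ t → :- t := :- # 1 :* t)

      -- Replacing 4 by 3 J² turns J² - 4 into -2 J².
      special⇒σ-J²-4 : σ (⊝ ⟦ 2 ⟧) ≡ σ (J ⊗ J ⊖ ⟦ 4 ⟧)
      special⇒σ-J²-4 = sym (σ-square-⊗ {J} {⊝ ⟦ 2 ⟧} {J ⊗ J ⊖ ⟦ 4 ⟧} special⇒J≢0 (linear-combination (J ∷ [])
        (λ J → :- # 1 , # 3 :* (J :* J) := # 4 , J :* J :* :- # 2 := J :* J :- # 4) special))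

      -- For C = 0 the slope at x = 2 vanishes too, and the discriminant is the constant -2 (2 (2 +
      -- 3 J))²; thus x = 2 takes the place of the root of the cubic.
      sum-discriminants-special : ∀ {x} → x ≡ ⟦ 2 ⟧ → sum-discriminants x ≡ + p ℤ.* σ (⊝ ⟦_⟧ {p} 2)
      sum-discriminants-special {x} x≡2 = trans
        (sum-cong-≗ λ y → σ-square-⊗ (⊗≢0 pr 2≢0 special⇒2+3J≢0) (sym (const y)))
        (sum-const p (σ (⊝ ⟦ 2 ⟧)))
        where
        const : ∀ y → discriminant x y ≡ (⟦ 2 ⟧ ⊗ (⟦ 2 ⟧ ⊕ ⟦ 3 ⟧ ⊗ J)) ⊗ (⟦ 2 ⟧ ⊗ (⟦ 2 ⟧ ⊕ ⟦ 3 ⟧ ⊗ J)) ⊗ ⊝ ⟦ 2 ⟧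
        const y = linear-combination₂ (x ∷ y ∷ J ∷ [])
          (λ x y J →
            (x :+ # 2) :* (y :* y :- # 4) :- # 2 :* Cᴾ J :* y :- # 4 :* Cᴾ J ,
            x := # 2 ,
            Cᴾ J :- # 8 :- # 8 :* y :+ # 12 :* J :+ # 24 ,
            # 3 :* (J :* J) := # 4 ,
            discriminantᴾ x y J := # 2 :* (# 2 :+ # 3 :* J) :* (# 2 :* (# 2 :+ # 3 :* J)) :* :- # 2) x≡2 special

      #solutions-special :
        sum (λ x → sum (λ y → sum (λ z → ι (solution? C D (x , y , z)))))
          ≡ + (p ℕ.^ 2) ℤ.+ 1ℤ ℤ.- + 2 ℤ.* σ {p} ⟦ 2 ⟧ ℤ.* + p
      #solutions-special = trans
        (#solutions A ⟦ 2 ⟧ λ x → case x ≟ ⊝ ⟦ 2 ⟧ of λ where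
          (yes x≡-2) → at--2 A ⟦ 2 ⟧ 2≢-2 special⇒σ-J²-4 x≡-2
          (no x≢-2) → case x ≟ ⟦ 2 ⟧ of λ where
            (yes x≡2) → at-w A ⟦ 2 ⟧ 2≢-2 x≡2 (trans (sum-discriminants-special x≡2)
              (trans (sym (ℤ.+-identityˡ (+ p ℤ.* A))) (cong (λ s → ℤ.- s ℤ.+ + p ℤ.* A) (sym (σ-zero (leading-2 x≡2))))))
            (no x≢2) → elsewhere A ⟦ 2 ⟧ x≢-2 x≢2 (sum-discriminants-generic x≢2 x≢-2 (special⇒Cubic≢0 x≢2)))
        (trans (cong (λ A → + (p ℕ.^ 2) ℤ.+ 1ℤ ℤ.+ + 2 ℤ.* A ℤ.* + p) special⇒σ-2) (arith (+ (p ℕ.^ 2)) (+ p) (σ {p} ⟦ 2 ⟧)))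
        where
        A = σ (⊝ ⟦_⟧ {p} 2)
        arith : ∀ q r s → q ℤ.+ 1ℤ ℤ.+ + 2 ℤ.* (ℤ.- s) ℤ.* r ≡ q ℤ.+ 1ℤ ℤ.- + 2 ℤ.* s ℤ.* r
        arith = ℤ-Solver.solve-∀

    -- Vertices fixed by one flip

    FlipFixed : F → F → F → Set
    FlipFixed x y z = ⟦ 2 ⟧ ⊗ x ≡ y ⊗ z ⊖ C

    private
      square-difference : ∀ {l r v w c : F} → ⟦ 4 ⟧ ⊗ (l ⊖ r) ≡ (v ⊖ w) ⊗ (v ⊖ w) ⊖ c → v ≡ w →
        (l ≡ r → c ≡ ⟦ 0 ⟧) × (c ≡ ⟦ 0 ⟧ → l ≡ r)
      square-difference {l} {r} {v} {w} {c} h refl =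
        (λ l≡r → linear-combination₂ (c ∷ l ∷ r ∷ v ∷ [])
          (λ c l r v → # 1 , # 4 :* (l :- r) := (v :- v) :* (v :- v) :- c , :- # 4 , l := r , c := # 0) h l≡r) ,
        (λ c≡0 → [ (λ h → contradiction h 4≢0) , (λ h → ⊖≡0⇒≡ h) ]′
          (⊗≡0 pr ⟦ 4 ⟧ (l ⊖ r) (linear-combination₂ (l ∷ r ∷ v ∷ c ∷ [])
            (λ l r v c →
              # 1 ,
              # 4 :* (l :- r) := (v :- v) :* (v :- v) :- c ,
              :- # 1 ,
              c := # 0 ,
              # 4 :* (l :- r) := # 0) h c≡0)))

    flipFixed⇒curve : ∀ {x y z} → FlipFixed x y z → Solution C D (x , y , z) → Curve y z ≡ ⟦ 0 ⟧
    flipFixed⇒curve {x} {y} {z} fix sol = proj₁ (square-difference (surface-completed-square x y z) fix) sol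

    curve⇒solution : ∀ {x y z} → FlipFixed x y z → Curve y z ≡ ⟦ 0 ⟧ → Solution C D (x , y , z)
    curve⇒solution {x} {y} {z} fix = proj₂ (square-difference (surface-completed-square x y z) fix)

    -- On z = -2 the curve polynomial is the nonzero constant - K.
    curve⇒z+2≢0 : ∀ {y z} → Curve y z ≡ ⟦ 0 ⟧ → z ⊕ ⟦ 2 ⟧ ≢ ⟦ 0 ⟧
    curve⇒z+2≢0 {y} {z} h z+2≡0 = K≢0 (lem K h)
      where
      lem : ∀ K → (y ⊕ ⟦ 2 ⟧) ⊗ (z ⊕ ⟦ 2 ⟧) ⊗
          ((y ⊕ ⟦ 2 ⟧) ⊗ (z ⊕ ⟦ 2 ⟧) ⊖ ⟦ 4 ⟧ ⊗ ((y ⊕ ⟦ 2 ⟧) ⊕ (z ⊕ ⟦ 2 ⟧)) ⊕ ⟦ 6 ⟧ ⊗ j ⊗ m) ⊖ K ≡ ⟦ 0 ⟧ → K ≡ ⟦ 0 ⟧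
      lem K h = linear-combination₂ (K ∷ y ∷ z ∷ J ∷ [])
        (λ K y z J →
          :- # 1 ,
          (y :+ # 2) :* (z :+ # 2) :* ((y :+ # 2) :* (z :+ # 2) :- # 4 :* (y :+ # 2 :+ (z :+ # 2))
            :+ # 6 :* jᴾ J :* mᴾ J) :- K := # 0 ,
          (y :+ # 2) :* ((y :+ # 2) :* (z :+ # 2) :- # 4 :* (y :+ # 2 :+ (z :+ # 2))
            :+ # 6 :* jᴾ J :* mᴾ J) ,
          z :+ # 2 := # 0 ,
          K := # 0) h z+2≡0

    denominator : F → F → F
    denominator s t = ⟦ 2 ⟧ ⊗ s ⊖ ⟦ 2 ⟧ ⊕ j ⊗ t

    -- In t = 3 (J + 2) / (z + 2) and y the curve is a double cover of the t-line, and s is, up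
    -- to a scalar, the square root of its discriminant; s determines t - 1 through its cube.
    IsT : F → F → Set
    IsT s t = ⟦ 3 ⟧ ⊗ (s ⊗ s) ≡ n ⊖ j ⊗ ((t ⊖ ⟦ 1 ⟧) ⊗ (t ⊖ ⟦ 1 ⟧) ⊗ (t ⊖ ⟦ 1 ⟧))

    IsZ : F → F → Set
    IsZ t z = (z ⊕ ⟦ 2 ⟧) ⊗ t ≡ ⟦ 3 ⟧ ⊗ m

    -- Put Y = y + 2, a = 3 m - 4 t and b = 3 m (j t - 2). The curve reads Y (a Y + 2 b) = 3 j m²
    -- t², and 6 m s = a Y + b turns a Y + 2 b into 3 m times `denominator s t`. Dividing by a Y + 2
    -- b rather than by a keeps the formula valid at z = 2, where a = 0.
    IsY : F → F → F → Set
    IsY s t y = (y ⊕ ⟦ 2 ⟧) ⊗ denominator s t ≡ j ⊗ m ⊗ (t ⊗ t)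

    private
      InT : F → F → Set
      InT t y = (y ⊕ ⟦ 2 ⟧) ⊗ ((⟦ 3 ⟧ ⊗ m ⊖ ⟦ 4 ⟧ ⊗ t) ⊗ (y ⊕ ⟦ 2 ⟧) ⊕ ⟦ 6 ⟧ ⊗ m ⊗
          (j ⊗ t ⊖ ⟦ 2 ⟧)) ≡ ⟦ 3 ⟧ ⊗ j ⊗ (m ⊗ m) ⊗ (t ⊗ t)

      IsS : F → F → F → Set
      IsS s t y = ⟦ 6 ⟧ ⊗ m ⊗ s ≡ (⟦ 3 ⟧ ⊗ m ⊖ ⟦ 4 ⟧ ⊗ t) ⊗ (y ⊕ ⟦ 2 ⟧) ⊕ ⟦ 3 ⟧ ⊗ m ⊗ (j ⊗ t ⊖ ⟦ 2 ⟧)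

      cancel : ∀ {a b c} → a ≢ ⟦ 0 ⟧ → a ⊗ (b ⊖ c) ≡ ⟦ 0 ⟧ → b ≡ c
      cancel {a} {b} {c} a≢0 h = [ (λ a≡0 → contradiction a≡0 a≢0) , (λ h → ⊖≡0⇒≡ h) ]′ (⊗≡0 pr a (b ⊖ c) h)

      -- After multiplication by the squared denominator, y + 2 can be eliminated by `IsY`, and what
      -- remains is a multiple of `IsT`.
      inT : ∀ {s t y} → denominator s t ≢ ⟦ 0 ⟧ → IsT s t → IsY s t y → InT t y
      inT {s} {t} {y} B≢0 isT isY = cancel (⊗≢0 pr B≢0 B≢0) (linear-combination₂ (s ∷ t ∷ y ∷ J ∷ [])
        (λ s t y J →
          ((y :+ # 2) :* denominatorᴾ s t J :+ jᴾ J :* mᴾ J :* (t :* t)) :* (# 3 :* mᴾ J :- # 4 :* t)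
            :+ # 6 :* mᴾ J :* (jᴾ J :* t :- # 2) :* denominatorᴾ s t J ,
          (y :+ # 2) :* denominatorᴾ s t J := jᴾ J :* mᴾ J :* (t :* t) ,
          :- (# 4 :* jᴾ J :* (mᴾ J :* mᴾ J) :* (t :* t)) ,
          # 3 :* (s :* s) := nᴾ J :- jᴾ J :* ((t :- # 1) :* (t :- # 1) :* (t :- # 1)) ,
          denominatorᴾ s t J :* denominatorᴾ s t J
            :* ((y :+ # 2) :* ((# 3 :* mᴾ J :- # 4 :* t) :* (y :+ # 2)
            :+ # 6 :* mᴾ J :* (jᴾ J :* t :- # 2)) :- # 3 :* jᴾ J :* (mᴾ J :* mᴾ J) :* (t :* t)) := # 0) isY isT)

      curve-inT : ∀ {t y z} → IsZ t z → (t ⊗ t) ⊗ Curve y z ≡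
        ⟦ 3 ⟧ ⊗ m ⊗ ((y ⊕ ⟦ 2 ⟧) ⊗ ((⟦ 3 ⟧ ⊗ m ⊖ ⟦ 4 ⟧ ⊗ t) ⊗ (y ⊕ ⟦ 2 ⟧) ⊕ ⟦ 6 ⟧ ⊗ m ⊗
            (j ⊗ t ⊖ ⟦ 2 ⟧)) ⊖ ⟦ 3 ⟧ ⊗ j ⊗ (m ⊗ m) ⊗ (t ⊗ t))
      curve-inT {t} {y} {z} isZ = linear-combination (t ∷ y ∷ z ∷ J ∷ [])
        (λ t y z J →
          ((y :+ # 2) :* (y :+ # 2) :- # 4 :* (y :+ # 2)) :* ((z :+ # 2) :* t :+ # 3 :* mᴾ J)
            :+ (# 6 :* jᴾ J :* mᴾ J :* (y :+ # 2) :- # 4 :* ((y :+ # 2) :* (y :+ # 2))) :* t ,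
          (z :+ # 2) :* t := # 3 :* mᴾ J ,
          t :* t :* Curveᴾ y z J := # 3 :* mᴾ J
            :* ((y :+ # 2) :* ((# 3 :* mᴾ J :- # 4 :* t) :* (y :+ # 2)
            :+ # 6 :* mᴾ J :* (jᴾ J :* t :- # 2)) :- # 3 :* jᴾ J :* (mᴾ J :* mᴾ J) :* (t :* t))) isZ

      3m≢0 : ⟦ 3 ⟧ ⊗ m ≢ ⟦ 0 ⟧
      3m≢0 = ⊗≢0 pr 3≢0 m≢0

    IsT⇒curve : ∀ {s t y z} → t ≢ ⟦ 0 ⟧ → denominator s t ≢ ⟦ 0 ⟧ → IsT s t → IsZ t z → IsY s t y → Curve y z ≡ ⟦ 0 ⟧
    IsT⇒curve {s} {t} {y} {z} t≢0 B≢0 isT isZ isY = lem {⟦ 3 ⟧ ⊗ m} (Curve y z) (curve-inT isZ) (inT B≢0 isT isY)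
      where
      lem : ∀ {a b c} G → (t ⊗ t) ⊗ G ≡ a ⊗ (b ⊖ c) → b ≡ c → G ≡ ⟦ 0 ⟧
      lem {a} {b} {c} G h b≡c = [ (λ h → contradiction h (⊗≢0 pr t≢0 t≢0)) , (λ h → h) ]′
        (⊗≡0 pr (t ⊗ t) G (linear-combination₂ (t ∷ G ∷ a ∷ b ∷ c ∷ [])
          (λ t G a b c → # 1 , t :* t :* G := a :* (b :- c) , a , b := c , t :* t :* G := # 0) h b≡c))

    curve⇒inT : ∀ {t y z} → IsZ t z → Curve y z ≡ ⟦ 0 ⟧ → InT t y
    curve⇒inT {t} {y} {z} isZ h = lem (curve-inT isZ) h
      where
      lem : ∀ {b c G} → (t ⊗ t) ⊗ G ≡ ⟦ 3 ⟧ ⊗ m ⊗ (b ⊖ c) → G ≡ ⟦ 0 ⟧ → b ≡ c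
      lem {b} {c} {G} h G≡0 = cancel 3m≢0 (linear-combination₂ (b ∷ c ∷ t ∷ G ∷ J ∷ [])
        (λ b c t G J →
          :- # 1 ,
          t :* t :* G := # 3 :* mᴾ J :* (b :- c) ,
          t :* t ,
          G := # 0 ,
          # 3 :* mᴾ J :* (b :- c) := # 0) h G≡0)

    -- The square of 6 m s is a quarter of the discriminant of `InT` as a quadratic in y + 2.
    -- Because j + m = 4, its terms in t complete to the cube of t - 1.
    IsS⇒IsT : ∀ {s t y} → InT t y → IsS s t y → IsT s t
    IsS⇒IsT {s} {t} {y} h isS = cancel (⊗≢0 pr 3m≢0 (⊗≢0 pr 2≢0 (⊗≢0 pr 2≢0 m≢0))) (linear-combination₂ (s ∷ t ∷ y ∷ J ∷ [])
      (λ s t y J →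
        # 6 :* mᴾ J :* s :+ ((# 3 :* mᴾ J :- # 4 :* t) :* (y :+ # 2)
          :+ # 3 :* mᴾ J :* (jᴾ J :* t :- # 2)) ,
        # 6 :* mᴾ J :* s := (# 3 :* mᴾ J :- # 4 :* t) :* (y :+ # 2) :+ # 3 :* mᴾ J :* (jᴾ J :* t :- # 2) ,
        # 3 :* mᴾ J :- # 4 :* t ,
        (y :+ # 2) :* ((# 3 :* mᴾ J :- # 4 :* t) :* (y :+ # 2) :+ # 6 :* mᴾ J :* (jᴾ J :* t :- # 2)) :=
          # 3 :* jᴾ J :* (mᴾ J :* mᴾ J) :* (t :* t) ,
        # 3 :* mᴾ J :* (# 2 :* (# 2 :* mᴾ J))
          :* (# 3 :* (s :* s) :- (nᴾ J :- jᴾ J :* ((t :- # 1) :* (t :- # 1) :* (t :- # 1)))) := # 0) isS h)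

    IsS⇒IsY : ∀ {s t y} → InT t y → IsS s t y → IsY s t y
    IsS⇒IsY {s} {t} {y} h isS = cancel 3m≢0 (linear-combination₂ (y ∷ s ∷ t ∷ J ∷ [])
      (λ y s t J →
        y :+ # 2 ,
        # 6 :* mᴾ J :* s := (# 3 :* mᴾ J :- # 4 :* t) :* (y :+ # 2) :+ # 3 :* mᴾ J :* (jᴾ J :* t :- # 2) ,
        # 1 ,
        (y :+ # 2) :* ((# 3 :* mᴾ J :- # 4 :* t) :* (y :+ # 2) :+ # 6 :* mᴾ J :* (jᴾ J :* t :- # 2)) :=
          # 3 :* jᴾ J :* (mᴾ J :* mᴾ J) :* (t :* t) ,
        # 3 :* mᴾ J :* ((y :+ # 2) :* denominatorᴾ s t J :- jᴾ J :* mᴾ J :* (t :* t)) := # 0) isS h)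

    -- `IsY` and `InT` combine to the claim times y + 2, which is nonzero since its product with the
    -- denominator is j m t². This recovers s from t and y.
    IsY⇒IsS : ∀ {s t y} → t ≢ ⟦ 0 ⟧ → denominator s t ≢ ⟦ 0 ⟧ → IsT s t → IsY s t y → IsS s t y
    IsY⇒IsS {s} {t} {y} t≢0 B≢0 isT isY = cancel y+2≢0 (linear-combination₂ (y ∷ s ∷ t ∷ J ∷ [])
      (λ y s t J →
        # 3 :* mᴾ J ,
        (y :+ # 2) :* denominatorᴾ s t J := jᴾ J :* mᴾ J :* (t :* t) ,
        :- # 1 ,
        (y :+ # 2) :* ((# 3 :* mᴾ J :- # 4 :* t) :* (y :+ # 2) :+ # 6 :* mᴾ J :* (jᴾ J :* t :- # 2)) :=
          # 3 :* jᴾ J :* (mᴾ J :* mᴾ J) :* (t :* t) ,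
        (y :+ # 2) :* (# 6 :* mᴾ J :* s
          :- ((# 3 :* mᴾ J :- # 4 :* t) :* (y :+ # 2) :+ # 3 :* mᴾ J :* (jᴾ J :* t :- # 2))) := # 0) isY
              (inT {s} B≢0 isT isY))
      where
      y+2≢0 : y ⊕ ⟦ 2 ⟧ ≢ ⟦ 0 ⟧
      y+2≢0 h = ⊗≢0 pr (⊗≢0 pr j≢0 m≢0) (⊗≢0 pr t≢0 t≢0)
          (trans (sym isY) (trans (cong (_⊗ denominator s t) h) (𝔽.zeroˡ (denominator s t))))

    IsZ⇒t≢0 : ∀ {t z} → IsZ t z → t ≢ ⟦ 0 ⟧
    IsZ⇒t≢0 {t} {z} isZ h = 3m≢0 (trans (sym isZ) (trans (cong ((z ⊕ ⟦ 2 ⟧) ⊗_) h) (𝔽.zeroʳ (z ⊕ ⟦ 2 ⟧))))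

    IsY⇒denominator≢0 : ∀ {s t y} → t ≢ ⟦ 0 ⟧ → IsY s t y → denominator s t ≢ ⟦ 0 ⟧
    IsY⇒denominator≢0 {s} {t} {y} t≢0 isY h = ⊗≢0 pr (⊗≢0 pr j≢0 m≢0) (⊗≢0 pr t≢0 t≢0)
      (trans (sym isY) (trans (cong ((y ⊕ ⟦ 2 ⟧) ⊗_) h) (𝔽.zeroʳ (y ⊕ ⟦ 2 ⟧))))

    tOf : F → F
    tOf s = ⟦ 1 ⟧ ⊕ cbrt pr p%3≡2 ((n ⊖ ⟦ 3 ⟧ ⊗ (s ⊗ s)) ⊗ inv pr j)

    IsT-tOf : ∀ s → IsT s (tOf s)
    IsT-tOf s = lem _ (inv pr j) (cbrt-cubed pr p%3≡2 ((n ⊖ ⟦ 3 ⟧ ⊗ (s ⊗ s)) ⊗ inv pr j)) (inv-inverse pr j≢0)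
      where
      lem : ∀ c j⁻¹ → c ⊗ c ⊗ c ≡ (n ⊖ ⟦ 3 ⟧ ⊗ (s ⊗ s)) ⊗ j⁻¹ → j ⊗ j⁻¹ ≡ ⟦ 1 ⟧ → IsT s (⟦ 1 ⟧ ⊕ c)
      lem c j⁻¹ h₁ h₂ = linear-combination₂ (s ∷ c ∷ j⁻¹ ∷ J ∷ [])
        (λ s c j⁻¹ J →
          jᴾ J ,
          c :* c :* c := (nᴾ J :- # 3 :* (s :* s)) :* j⁻¹ ,
          nᴾ J :- # 3 :* (s :* s) ,
          jᴾ J :* j⁻¹ := # 1 ,
          # 3 :* (s :* s) := nᴾ J :- jᴾ J
            :* ((# 1 :+ c :- # 1) :* (# 1 :+ c :- # 1) :* (# 1 :+ c :- # 1))) h₁ h₂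

    IsT-unique : ∀ {s t t′} → IsT s t → IsT s t′ → t ≡ t′
    IsT-unique {s} {t} {t′} h h′ = linear-combination (t ∷ t′ ∷ [])
      (λ t t′ →
        # 1 ,
        t :- # 1 := t′ :- # 1 ,
        t := t′) (cube-injective pr p%3≡2 {t ⊖ ⟦ 1 ⟧} {t′ ⊖ ⟦ 1 ⟧} (cancel j≢0 (linear-combination₂ (t ∷ t′ ∷ s ∷ J ∷ [])
        (λ t t′ s J →
          :- # 1 ,
          # 3 :* (s :* s) := nᴾ J :- jᴾ J :* ((t′ :- # 1) :* (t′ :- # 1) :* (t′ :- # 1)) ,
          # 1 ,
          # 3 :* (s :* s) := nᴾ J :- jᴾ J :* ((t :- # 1) :* (t :- # 1) :* (t :- # 1)) ,
          jᴾ J :* ((t :- # 1) :* (t :- # 1) :* (t :- # 1) :- (t′ :- # 1) :* (t′ :- # 1) :* (t′ :- # 1)) :=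
            # 0) h′ h)))

    half : F
    half = inv pr ⟦ 2 ⟧

    2⊗half : ⟦ 2 ⟧ ⊗ half ≡ ⟦ 1 ⟧
    2⊗half = inv-inverse pr 2≢0

    -- For z = 2 the equation for y is linear; s₀ belongs to the root that has become infinite.
    s₀ : F
    s₀ = ⟦ 1 ⟧ ⊖ ⟦ 3 ⟧ ⊗ j ⊗ m ⊗ (half ⊗ half ⊗ half)

    8⊗s₀ : ⟦ 8 ⟧ ⊗ s₀ ≡ ⟦ 8 ⟧ ⊖ ⟦ 3 ⟧ ⊗ j ⊗ m
    8⊗s₀ = lem half 2⊗half
      where
      lem : ∀ h → ⟦ 2 ⟧ ⊗ h ≡ ⟦ 1 ⟧ → ⟦ 8 ⟧ ⊗ (⟦ 1 ⟧ ⊖ ⟦ 3 ⟧ ⊗ j ⊗ m ⊗ (h ⊗ h ⊗ h)) ≡ ⟦ 8 ⟧ ⊖ ⟦ 3 ⟧ ⊗ j ⊗ m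
      lem h eq = linear-combination (h ∷ J ∷ [])
        (λ h J →
          :- (# 3 :* jᴾ J :* mᴾ J :* (# 4 :* (h :* h) :+ # 2 :* h :+ # 1)) ,
          # 2 :* h := # 1 ,
          # 8 :* (# 1 :- # 3 :* jᴾ J :* mᴾ J :* (h :* h :* h)) := # 8 :- # 3 :* jᴾ J :* mᴾ J) eq

    8≢0 : ⟦ 8 ⟧ ≢ ⟦_⟧ {p} 0
    8≢0 h = ⊗≢0 pr 2≢0 4≢0 (trans (⟦*⟧ 2 4) h)

    -- At t = 0, which corresponds to infinite z, the right side of `IsT` is n + j = 3.
    t≡0⇒s≡±1 : ∀ {s t} → IsT s t → t ≡ ⟦ 0 ⟧ → s ≡ ⟦ 1 ⟧ ⊎ s ≡ ⊝ ⟦ 1 ⟧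
    t≡0⇒s≡±1 {s} {t} isT t≡0 = [ (λ h → contradiction h 3≢0) , (λ h → Sum.map
        (λ h → ⊖≡0⇒≡ h) (λ h → linear-combination (s ∷ []) (λ s → # 1 , s :+ # 1 := # 0 , s := :- # 1) h)
        (⊗≡0 pr (s ⊖ ⟦ 1 ⟧) (s ⊕ ⟦ 1 ⟧) h)) ]′
      (⊗≡0 pr ⟦ 3 ⟧ ((s ⊖ ⟦ 1 ⟧) ⊗ (s ⊕ ⟦ 1 ⟧)) (linear-combination₂ (s ∷ t ∷ J ∷ [])
        (λ s t J →
          # 1 ,
          # 3 :* (s :* s) := nᴾ J :- jᴾ J :* ((t :- # 1) :* (t :- # 1) :* (t :- # 1)) ,
          :- (jᴾ J :* (t :* t :- # 3 :* t :+ # 3)) ,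
          t := # 0 ,
          # 3 :* ((s :- # 1) :* (s :+ # 1)) := # 0) isT t≡0))

    s²≡1⇒t≡0 : ∀ {s t} → IsT s t → s ⊗ s ≡ ⟦ 1 ⟧ → t ≡ ⟦ 0 ⟧
    s²≡1⇒t≡0 {s} {t} isT s²≡1 = linear-combination (t ∷ [])
      (λ t →
        # 1 ,
        t :- # 1 := :- # 1 ,
        t := # 0) (cube-injective pr p%3≡2 {t ⊖ ⟦ 1 ⟧} {⊝ ⟦ 1 ⟧} (cancel j≢0 (linear-combination₂ (t ∷ s ∷ J ∷ [])
        (λ t s J →
          # 1 ,
          # 3 :* (s :* s) := nᴾ J :- jᴾ J :* ((t :- # 1) :* (t :- # 1) :* (t :- # 1)) ,
          :- # 3 ,
          s :* s := # 1 ,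
          jᴾ J :* ((t :- # 1) :* (t :- # 1) :* (t :- # 1) :- :- # 1 :* :- # 1 :* :- # 1) := # 0) isT s²≡1)))

    -- Substituting 2 s = 2 - j t into `IsT` leaves j t² (4 t - 3 m) = 0, so 4 t = 3 m, the value of
    -- t at z = 2.
    denominator≡0⇒s≡s₀ : ∀ {s t} → IsT s t → t ≢ ⟦ 0 ⟧ → denominator s t ≡ ⟦ 0 ⟧ → s ≡ s₀
    denominator≡0⇒s≡s₀ {s} {t} isT t≢0 B≡0 = ⊗-cancelˡ pr 8≢0 (trans (linear-combination₂ (s ∷ t ∷ J ∷ [])
      (λ s t J →
        # 4 ,
        denominatorᴾ s t J := # 0 ,
        :- jᴾ J ,
        # 4 :* t := # 3 :* mᴾ J ,
        # 8 :* s := # 8 :- # 3 :* jᴾ J :* mᴾ J) B≡0 4t≡3m) (sym 8⊗s₀))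
      where
      4t≡3m : ⟦ 4 ⟧ ⊗ t ≡ ⟦ 3 ⟧ ⊗ m
      4t≡3m = cancel (⊗≢0 pr j≢0 (⊗≢0 pr t≢0 t≢0)) (linear-combination₂ (t ∷ s ∷ J ∷ [])
        (λ t s J →
          # 4 ,
          # 3 :* (s :* s) := nᴾ J :- jᴾ J :* ((t :- # 1) :* (t :- # 1) :* (t :- # 1)) ,
          :- (# 3 :* (# 2 :* s :+ # 2 :- jᴾ J :* t)) ,
          denominatorᴾ s t J := # 0 ,
          jᴾ J :* (t :* t) :* (# 4 :* t :- # 3 :* mᴾ J) := # 0) isT B≡0)

    -- At s₀ the cubes of 4 (t - 1) and of 3 m - 4 agree, so injectivity of cubing gives 4 t = 3 m,
    -- where the denominator vanishes.
    s≡s₀⇒denominator≡0 : ∀ {s t} → IsT s t → s ≡ s₀ → denominator s t ≡ ⟦ 0 ⟧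
    s≡s₀⇒denominator≡0 {s} {t} isT s≡s₀ = [ (λ h → contradiction h 4≢0) , (λ h → h) ]′
        (⊗≡0 pr ⟦ 4 ⟧ (denominator s t) (linear-combination₂ (s ∷ t ∷ J ∷ [])
          (λ s t J →
            # 1 ,
            # 8 :* s := # 8 :- # 3 :* jᴾ J :* mᴾ J ,
            jᴾ J ,
            # 4 :* t := # 3 :* mᴾ J ,
            # 4 :* denominatorᴾ s t J := # 0) 8s 4t≡3m))
      where
      8s : ⟦ 8 ⟧ ⊗ s ≡ ⟦ 8 ⟧ ⊖ ⟦ 3 ⟧ ⊗ j ⊗ m
      8s = trans (cong (⟦ 8 ⟧ ⊗_) s≡s₀) 8⊗s₀
      4t≡3m : ⟦ 4 ⟧ ⊗ t ≡ ⟦ 3 ⟧ ⊗ m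
      4t≡3m = linear-combination (t ∷ J ∷ [])
        (λ t J →
          # 1 ,
          # 4 :* t :- # 4 := # 3 :* mᴾ J :- # 4 ,
          # 4 :* t := # 3 :* mᴾ J) (cube-injective pr p%3≡2 {⟦ 4 ⟧ ⊗ t ⊖ ⟦ 4 ⟧} {⟦ 3 ⟧ ⊗ m ⊖ ⟦ 4 ⟧}
        (cancel j≢0 (linear-combination₂ (t ∷ s ∷ J ∷ [])
          (λ t s J →
            # 64 ,
            # 3 :* (s :* s) := nᴾ J :- jᴾ J :* ((t :- # 1) :* (t :- # 1) :* (t :- # 1)) ,
            :- (# 3 :* (# 8 :* s :+ # 8 :- # 3 :* jᴾ J :* mᴾ J)) ,
            # 8 :* s := # 8 :- # 3 :* jᴾ J :* mᴾ J ,
            jᴾ J :* ((# 4 :* t :- # 4) :* (# 4 :* t :- # 4) :* (# 4 :* t :- # 4)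
              :- (# 3 :* mᴾ J :- # 4) :* (# 3 :* mᴾ J :- # 4) :* (# 3 :* mᴾ J :- # 4)) := # 0) isT 8s)))

    1≢-1 : ⟦ 1 ⟧ ≢ ⊝ ⟦_⟧ {p} 1
    1≢-1 h = 2≢0 (trans (sym (⟦+⟧ 1 1)) (trans (cong (⟦ 1 ⟧ ⊕_) h) (⊕-inverseʳ ⟦ 1 ⟧)))

    s₀≢1 : s₀ ≢ ⟦ 1 ⟧
    s₀≢1 h = ⊗≢0 pr 3m≢0 j≢0 (lem s₀ h 8⊗s₀)
      where
      lem : ∀ s → s ≡ ⟦ 1 ⟧ → ⟦ 8 ⟧ ⊗ s ≡ ⟦ 8 ⟧ ⊖ ⟦ 3 ⟧ ⊗ j ⊗ m → ⟦ 3 ⟧ ⊗ m ⊗ j ≡ ⟦ 0 ⟧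
      lem s s≡1 h = linear-combination₂ (s ∷ J ∷ [])
        (λ s J →
          # 1 ,
          # 8 :* s := # 8 :- # 3 :* jᴾ J :* mᴾ J ,
          :- # 8 ,
          s := # 1 ,
          # 3 :* mᴾ J :* jᴾ J := # 0) h s≡1

    -- Equality would mean 3 j m = 16, hence 3 J² = -4 and (3 J)² + 3 · 2² = 0.
    s₀≢-1 : s₀ ≢ ⊝ ⟦ 1 ⟧
    s₀≢-1 h = 2≢0 (a²+3b²≡0⇒b≡0 (⟦ 3 ⟧ ⊗ J) ⟦ 2 ⟧ (lem s₀ h 8⊗s₀))
      where
      lem : ∀ s → s ≡ ⊝ ⟦ 1 ⟧ → ⟦ 8 ⟧ ⊗ s ≡ ⟦ 8 ⟧ ⊖ ⟦ 3 ⟧ ⊗ j ⊗ m → (⟦ 3 ⟧ ⊗ J) ⊗ (⟦ 3 ⟧ ⊗ J) ⊕ ⟦ 3 ⟧ ⊗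
          (⟦ 2 ⟧ ⊗ ⟦ 2 ⟧) ≡ ⟦ 0 ⟧
      lem s s≡-1 h = linear-combination₂ (s ∷ J ∷ [])
        (λ s J →
          :- # 3 ,
          # 8 :* s := # 8 :- # 3 :* jᴾ J :* mᴾ J ,
          # 24 ,
          s := :- # 1 ,
          # 3 :* J :* (# 3 :* J) :+ # 3 :* (# 2 :* # 2) := # 0) h s≡-1

    -- The values 1 and -1 would make z infinite, and s₀ would make y infinite.
    Regular : F → Set
    Regular s = s ≢ ⟦ 1 ⟧ × s ≢ ⊝ ⟦ 1 ⟧ × s ≢ s₀

    regular⇒t≢0 : ∀ {s t} → IsT s t → Regular s → t ≢ ⟦ 0 ⟧
    regular⇒t≢0 isT (s≢1 , s≢-1 , _) t≡0 = [ s≢1 , s≢-1 ]′ (t≡0⇒s≡±1 isT t≡0)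

    regular⇒denominator≢0 : ∀ {s t} → IsT s t → Regular s → denominator s t ≢ ⟦ 0 ⟧
    regular⇒denominator≢0 isT r@(_ , _ , s≢s₀) B≡0 = s≢s₀ (denominator≡0⇒s≡s₀ isT (regular⇒t≢0 isT r) B≡0)

    nonzero⇒regular : ∀ {s t} → IsT s t → t ≢ ⟦ 0 ⟧ → denominator s t ≢ ⟦ 0 ⟧ → Regular s
    nonzero⇒regular {s} isT t≢0 B≢0 =
      (λ s≡1 → t≢0 (s²≡1⇒t≡0 {s} isT (lem s s≡1))) ,
      (λ s≡-1 → t≢0 (s²≡1⇒t≡0 {s} isT (lem′ s s≡-1))) ,
      (λ s≡s₀ → B≢0 (s≡s₀⇒denominator≡0 isT s≡s₀))
      where
      lem : ∀ s → s ≡ ⟦ 1 ⟧ → s ⊗ s ≡ ⟦ 1 ⟧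
      lem s h = linear-combination (s ∷ []) (λ s → s :+ # 1 , s := # 1 , s :* s := # 1) h
      lem′ : ∀ s → s ≡ ⊝ ⟦ 1 ⟧ → s ⊗ s ≡ ⟦ 1 ⟧
      lem′ s h = linear-combination (s ∷ []) (λ s → s :- # 1 , s := :- # 1 , s :* s := # 1) h

    fixedPoint : F → Triple
    fixedPoint s = (y ⊗ z ⊖ C) ⊗ half , y , z
      where
      t = tOf s
      y = j ⊗ m ⊗ (t ⊗ t) ⊗ inv pr (denominator s t) ⊖ ⟦ 2 ⟧
      z = ⟦ 3 ⟧ ⊗ m ⊗ inv pr t ⊖ ⟦ 2 ⟧

    private
      quotient : ∀ {a b} c → a ⊗ b ≡ ⟦ 1 ⟧ → (c ⊗ b ⊖ ⟦ 2 ⟧ ⊕ ⟦ 2 ⟧) ⊗ a ≡ c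
      quotient {a} {b} c h = linear-combination (c ∷ b ∷ a ∷ [])
        (λ c b a → c , a :* b := # 1 , (c :* b :- # 2 :+ # 2) :* a := c) h

      IsY-fixedPoint : ∀ {s} → Regular s → IsY s (tOf s) (proj₁ (proj₂ (fixedPoint s)))
      IsY-fixedPoint {s} r = quotient (j ⊗ m ⊗ (tOf s ⊗ tOf s)) (inv-inverse pr (regular⇒denominator≢0 (IsT-tOf s) r))

      IsZ-fixedPoint : ∀ {s} → Regular s → IsZ (tOf s) (proj₂ (proj₂ (fixedPoint s)))
      IsZ-fixedPoint {s} r = quotient (⟦ 3 ⟧ ⊗ m) (inv-inverse pr (regular⇒t≢0 (IsT-tOf s) r))

      half⇒double : ∀ {x w} h → ⟦ 2 ⟧ ⊗ h ≡ ⟦ 1 ⟧ → x ≡ w ⊗ h → ⟦ 2 ⟧ ⊗ x ≡ w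
      half⇒double {x} {w} h 2h≡1 x≡wh = linear-combination₂ (x ∷ w ∷ h ∷ [])
        (λ x w h → # 2 , x := w :* h , w , # 2 :* h := # 1 , # 2 :* x := w) x≡wh 2h≡1

      double⇒half : ∀ {x w} h → ⟦ 2 ⟧ ⊗ h ≡ ⟦ 1 ⟧ → ⟦ 2 ⟧ ⊗ x ≡ w → x ≡ w ⊗ h
      double⇒half {x} {w} h 2h≡1 2x≡w = linear-combination₂ (x ∷ w ∷ h ∷ [])
        (λ x w h → h , # 2 :* x := w , :- x , # 2 :* h := # 1 , x := w :* h) 2x≡w 2h≡1

    Fixed : Triple → Set
    Fixed (x , y , z) = FlipFixed x y z × Solution C D (x , y , z)

    fixedPoint-fixed : ∀ {s} → Regular s → Fixed (fixedPoint s)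
    fixedPoint-fixed {s} r = fix , curve⇒solution fix
      (IsT⇒curve (regular⇒t≢0 (IsT-tOf s) r) (regular⇒denominator≢0 (IsT-tOf s) r) (IsT-tOf s)
          (IsZ-fixedPoint r) (IsY-fixedPoint r))
      where
      fix = half⇒double half 2⊗half refl

    fixedPoint-surjective : ∀ {x y z} → Fixed (x , y , z) → ∃ λ s → Regular s × fixedPoint s ≡ (x , y , z)
    fixedPoint-surjective {x} {y} {z} (fix , sol) = s , regular , cong₂ _,_ x≡ (cong₂ _,_ y≡ z≡)
      where
      curve = flipFixed⇒curve fix sol
      t = ⟦ 3 ⟧ ⊗ m ⊗ inv pr (z ⊕ ⟦ 2 ⟧)
      isZ : IsZ t z
      isZ = lem (inv pr (z ⊕ ⟦ 2 ⟧)) (inv-inverse pr (curve⇒z+2≢0 {y} curve))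
        where
        lem : ∀ w → (z ⊕ ⟦ 2 ⟧) ⊗ w ≡ ⟦ 1 ⟧ → (z ⊕ ⟦ 2 ⟧) ⊗ (⟦ 3 ⟧ ⊗ m ⊗ w) ≡ ⟦ 3 ⟧ ⊗ m
        lem w h = linear-combination (z ∷ w ∷ J ∷ [])
          (λ z w J → # 3 :* mᴾ J , (z :+ # 2) :* w := # 1 , (z :+ # 2) :* (# 3 :* mᴾ J :* w) := # 3 :* mᴾ J) h
      t≢0 : t ≢ ⟦ 0 ⟧
      t≢0 = IsZ⇒t≢0 {z = z} isZ
      6m≢0 : ⟦ 6 ⟧ ⊗ m ≢ ⟦ 0 ⟧
      6m≢0 h = ⊗≢0 pr 2≢0 3m≢0 (linear-combination (J ∷ [])
        (λ J → # 1 , # 6 :* mᴾ J := # 0 , # 2 :* (# 3 :* mᴾ J) := # 0) h)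
      s : F
      -- The parameter is obtained by solving `IsS`, which is linear in s.
      s = inv pr (⟦ 6 ⟧ ⊗ m) ⊗ ((⟦ 3 ⟧ ⊗ m ⊖ ⟦ 4 ⟧ ⊗ t) ⊗ (y ⊕ ⟦ 2 ⟧) ⊕ ⟦ 3 ⟧ ⊗ m ⊗ (j ⊗ t ⊖ ⟦ 2 ⟧))
      isS : IsS s t y
      isS = lem {⟦ 6 ⟧ ⊗ m} {inv pr (⟦ 6 ⟧ ⊗ m)} {(⟦ 3 ⟧ ⊗ m ⊖ ⟦ 4 ⟧ ⊗ t) ⊗ (y ⊕ ⟦ 2 ⟧) ⊕ ⟦ 3 ⟧ ⊗ m ⊗
          (j ⊗ t ⊖ ⟦ 2 ⟧)} (inv-inverse pr 6m≢0)
        where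
        lem : ∀ {a b w} → a ⊗ b ≡ ⟦ 1 ⟧ → a ⊗ (b ⊗ w) ≡ w
        lem {a} {b} {w} h = linear-combination (a ∷ b ∷ w ∷ []) (λ a b w → w , a :* b := # 1 , a :* (b :* w) := w) h
      inT′ = curve⇒inT {z = z} isZ curve
      isT = IsS⇒IsT inT′ isS
      isY = IsS⇒IsY {s} inT′ isS
      regular : Regular s
      regular = nonzero⇒regular isT t≢0 (IsY⇒denominator≢0 {s} t≢0 isY)
      tOf≡t : tOf s ≡ t
      tOf≡t = IsT-unique {s} (IsT-tOf s) isT
      shift : ∀ {a b} → a ⊕ ⟦ 2 ⟧ ≡ b ⊕ ⟦ 2 ⟧ → a ≡ b
      shift {a} {b} h = linear-combination (a ∷ b ∷ []) (λ a b → # 1 , a :+ # 2 := b :+ # 2 , a := b) h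
      y′ z′ : F
      y′ = proj₁ (proj₂ (fixedPoint s))
      z′ = proj₂ (proj₂ (fixedPoint s))
      y≡ : y′ ≡ y
      y≡ = shift (⊗-cancelˡ pr (regular⇒denominator≢0 isT regular)
          (trans (⊗-comm (denominator s t) (y′ ⊕ ⟦ 2 ⟧))
          (trans (subst (λ t → IsY s t y′) tOf≡t (IsY-fixedPoint regular))
          (trans (sym isY) (⊗-comm (y ⊕ ⟦ 2 ⟧) (denominator s t))))))
      z≡ : z′ ≡ z
      z≡ = shift (⊗-cancelˡ pr t≢0 (trans (⊗-comm t (z′ ⊕ ⟦ 2 ⟧))
          (trans (subst (λ t → IsZ t z′) tOf≡t (IsZ-fixedPoint regular)) (trans (sym isZ) (⊗-comm (z ⊕ ⟦ 2 ⟧) t)))))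
      x≡ : proj₁ (fixedPoint s) ≡ x
      x≡ = trans (cong₂ (λ y z → (y ⊗ z ⊖ C) ⊗ half) y≡ z≡) (sym (double⇒half half 2⊗half fix))

    -- The coordinate z determines t because z ≠ -2, and then y determines s through `IsS`.
    fixedPoint-injective : ∀ {s s′} → Regular s → Regular s′ → fixedPoint s ≡ fixedPoint s′ → s ≡ s′
    fixedPoint-injective {s} {s′} r r′ eq = lem
        (IsY⇒IsS (regular⇒t≢0 (IsT-tOf s) r) (regular⇒denominator≢0 (IsT-tOf s) r) (IsT-tOf s) (IsY-fixedPoint r))
        (subst₂ (λ t y → IsS s′ t y) (sym t≡t′) (cong (proj₁ ∘ proj₂) (sym eq))
          (IsY⇒IsS (regular⇒t≢0 (IsT-tOf s′) r′) (regular⇒denominator≢0 (IsT-tOf s′) r′) (IsT-tOf s′) (IsY-fixedPoint r′)))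
      where
      z+2 : F
      z+2 = proj₂ (proj₂ (fixedPoint s)) ⊕ ⟦ 2 ⟧
      z+2≢0 : z+2 ≢ ⟦ 0 ⟧
      z+2≢0 = curve⇒z+2≢0 {proj₁ (proj₂ (fixedPoint s))}
          (flipFixed⇒curve (proj₁ (fixedPoint-fixed r)) (proj₂ (fixedPoint-fixed r)))
      t≡t′ : tOf s ≡ tOf s′
      t≡t′ = ⊗-cancelˡ pr z+2≢0 (trans (IsZ-fixedPoint r)
          (sym (subst (λ z → IsZ (tOf s′) z) (cong (proj₂ ∘ proj₂) (sym eq)) (IsZ-fixedPoint r′))))
      lem : ∀ {w} → ⟦ 6 ⟧ ⊗ m ⊗ s ≡ w → ⟦ 6 ⟧ ⊗ m ⊗ s′ ≡ w → s ≡ s′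
      lem h h′ = cancel (⊗≢0 pr 2≢0 3m≢0) (lem₂ (trans h (sym h′)))
        where
        lem₂ : ⟦ 6 ⟧ ⊗ m ⊗ s ≡ ⟦ 6 ⟧ ⊗ m ⊗ s′ → (⟦ 2 ⟧ ⊗ (⟦ 3 ⟧ ⊗ m)) ⊗ (s ⊖ s′) ≡ ⟦ 0 ⟧
        lem₂ h = linear-combination (s ∷ s′ ∷ J ∷ [])
          (λ s s′ J →
            # 1 ,
            # 6 :* mᴾ J :* s := # 6 :* mᴾ J :* s′ ,
            # 2 :* (# 3 :* mᴾ J) :* (s :- s′) := # 0) h

    -- Vertices fixed by two or three flips

    solution-swap₁₂ : ∀ {x y z} → Solution C D (x , y , z) → Solution C D (y , x , z)
    solution-swap₁₂ {x} {y} {z} h = linear-combination (y ∷ x ∷ z ∷ J ∷ [])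
      (λ y x z J →
        # 1 ,
        x :* x :+ y :* y :+ z :* z := x :* y :* z :- Cᴾ J :* (x :+ y :+ z) :+ Dᴾ J ,
        y :* y :+ x :* x :+ z :* z := y :* x :* z :- Cᴾ J :* (y :+ x :+ z) :+ Dᴾ J) h

    solution-swap₂₃ : ∀ {x y z} → Solution C D (x , y , z) → Solution C D (x , z , y)
    solution-swap₂₃ {x} {y} {z} h = linear-combination (x ∷ z ∷ y ∷ J ∷ [])
      (λ x z y J →
        # 1 ,
        x :* x :+ y :* y :+ z :* z := x :* y :* z :- Cᴾ J :* (x :+ y :+ z) :+ Dᴾ J ,
        x :* x :+ z :* z :+ y :* y := x :* z :* y :- Cᴾ J :* (x :+ z :+ y) :+ Dᴾ J) h

    flipFixed-comm : ∀ {x y z} → FlipFixed x y z → FlipFixed x z y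
    flipFixed-comm {x} {y} {z} h = trans h (cong (_⊖ C) (⊗-comm y z))

    DoublyFixed : Triple → Set
    DoublyFixed (x , y , z) = FlipFixed x y z × FlipFixed y x z × Solution C D (x , y , z)

    -- The two fixing equations differ by (z + 2)(x - y) = 0.
    doublyFixed⇒x≡y : ∀ {x y z} → DoublyFixed (x , y , z) → x ≡ y
    doublyFixed⇒x≡y {x} {y} {z} (fix₁ , fix₂ , sol) =
      cancel (curve⇒z+2≢0 {y} (flipFixed⇒curve fix₁ sol)) (lem {C} fix₁ fix₂)
      where
      lem : ∀ {c} → ⟦ 2 ⟧ ⊗ x ≡ y ⊗ z ⊖ c → ⟦ 2 ⟧ ⊗ y ≡ x ⊗ z ⊖ c → (z ⊕ ⟦ 2 ⟧) ⊗ (x ⊖ y) ≡ ⟦ 0 ⟧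
      lem {c} h₁ h₂ = linear-combination₂ (z ∷ x ∷ y ∷ c ∷ [])
        (λ z x y c →
          # 1 ,
          # 2 :* x := y :* z :- c ,
          :- # 1 ,
          # 2 :* y := x :* z :- c ,
          (z :+ # 2) :* (x :- y) := # 0) h₁ h₂

    -- The fixing equation says (z - 2) x = C, and multiplying the surface equation by z - 2
    -- eliminates x. Conversely x = C / (z - 2) gives the doubly fixed vertex if C ≠ 0.
    doublyFixed⇒Cubic≡0 : ∀ {x z} → DoublyFixed (x , x , z) → Cubic z ≡ ⟦ 0 ⟧
    doublyFixed⇒Cubic≡0 {x} {z} (fix , _ , sol) =
      linear-combination₂ (z ∷ x ∷ J ∷ [])
        (λ z x J →
          z :- # 2 ,
          x :* x :+ x :* x :+ z :* z := x :* x :* z :- Cᴾ J :* (x :+ x :+ z) :+ Dᴾ J ,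
          :- ((z :- # 2) :* x :- Cᴾ J) ,
          # 2 :* x := x :* z :- Cᴾ J ,
          Cubicᴾ z J := # 0) sol fix

    module _ (C≢0 : C ≢ ⟦ 0 ⟧) where
      private
        z₀ x₀ : F
        z₀ = root e e³n
        x₀ = C ⊗ inv pr (z₀ ⊖ ⟦ 2 ⟧)

        x₀-fixed : FlipFixed x₀ x₀ z₀
        x₀-fixed = lem {C} z₀ (inv pr (z₀ ⊖ ⟦ 2 ⟧)) (inv-inverse pr (root≢2 e e³n C≢0))
          where
          lem : ∀ {c} z w → (z ⊖ ⟦ 2 ⟧) ⊗ w ≡ ⟦ 1 ⟧ → ⟦ 2 ⟧ ⊗ (c ⊗ w) ≡ (c ⊗ w) ⊗ z ⊖ c
          lem {c} z w h = linear-combination (c ∷ w ∷ z ∷ [])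
            (λ c w z → :- c , (z :- # 2) :* w := # 1 , # 2 :* (c :* w) := c :* w :* z :- c) h

        Cubic⇒solution : ∀ {x z} → z ⊖ ⟦ 2 ⟧ ≢ ⟦ 0 ⟧ → FlipFixed x x z → Cubic z ≡ ⟦ 0 ⟧ → Solution C D (x , x , z)
        Cubic⇒solution {x} {z} z≢2 fix h = cancel z≢2 (linear-combination₂ (z ∷ x ∷ J ∷ [])
          (λ z x J →
            # 1 ,
            Cubicᴾ z J := # 0 ,
            (z :- # 2) :* x :- Cᴾ J ,
            # 2 :* x := x :* z :- Cᴾ J ,
            (z :- # 2) :* (x :* x :+ x :* x :+ z :* z
              :- (x :* x :* z :- Cᴾ J :* (x :+ x :+ z) :+ Dᴾ J)) := # 0) h fix)

      doublyFixedPoint : Triple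
      doublyFixedPoint = x₀ , x₀ , z₀

      doublyFixedPoint-doublyFixed : DoublyFixed doublyFixedPoint
      doublyFixedPoint-doublyFixed = x₀-fixed , x₀-fixed , Cubic⇒solution (root≢2 e e³n C≢0) x₀-fixed (Cubic-root e e³n)

      doublyFixedPoint-unique : ∀ {x y z} → DoublyFixed (x , y , z) → (x , y , z) ≡ doublyFixedPoint
      doublyFixedPoint-unique {x} {y} {z} d = unique (doublyFixed⇒x≡y d) d
        where
        lem : ∀ {a c} z₀ → z ≡ z₀ → ⟦ 2 ⟧ ⊗ x ≡ x ⊗ z ⊖ c → ⟦ 2 ⟧ ⊗ a ≡ a ⊗ z₀ ⊖ c → (z₀ ⊖ ⟦ 2 ⟧) ⊗ (x ⊖ a) ≡ ⟦ 0 ⟧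
        lem {a} {c} _ refl h h′ = linear-combination₂ (z ∷ x ∷ a ∷ c ∷ [])
          (λ z x a c →
            :- # 1 ,
            # 2 :* x := x :* z :- c ,
            # 1 ,
            # 2 :* a := a :* z :- c ,
            (z :- # 2) :* (x :- a) := # 0) h h′
        unique : ∀ {y} → x ≡ y → DoublyFixed (x , y , z) → (x , y , z) ≡ doublyFixedPoint
        unique refl d@(fix , _) = cong₂ _,_ x≡x₀ (cong₂ _,_ x≡x₀ z≡z₀)
          where
          z≡z₀ : z ≡ z₀
          z≡z₀ = Cubic-root-unique e e³n z (doublyFixed⇒Cubic≡0 d)
          x≡x₀ : x ≡ x₀
          x≡x₀ = cancel (root≢2 e e³n C≢0) (lem {x₀} {C} z₀ z≡z₀ fix x₀-fixed)

    -- With x = y and C = 0 the two equations reduce to z² = D.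
    special⇒¬doublyFixed : ⟦ 3 ⟧ ⊗ (J ⊗ J) ≡ ⟦ 4 ⟧ → ∀ {x y z} → ¬ DoublyFixed (x , y , z)
    special⇒¬doublyFixed special {x} {y} {z} d = lem (doublyFixed⇒x≡y d) d
      where
      lem : ∀ {y} → x ≡ y → ¬ DoublyFixed (x , y , z)
      lem refl (fix , _ , sol) = special⇒D-nonSquare special z (trans {j = D ⊖ C ⊗ (x ⊕ z)}
        (linear-combination₂ (z ∷ x ∷ J ∷ [])
          (λ z x J →
            # 1 ,
            x :* x :+ x :* x :+ z :* z := x :* x :* z :- Cᴾ J :* (x :+ x :+ z) :+ Dᴾ J ,
            :- x ,
            # 2 :* x := x :* z :- Cᴾ J ,
            z :* z := Dᴾ J :- Cᴾ J :* (x :+ z)) sol fix)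
        (linear-combination (x ∷ z ∷ J ∷ [])
          (λ x z J → :- (x :+ z) , Cᴾ J := # 0 , Dᴾ J :- Cᴾ J :* (x :+ z) := Dᴾ J) (special⇒C≡0 special)))

    -- All coordinates would be equal to some t. Eliminating J gives (t + 2)² (t - 1)² = 0; here t =
    -- -2 is off the curve and t = 1 forces J = -1.
    ¬triplyFixed : ∀ {x y z} → FlipFixed x y z → FlipFixed y x z → FlipFixed z x y → ¬ Solution C D (x , y , z)
    ¬triplyFixed {x} {y} {z} fix₁ fix₂ fix₃ sol = diagonal
        (doublyFixed⇒x≡y (fix₁ , fix₂ , sol))
        (doublyFixed⇒x≡y (flipFixed-comm {x} {y} {z} fix₁ , fix₃ , solution-swap₂₃ sol)) fix₁ sol
      where
      diagonal : ∀ {x y z} → x ≡ y → x ≡ z → FlipFixed x y z → ¬ Solution C D (x , y , z)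
      diagonal {t} refl refl fix sol =
          ⊗≢0 pr (⊗≢0 pr t+2≢0 t+2≢0) (⊗≢0 pr t-1≢0 t-1≢0) square≡0
        where
        t+2≢0 : t ⊕ ⟦ 2 ⟧ ≢ ⟦ 0 ⟧
        t+2≢0 = curve⇒z+2≢0 {t} (flipFixed⇒curve fix sol)
        -- The fixing equation gives 3 J² = t² - 2 t + 4, which makes D linear in J; the surface
        -- equation then has the factor t + 2.
        linear-in-J : ⟦ 3 ⟧ ⊗ J ⊗ (t ⊖ ⟦ 4 ⟧) ≡ ⟦ 2 ⟧ ⊗ (t ⊗ t) ⊖ ⟦ 7 ⟧ ⊗ t ⊕ ⟦ 14 ⟧
        linear-in-J = cancel t+2≢0 (linear-combination₂ (t ∷ J ∷ [])
          (λ t J →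
            :- # 1 ,
            t :* t :+ t :* t :+ t :* t := t :* t :* t :- Cᴾ J :* (t :+ t :+ t) :+ Dᴾ J ,
            # 3 :* t :- # 3 :* J ,
            # 2 :* t := t :* t :- Cᴾ J ,
            (t :+ # 2) :* (# 3 :* J :* (t :- # 4) :- (# 2 :* (t :* t) :- # 7 :* t :+ # 14)) := # 0) sol fix)
        -- Square the linear relation and replace 3 J² by t² - 2 t + 4 once more.
        square≡0 : (t ⊕ ⟦ 2 ⟧) ⊗ (t ⊕ ⟦ 2 ⟧) ⊗ ((t ⊖ ⟦ 1 ⟧) ⊗ (t ⊖ ⟦ 1 ⟧)) ≡ ⟦ 0 ⟧
        square≡0 = linear-combination₂ (t ∷ J ∷ [])
          (λ t J →
            :- (# 3 :* J :* (t :- # 4) :+ (# 2 :* (t :* t) :- # 7 :* t :+ # 14)) ,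
            # 3 :* J :* (t :- # 4) := # 2 :* (t :* t) :- # 7 :* t :+ # 14 ,
            # 3 :* (t :- # 4) :* (t :- # 4) ,
            # 2 :* t := t :* t :- Cᴾ J ,
            (t :+ # 2) :* (t :+ # 2) :* ((t :- # 1) :* (t :- # 1)) := # 0) linear-in-J fix
        t-1≢0 : t ⊖ ⟦ 1 ⟧ ≢ ⟦ 0 ⟧
        t-1≢0 h = ⊗≢0 pr (⊗≢0 pr 3≢0 3≢0) n≢0 (linear-combination₂ (t ∷ J ∷ [])
          (λ t J →
            :- # 1 ,
            # 3 :* J :* (t :- # 4) := # 2 :* (t :* t) :- # 7 :* t :+ # 14 ,
            # 3 :* J :- # 2 :* t :+ # 5 ,
            t :- # 1 := # 0 ,
            # 3 :* # 3 :* nᴾ J := # 0) linear-in-J h)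

    -- Degrees in the Vieta graph

    open FiniteSimpleGraph (vietaGraph C D) using (vertices; unique; degree; #vertices; #deficient; #ofDegree)

    ∈-vertices⁺ : ∀ {v} → Solution C D v → v ∈ vertices
    ∈-vertices⁺ {x , y , z} sol = ∈-filter⁺ (solution? C D)
      (∈-cartesianProduct⁺ (∈-allFin x) (∈-cartesianProduct⁺ (∈-allFin y) (∈-allFin z))) sol

    ∈-vertices⁻ : ∀ {v} → v ∈ vertices → Solution C D v
    ∈-vertices⁻ v∈ = proj₂ (∈-filter⁻ (solution? C D) {xs = allTriples} v∈)

    #vertices≡sum : + #vertices ≡ sum (λ x → sum (λ y → sum (λ z → ι (solution? C D (x , y , z)))))
    #vertices≡sum = trans (length-filter-product (solution? C D) (λ x → x) (cartesianProduct (allFin p) (allFin p)))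
      (sum-cong-≗ λ x → trans (length-filter-product (λ yz → solution? C D (x , yz)) (λ y → y) (allFin p))
        (sum-cong-≗ λ y → length-filter-tabulate (λ z → solution? C D (x , y , z)) (λ z → z)))

    P₁ P₂ P₃ : Triple → Set
    P₁ (x , y , z) = FlipFixed x y z
    P₂ (x , y , z) = FlipFixed y x z
    P₃ (x , y , z) = FlipFixed z x y

    P₁? : Unary.Decidable P₁
    P₁? (x , y , z) = ⟦ 2 ⟧ ⊗ x ≟ y ⊗ z ⊖ C
    P₂? : Unary.Decidable P₂
    P₂? (x , y , z) = ⟦ 2 ⟧ ⊗ y ≟ x ⊗ z ⊖ C
    P₃? : Unary.Decidable P₃
    P₃? (x , y , z) = ⟦ 2 ⟧ ⊗ z ≟ x ⊗ y ⊖ C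

    module _ {P Q : Triple → Set} (P? : Unary.Decidable P) (Q? : Unary.Decidable Q)
      (f g : Triple → Triple) (fg : ∀ v → f (g v) ≡ v) (gf : ∀ v → g (f v) ≡ v)
      (P⇒Q : ∀ v → Solution C D v → P v → Solution C D (f v) × Q (f v))
      (Q⇒P : ∀ v → Solution C D v → Q v → Solution C D (g v) × P (g v)) where

      -- Applied to permutations of the coordinates, which preserve the surface, so that one flip
      -- and one pair of flips stand for all.
      count-symmetric : length (filter P? vertices) ≡ length (filter Q? vertices)
      count-symmetric = length-bijection f (Unique.filter⁺ P? unique) (Unique.filter⁺ Q? unique)
        (λ {v} {w} _ _ fv≡fw → trans (sym (gf v)) (trans (cong g fv≡fw) (gf w)))
        (λ {v} v∈ → let v∈V , Pv = ∈-filter⁻ P? v∈ ; sol , Qfv = P⇒Q v (∈-vertices⁻ v∈V) Pv in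
          ∈-filter⁺ Q? (∈-vertices⁺ sol) Qfv)
        (λ {w} w∈ → let w∈V , Qw = ∈-filter⁻ Q? w∈ ; sol , Pgw = Q⇒P w (∈-vertices⁻ w∈V) Qw in
          g w , ∈-filter⁺ P? (∈-vertices⁺ sol) Pgw , fg w)

    swap₁₂ swap₂₃ rotate rotate⁻¹ : Triple {p} → Triple {p}
    swap₁₂ (x , y , z)   = y , x , z
    swap₂₃ (x , y , z)   = x , z , y
    rotate (x , y , z)   = y , z , x
    rotate⁻¹ (x , y , z) = z , x , y

    regular? : Unary.Decidable Regular
    regular? s = ¬? (s ≟ ⟦ 1 ⟧) ×-dec ¬? (s ≟ ⊝ ⟦ 1 ⟧) ×-dec ¬? (s ≟ s₀)

    regulars : List F
    regulars = filter regular? (allFin p)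

    #regulars : length regulars ≡ p ∸ 3
    -- Prepending the three excluded values, which are distinct, gives a duplicate-free list of the
    -- whole field.
    #regulars = cong (_∸ 3) (trans (length-≡ {xs = ⟦ 1 ⟧ ∷ ⊝ ⟦ 1 ⟧ ∷ s₀ ∷ regulars} {ys = allFin p}
        ((1≢-1 ∷ (s₀≢1 ∘ sym) ∷ All.tabulate (λ s∈ 1≡s → proj₁ (regular s∈) (sym 1≡s)))
          ∷ ((s₀≢-1 ∘ sym) ∷ All.tabulate (λ s∈ -1≡s → proj₁ (proj₂ (regular s∈)) (sym -1≡s)))
          ∷ All.tabulate (λ s∈ s₀≡s → proj₂ (proj₂ (regular s∈)) (sym s₀≡s))
          ∷ Unique.filter⁺ regular? (Unique.allFin⁺ p))
        (Unique.allFin⁺ p) (λ {s} _ → ∈-allFin s) (λ {s} _ → classify s))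
      (length-tabulate {n = p} (λ s → s)))
      where
      regular : ∀ {s} → s ∈ regulars → Regular s
      regular s∈ = proj₂ (∈-filter⁻ regular? {xs = allFin p} s∈)
      classify : ∀ s → s ∈ ⟦ 1 ⟧ ∷ ⊝ ⟦ 1 ⟧ ∷ s₀ ∷ regulars
      classify s = case s ≟ ⟦ 1 ⟧ of λ where
        (yes s≡1) → here s≡1
        (no s≢1)  → case s ≟ ⊝ ⟦ 1 ⟧ of λ where
          (yes s≡-1) → there (here s≡-1)
          (no s≢-1)  → case s ≟ s₀ of λ where
            (yes s≡s₀) → there (there (here s≡s₀))
            (no s≢s₀)  → there (there (there (∈-filter⁺ regular? (∈-allFin s) (s≢1 , s≢-1 , s≢s₀))))

    #P₁ : length (filter P₁? vertices) ≡ p ∸ 3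
    #P₁ = trans (sym (length-bijection fixedPoint {xs = regulars} {ys = filter P₁? vertices}
        (Unique.filter⁺ regular? (Unique.allFin⁺ p)) (Unique.filter⁺ P₁? unique)
        (λ {s} {s′} s∈ s′∈ → fixedPoint-injective {s} {s′} (regular s∈) (regular s′∈))
        (λ {s} s∈ → let fix , sol = fixedPoint-fixed (regular s∈) in ∈-filter⁺ P₁? {fixedPoint s} (∈-vertices⁺ {fixedPoint s} sol) fix)
        from))
      #regulars
      where
      regular : ∀ {s} → s ∈ regulars → Regular s
      regular s∈ = proj₂ (∈-filter⁻ regular? {xs = allFin p} s∈)
      from : ∀ {v} → v ∈ filter P₁? vertices → ∃ λ s → s ∈ regulars × fixedPoint s ≡ v
      from {v} v∈ =
        let v∈V , fix = ∈-filter⁻ P₁? {xs = vertices} v∈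
            s , r , eq = fixedPoint-surjective (fix , ∈-vertices⁻ v∈V)
        in s , ∈-filter⁺ regular? (∈-allFin s) r , eq

    #P₂ : length (filter P₂? vertices) ≡ p ∸ 3
    #P₂ = trans (sym (count-symmetric P₁? P₂? swap₁₂ swap₁₂ (λ _ → refl) (λ _ → refl)
      (λ { (x , y , z) sol fix → solution-swap₁₂ {x} {y} {z} sol , fix })
      (λ { (x , y , z) sol fix → solution-swap₁₂ {x} {y} {z} sol , fix }))) #P₁

    #P₃ : length (filter P₃? vertices) ≡ p ∸ 3
    #P₃ = trans (sym (count-symmetric P₁? P₃? rotate rotate⁻¹ (λ _ → refl) (λ _ → refl)
      (λ { (x , y , z) sol fix → solution-swap₂₃ {y} {x} {z} (solution-swap₁₂ {x} {y} {z} sol) , fix })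
      (λ { (x , y , z) sol fix → solution-swap₁₂ {x} {z} {y} (solution-swap₂₃ {x} {y} {z} sol) , fix }))) #P₁

    #P₁₃ : length (filter (P₁? ∩? P₂?) vertices) ≡ length (filter (P₁? ∩? P₃?) vertices)
    #P₁₃ = count-symmetric (P₁? ∩? P₂?) (P₁? ∩? P₃?) swap₂₃ swap₂₃ (λ _ → refl) (λ _ → refl)
      (λ { (x , y , z) sol (fix₁ , fix₂) → solution-swap₂₃ {x} {y} {z} sol , flipFixed-comm {x} {y} {z} fix₁ , fix₂ })
      (λ { (x , y , z) sol (fix₁ , fix₃) → solution-swap₂₃ {x} {y} {z} sol , flipFixed-comm {x} {y} {z} fix₁ , fix₃ })

    #P₂₃ : length (filter (P₁? ∩? P₂?) vertices) ≡ length (filter (P₂? ∩? P₃?) vertices)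
    #P₂₃ = count-symmetric (P₁? ∩? P₂?) (P₂? ∩? P₃?) rotate⁻¹ rotate (λ _ → refl) (λ _ → refl)
      (λ { (x , y , z) sol (fix₁ , fix₂) → solution-swap₁₂ {x} {z} {y} (solution-swap₂₃ {x} {y} {z} sol) ,
             flipFixed-comm {x} {y} {z} fix₁ , flipFixed-comm {y} {x} {z} fix₂ })
      (λ { (x , y , z) sol (fix₂ , fix₃) → solution-swap₂₃ {y} {x} {z} (solution-swap₁₂ {x} {y} {z} sol) ,
             flipFixed-comm {y} {x} {z} fix₂ , flipFixed-comm {z} {x} {y} fix₃ })

    #P₁₂-generic : C ≢ ⟦ 0 ⟧ → length (filter (P₁? ∩? P₂?) vertices) ≡ 1
    #P₁₂-generic C≢0 = length-≡ {ys = v₀ ∷ []} (Unique.filter⁺ (P₁? ∩? P₂?) unique) ([] ∷ [])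
      (λ { {v} v∈ → let v∈V , fix₁ , fix₂ = ∈-filter⁻ (P₁? ∩? P₂?) {xs = vertices} v∈ in
        here (doublyFixedPoint-unique C≢0 (fix₁ , fix₂ , ∈-vertices⁻ v∈V)) })
      (λ { (here refl) → let fix₁ , fix₂ , sol = doublyFixedPoint-doublyFixed C≢0 in
        ∈-filter⁺ (P₁? ∩? P₂?) {v₀} (∈-vertices⁺ {v₀} sol) (fix₁ , fix₂) })
      where
      v₀ = doublyFixedPoint C≢0

    #P₁₂-special : ⟦ 3 ⟧ ⊗ (J ⊗ J) ≡ ⟦ 4 ⟧ → length (filter (P₁? ∩? P₂?) vertices) ≡ 0
    #P₁₂-special special = length-≡ {ys = []} (Unique.filter⁺ (P₁? ∩? P₂?) unique) []
      (λ {v} v∈ → let v∈V , fix₁ , fix₂ = ∈-filter⁻ (P₁? ∩? P₂?) {xs = vertices} v∈ in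
        contradiction (fix₁ , fix₂ , ∈-vertices⁻ v∈V) (special⇒¬doublyFixed special))
      (λ ())

    flip₁ flip₂ flip₃ : Triple → Triple
    flip₁ (x , y , z) = y ⊗ z ⊖ C ⊖ x , y , z
    flip₂ (x , y , z) = x , x ⊗ z ⊖ C ⊖ y , z
    flip₃ (x , y , z) = x , y , x ⊗ y ⊖ C ⊖ z

    flip₁-solution : ∀ {x y z} → Solution C D (x , y , z) → Solution C D (flip₁ (x , y , z))
    flip₁-solution {x} {y} {z} h = linear-combination (y ∷ z ∷ x ∷ J ∷ [])
      (λ y z x J →
        # 1 ,
        x :* x :+ y :* y :+ z :* z := x :* y :* z :- Cᴾ J :* (x :+ y :+ z) :+ Dᴾ J ,
        (y :* z :- Cᴾ J :- x) :* (y :* z :- Cᴾ J :- x) :+ y :* y :+ z :* z :=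
          (y :* z :- Cᴾ J :- x) :* y :* z :- Cᴾ J :* (y :* z :- Cᴾ J :- x :+ y :+ z) :+ Dᴾ J) h

    flip-solution : ∀ {v w} → Solution C D v → w ∈ flips C D v → Solution C D w
    flip-solution {x , y , z} sol (here refl) = flip₁-solution {x} {y} {z} sol
    flip-solution {x , y , z} sol (there (here refl)) =
      solution-swap₁₂ {x ⊗ z ⊖ C ⊖ y} {x} {z} (flip₁-solution {y} {x} {z} (solution-swap₁₂ {x} {y} {z} sol))
    flip-solution {x , y , z} sol (there (there (here refl))) =
      solution-swap₂₃ {x} {x ⊗ y ⊖ C ⊖ z} {y} (solution-swap₁₂ {x ⊗ y ⊖ C ⊖ z} {x} {y}
        (flip₁-solution {z} {x} {y} (solution-swap₁₂ {x} {z} {y} (solution-swap₂₃ {x} {y} {z} sol))))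

    a-[a-x]≡x : ∀ a x → a ⊖ (a ⊖ x) ≡ x
    a-[a-x]≡x a x = identity (a ∷ x ∷ []) (λ a x → a :- (a :- x) := x)

    flips-sym : ∀ {v w} → w ∈ flips C D v → v ∈ flips C D w
    flips-sym {x , y , z} (here refl)                 = here (cong (_, (y , z)) (sym (a-[a-x]≡x (y ⊗ z ⊖ C) x)))
    flips-sym {x , y , z} (there (here refl))         = there (here (cong (λ y → x , y , z) (sym (a-[a-x]≡x (x ⊗ z ⊖ C) y))))
    flips-sym {x , y , z} (there (there (here refl))) = there
        (there (here (cong (λ z → x , y , z) (sym (a-[a-x]≡x (x ⊗ y ⊖ C) z)))))

    -- Flips preserve the surface and are involutions, so both directions of the edge relation lead
    -- to flips of v. A coincidence between two different flips forces both to equal v, so the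
    -- remaining neighbours are distinct.
    degree-flips : ∀ {v} → Solution C D v → degree v ≡ length (filter (λ w → ¬? (v ≟ₜ w)) (flips C D v))
    degree-flips {v@(x , y , z)} sol = length-≡
      (Unique.filter⁺ (edge? C D v) unique)
      (filter-unique (λ w → ¬? (v ≟ₜ w)) (
        ((λ v≢f₁ _ f₁≡f₂ → v≢f₁ (cong (_, (y , z)) (sym (cong proj₁ f₁≡f₂)))) ∷
         (λ v≢f₁ _ f₁≡f₃ → v≢f₁ (cong (_, (y , z)) (sym (cong proj₁ f₁≡f₃)))) ∷ []) ∷
        ((λ v≢f₂ _ f₂≡f₃ → v≢f₂ (cong (λ y → x , y , z) (sym (cong (proj₁ ∘ proj₂) f₂≡f₃)))) ∷ []) ∷
        [] ∷ []))
      (λ w∈ → let _ , v≢w , e = ∈-filter⁻ (edge? C D v) {xs = vertices} w∈ in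
        ∈-filter⁺ (λ w → ¬? (v ≟ₜ w)) ([ (λ h → h) , flips-sym ]′ e) v≢w)
      (λ w∈ → let w∈flips , v≢w = ∈-filter⁻ (λ w → ¬? (v ≟ₜ w)) {xs = flips C D v} w∈ in
        ∈-filter⁺ (edge? C D v) (∈-vertices⁺ (flip-solution sol w∈flips)) (v≢w , inj₁ w∈flips))

    fixed⇔ : ∀ a x → (⟦ 2 ⟧ ⊗ x ≡ a → x ≡ a ⊖ x) × (x ≡ a ⊖ x → ⟦ 2 ⟧ ⊗ x ≡ a)
    fixed⇔ a x = (λ h → linear-combination (x ∷ a ∷ []) (λ x a → # 1 , # 2 :* x := a , x := a :- x) h) ,
        (λ h → linear-combination (x ∷ a ∷ []) (λ x a → # 1 , x := a :- x , # 2 :* x := a) h)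

    degree≡ : ∀ {v} → v ∈ vertices → 𝟙 (P₁? v) ℕ.+ 𝟙 (P₂? v) ℕ.+ 𝟙 (P₃? v) ℕ.+ degree v ≡ 3
    degree≡ {v@(x , y , z)} v∈ = trans
      (cong (λ d → 𝟙 (P₁? v) ℕ.+ 𝟙 (P₂? v) ℕ.+ 𝟙 (P₃? v) ℕ.+ d)
        (trans (degree-flips (∈-vertices⁻ v∈)) (length-filter (λ w → ¬? (v ≟ₜ w)) (flips C D v))))
      (arith {𝟙 (P₁? v)} {𝟙 (P₂? v)} {𝟙 (P₃? v)} {𝟙 (¬? (v ≟ₜ flip₁ v))} {𝟙 (¬? (v ≟ₜ flip₂ v))} {𝟙 (¬? (v ≟ₜ flip₃ v))}
             (complement (P₁? v) (v ≟ₜ flip₁ v)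
                (λ h → cong (_, (y , z)) (proj₁ (fixed⇔ (y ⊗ z ⊖ C) x) h))
                (λ h → proj₂ (fixed⇔ (y ⊗ z ⊖ C) x) (cong proj₁ h)))
             (complement (P₂? v) (v ≟ₜ flip₂ v)
                (λ h → cong (λ y → x , y , z) (proj₁ (fixed⇔ (x ⊗ z ⊖ C) y) h))
                (λ h → proj₂ (fixed⇔ (x ⊗ z ⊖ C) y) (cong (proj₁ ∘ proj₂) h)))
             (complement (P₃? v) (v ≟ₜ flip₃ v)
                (λ h → cong (λ z → x , y , z) (proj₁ (fixed⇔ (x ⊗ y ⊖ C) z) h))
                (λ h → proj₂ (fixed⇔ (x ⊗ y ⊖ C) z) (cong (proj₂ ∘ proj₂) h))))
      where
      complement : ∀ {A B : Set} (A? : Dec A) (B? : Dec B) → (A → B) → (B → A) → 𝟙 A? ℕ.+ 𝟙 (¬? B?) ≡ 1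
      complement (yes a) (yes b) f g = refl
      complement (yes a) (no ¬b) f g = contradiction (f a) ¬b
      complement (no ¬a) (yes b) f g = contradiction (g b) ¬a
      complement (no ¬a) (no ¬b) f g = refl
      arith : ∀ {a b c a′ b′ c′} → a ℕ.+ a′ ≡ 1 → b ℕ.+ b′ ≡ 1 → c ℕ.+ c′ ≡ 1 → a ℕ.+ b ℕ.+ c ℕ.+
          (a′ ℕ.+ (b′ ℕ.+ (c′ ℕ.+ 0))) ≡ 3
      arith {a} {b} {c} {a′} {b′} {c′} h₁ h₂ h₃ = trans (rearrange a b c a′ b′ c′) (cong₂ ℕ._+_ h₁ (cong₂ ℕ._+_ h₂ h₃))
        where
        rearrange : ∀ a b c a′ b′ c′ → a ℕ.+ b ℕ.+ c ℕ.+ (a′ ℕ.+ (b′ ℕ.+ (c′ ℕ.+ 0))) ≡ (a ℕ.+ a′) ℕ.+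
            ((b ℕ.+ b′) ℕ.+ (c ℕ.+ c′))
        rearrange = ℕ-Solver.solve-∀

    ¬P₁₂₃ : ∀ {v} → v ∈ vertices → P₁ v → P₂ v → ¬ P₃ v
    ¬P₁₂₃ {x , y , z} v∈ fix₁ fix₂ fix₃ = ¬triplyFixed fix₁ fix₂ fix₃ (∈-vertices⁻ v∈)

    module DegreeCount {r} (#P₁₂ : length (filter (P₁? ∩? P₂?) vertices) ≡ r) where
      private
        #P₁₃′ = trans (sym #P₁₃) #P₁₂
        #P₂₃′ = trans (sym #P₂₃) #P₁₂

      #ofDegree-0 : #ofDegree 0 ≡ 0
      #ofDegree-0 = #degree-0 P₁? P₂? P₃? degree vertices degree≡ ¬P₁₂₃ #P₁ #P₂ #P₃ #P₁₂ #P₁₃′ #P₂₃′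

      #ofDegree-1 : #ofDegree 1 ≡ 3 ℕ.* r
      #ofDegree-1 = #degree-1 P₁? P₂? P₃? degree vertices degree≡ ¬P₁₂₃ #P₁ #P₂ #P₃ #P₁₂ #P₁₃′ #P₂₃′

      #ofDegree-2 : #ofDegree 2 ℕ.+ (3 ℕ.* r ℕ.+ 3 ℕ.* r) ≡ 3 ℕ.* (p ∸ 3)
      #ofDegree-2 = #degree-2 P₁? P₂? P₃? degree vertices degree≡ ¬P₁₂₃ #P₁ #P₂ #P₃ #P₁₂ #P₁₃′ #P₂₃′

      #deficient≡ : #deficient ≡ #ofDegree 1 ℕ.+ #ofDegree 2
      #deficient≡ = #degree-<3 P₁? P₂? P₃? degree vertices degree≡ ¬P₁₂₃ #P₁ #P₂ #P₃ #P₁₂ #P₁₃′ #P₂₃′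

    private
      cancel-6 : ∀ {q d} → 5 ℕ.≤ q → d ℕ.+ 6 ≡ 3 ℕ.* (q ∸ 3) → d ≡ 3 ℕ.* (q ∸ 5)
      cancel-6 {q} {d} 5≤q h with ℕ.m≤n⇒∃[o]m+o≡n 5≤q
      ... | k , refl = ℕ.+-cancelʳ-≡ 6 d (3 ℕ.* k) (trans h (arith k))
        where
        arith : ∀ k → 3 ℕ.* (2 ℕ.+ k) ≡ 3 ℕ.* k ℕ.+ 6
        arith = ℕ-Solver.solve-∀

      3+3[q-5] : ∀ {q} → 5 ℕ.≤ q → 3 ℕ.+ 3 ℕ.* (q ∸ 5) ≡ 3 ℕ.* (q ∸ 4)
      3+3[q-5] {q} 5≤q with ℕ.m≤n⇒∃[o]m+o≡n 5≤q
      ... | k , refl = arith k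
        where
        arith : ∀ k → 3 ℕ.+ 3 ℕ.* k ≡ 3 ℕ.* (1 ℕ.+ k)
        arith = ℕ-Solver.solve-∀

    generic-counts : ⟦ 3 ⟧ ⊗ (J ⊗ J) ≢ ⟦ 4 ⟧ →
      + #vertices ≡ + (p ℕ.^ 2) ℤ.+ + 1 ℤ.+ + 2 ℤ.* σ (J ⊗ J ⊖ ⟦ 4 ⟧) ℤ.* + p
      × #deficient ≡ 3 ℕ.* (p ∸ 4) × #ofDegree 2 ≡ 3 ℕ.* (p ∸ 5) × #ofDegree 1 ≡ 3 × #ofDegree 0 ≡ 0
    generic-counts 3J²≢4 = trans #vertices≡sum (#solutions-generic C≢0) ,
        trans #deficient≡ (trans (cong₂ ℕ._+_ #ofDegree-1 #₂) (3+3[q-5] 5≤p)) , #₂ , #ofDegree-1 , #ofDegree-0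
      where
      C≢0 : C ≢ ⟦ 0 ⟧
      C≢0 h = 3J²≢4 (linear-combination (J ∷ []) (λ J → # 1 , Cᴾ J := # 0 , # 3 :* (J :* J) := # 4) h)
      -- Each of the three pairs of flips fixes one vertex, so r = 1: three vertices have degree 1,
      -- and 3 (p - 3) - 6 = 3 (p - 5) have degree 2.
      open DegreeCount (#P₁₂-generic C≢0)
      #₂ : #ofDegree 2 ≡ 3 ℕ.* (p ∸ 5)
      #₂ = cancel-6 5≤p #ofDegree-2

    special-counts : ⟦ 3 ⟧ ⊗ (J ⊗ J) ≡ ⟦ 4 ⟧ →
      + #vertices ≡ + (p ℕ.^ 2) ℤ.+ + 1 ℤ.- + 2 ℤ.* σ {p} ⟦ 2 ⟧ ℤ.* + p
      × #deficient ≡ 3 ℕ.* (p ∸ 3) × #ofDegree 2 ≡ 3 ℕ.* (p ∸ 3) × #ofDegree 1 ≡ 0 × #ofDegree 0 ≡ 0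
    special-counts 3J²≡4 = trans #vertices≡sum (#solutions-special 3J²≡4) ,
        trans #deficient≡ (cong₂ ℕ._+_ #ofDegree-1 #₂) , #₂ , #ofDegree-1 , #ofDegree-0
      where
      open DegreeCount (#P₁₂-special 3J²≡4)
      #₂ : #ofDegree 2 ≡ 3 ℕ.* (p ∸ 3)
      #₂ = trans (sym (ℕ.+-identityʳ (#ofDegree 2))) #ofDegree-2

theorem14p2 :
  (p : ℕ) .{{_ : NonZero p}} → Prime p → 5 ≤ p → p % 3 ≡ 2 →
  (J : 𝔽 p) → J ≢ ⟦ 2 ⟧ → J ≢ ⊝ ⟦ 2 ⟧ → J ≢ ⊝ ⟦ 1 ⟧ →
  let C = ⟦ 3 ⟧ ⊗ (J ⊗ J) ⊖ ⟦ 4 ⟧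
      D = ⟦ 9 ⟧ ⊗ (J ⊗ J ⊗ J) ⊖ ⟦ 36 ⟧ ⊗ J ⊖ ⟦ 28 ⟧
      open FiniteSimpleGraph (vietaGraph C D)
  in
  -- J² ≠ 4/3 and J² = 4/3, with the invertible denominator 3 cleared
  (⟦ 3 ⟧ ⊗ (J ⊗ J) ≢ ⟦ 4 ⟧ →
     + #vertices ≡ + (p ℕ.^ 2) ℤ.+ + 1 ℤ.+ + 2 ℤ.* σ (J ⊗ J ⊖ ⟦ 4 ⟧) ℤ.* + p
     × #deficient ≡ 3 ℕ.* (p ∸ 4)
     × #ofDegree 2 ≡ 3 ℕ.* (p ∸ 5)
     × #ofDegree 1 ≡ 3
     × #ofDegree 0 ≡ 0)
  ×
  (⟦ 3 ⟧ ⊗ (J ⊗ J) ≡ ⟦ 4 ⟧ →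
     + #vertices ≡ + (p ℕ.^ 2) ℤ.+ + 1 ℤ.- + 2 ℤ.* σ {p} ⟦ 2 ⟧ ℤ.* + p
     × #deficient ≡ 3 ℕ.* (p ∸ 3)
     × #ofDegree 2 ≡ 3 ℕ.* (p ∸ 3)
     × #ofDegree 1 ≡ 0
     × #ofDegree 0 ≡ 0)
theorem14p2 p pr 5≤p p%3≡2 J J≢2 J≢-2 J≢-1 = generic-counts , special-counts
  where open Surface pr 5≤p p%3≡2 J J≢2 J≢-2 J≢-1
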